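{- Let $G$ be a (finite, simple) plane graph with minimum degree five. Then $G$ contains at least one of the following minor $5$-stars: $\langle 5,7,7,5,17\rangle$, $\langle 5,7,8,5,11\rangle$, $\langle 5,7,5,8,8\rangle$, $\langle 8,5,5,11,6\rangle$, $\langle 8,5,5,8,7\rangle$, $\langle 8,5,5,7,8\rangle$, $\langle 8,5,5,6,9\rangle$, $\langle 5,6,5,8,11\rangle$, $\langle 5,6,6,5,\infty\rangle$, $\langle 5,6,6,6,17\rangle$, $\langle 6,6,6,6,11\rangle$, $\langle 6,6,6,7,8\rangle$, $\langle 6,6,7,6,8\rangle$, $\langle 5,6,6,11,7\rangle$, $\langle 5,6,11,6,7\rangle$, $\langle 5,6,6,8,8\rangle$, $\langle 5,6,8,6,8\rangle$, $\langle 5,7,6,8,7\rangle$, $\langle 5,6,7,7,7\rangle$, $\langle 5,6,6,7,11\rangle$, $\langle 5,6,7,6,11\rangle$, $\langle 5,7,6,7,8\rangle$, $\langle 5,7,7,6,8\rangle$, $\langle 5,7,6,6,14\rangle$, $\langle 5,8,6,6,11\rangle$, $\langle 5,5,7,6,14\rangle$, $\langle 5,6,7,5,35\rangle$, $\langle 5,6,8,5,15\rangle$, $\langle 5,6,9,5,10\rangle$, $\langle 5,6,11,5,9\rangle$, $\langle 5,5,10,5,12\rangle$, $\langle 5,7,11,5,8\rangle$, $\langle 5,6,5,7,14\rangle$, $\langle 5,5,9,5,17\rangle$.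
   Context: A plane graph is a graph embedded in the plane without edge crossings; $\deg(v)$ denotes the degree of $v$ in $G$. For integers (or $\infty$) $\kappa_1,\dots,\kappa_5$, a $\langle \kappa_1,\kappa_2,\kappa_3,\kappa_4,\kappa_5\rangle$-star in $G$ is a vertex $v$ of degree exactly $5$ together with its five neighbors $v_1,\dots,v_5$, listed in the cyclic order around $v$ given by the embedding (starting at some neighbor, in either orientation), such that $\deg(v_i)\le \kappa_i$ for $i=1,\dots,5$; the entry $\infty$ means no restriction. A star is called minor if its center has degree at most five; a minor $5$-star is thus a $5$-vertex together with its five neighbors. -}

module Defs where

open import Data.Nat using (ℕ; zero; suc; _+_; _*_; _≤_; _≡ᵇ_; _≤ᵇ_; _<ᵇ_)
open import Data.Nat.DivMod using (_mod_)
open import Data.Fin using (Fin; toℕ; cast)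
open import Data.Bool using (Bool; true; false; _∨_; _∧_; not; if_then_else_)
open import Data.List using (List; []; _∷_; map; concatMap; allFin; upTo; length)
open import Data.Nat.ListAction using (sum)
open import Data.Bool.ListAction using (all; any)
open import Data.Vec using (Vec; lookup) renaming ([] to []ᵥ; _∷_ to _∷ᵥ_)
open import Data.Maybe using (Maybe; just; nothing)
open import Data.Product using (Σ; Σ-syntax; _,_)
open import Data.Unit using (⊤)
open import Relation.Binary.PropositionalEquality using (_≡_; _≢_; sym)

-- A finite simple graph on vertex set Fin n together with a rotation
-- system: the neighbours of v, in the cyclic order around v given by the
-- embedding, are  nb v 0 , nb v 1 , … , nb v (deg v - 1).
-- rev v i is the position of v in the rotation of nb v i (so every edge is
-- seen from both ends, i.e. adjacency is symmetric).
record RotationGraph : Set where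
  field
    n        : ℕ
    deg      : Fin n → ℕ
    nb       : (v : Fin n) → Fin (deg v) → Fin n
    rev      : (v : Fin n) (i : Fin (deg v)) → Fin (deg (nb v i))
    nb-rev   : ∀ v i → nb (nb v i) (rev v i) ≡ v
    nb-inj   : ∀ v i j → nb v i ≡ nb v j → i ≡ j
    loopless : ∀ v i → nb v i ≢ v

module _ (G : RotationGraph) where
  open RotationGraph G

  next : {d : ℕ} → Fin d → Fin d
  next {suc m} i = suc (toℕ i) mod suc m

  Dart : Set
  Dart = Σ (Fin n) (λ v → Fin (deg v))

  allDarts : List Dart
  allDarts = concatMap (λ v → map (λ i → (v , i)) (allFin (deg v))) (allFin n)

  numDarts : ℕ
  numDarts = length allDarts

  -- face-tracing permutation (rotation ∘ edge involution)
  faceStep : Dart → Dart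
  faceStep (v , i) = (nb v i , next (rev v i))

  faceIter : ℕ → Dart → Dart
  faceIter zero d = d
  faceIter (suc k) d = faceIter k (faceStep d)

  dartLeq : Dart → Dart → Bool
  dartLeq (v , i) (w , j) =
    (toℕ v <ᵇ toℕ w) ∨ ((toℕ v ≡ᵇ toℕ w) ∧ (toℕ i ≤ᵇ toℕ j))

  count : {A : Set} → (A → Bool) → List A → ℕ
  count f xs = sum (map (λ x → if f x then 1 else 0) xs)

  isFaceRep : Dart → Bool
  isFaceRep d = all (λ k → dartLeq d (faceIter k d)) (upTo numDarts)

  -- number of faces of the rotation system (an isolated vertex has one face)
  numFaces : ℕ
  numFaces = count isFaceRep allDarts + count (λ v → deg v ≡ᵇ 0) (allFin n)

  reachStep : (Fin n → Bool) → (Fin n → Bool)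
  reachStep S u = S u ∨ any (λ i → S (nb u i)) (allFin (deg u))

  reachIter : ℕ → (Fin n → Bool) → (Fin n → Bool)
  reachIter zero S = S
  reachIter (suc k) S = reachIter k (reachStep S)

  reachable : Fin n → Fin n → Bool
  reachable v = reachIter n (λ u → toℕ v ≡ᵇ toℕ u)

  isCompRep : Fin n → Bool
  isCompRep v = all (λ u → not (reachable v u) ∨ (toℕ v ≤ᵇ toℕ u)) (allFin n)

  numComponents : ℕ
  numComponents = count isCompRep (allFin n)

  -- genus-zero condition: V - E + F = 2 c, i.e. every component is
  -- embedded in the sphere.  (Written as 2V + 2F = 2E + 4c, with 2E = #darts.)
  IsPlane : Set
  IsPlane = 2 * n + 2 * numFaces ≡ numDarts + 4 * numComponents

  MinDegree≥ : ℕ → Set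
  MinDegree≥ k = ∀ v → k ≤ deg v

  Bound : Set
  Bound = Maybe ℕ

  Fits : ℕ → Bound → Set
  Fits d nothing  = ⊤
  Fits d (just k) = d ≤ k

  -- position of the i-th listed neighbour: start s, orientation o
  pos : Fin 5 → Bool → Fin 5 → Fin 5
  pos s true  i = (toℕ s + toℕ i) mod 5
  pos s false i = (toℕ s + 4 * toℕ i) mod 5

  HasStar : Vec Bound 5 → Set
  HasStar κ =
    Σ[ v ∈ Fin n ] Σ[ e ∈ deg v ≡ 5 ] Σ[ s ∈ Fin 5 ] Σ[ o ∈ Bool ]
      (∀ (i : Fin 5) → Fits (deg (nb v (cast (sym e) (pos s o i)))) (lookup κ i))

∞ : Maybe ℕ
∞ = nothing

⟨_,_,_,_,_⟩ : Maybe ℕ → Maybe ℕ → Maybe ℕ → Maybe ℕ → Maybe ℕ → Vec (Maybe ℕ) 5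
⟨ a , b , c , d , e ⟩ = a ∷ᵥ b ∷ᵥ c ∷ᵥ d ∷ᵥ e ∷ᵥ []ᵥ

j : ℕ → Maybe ℕ
j = just

starList : List (Vec (Maybe ℕ) 5)
starList =
  ⟨ j 5 , j 7 , j 7 , j 5 , j 17 ⟩ ∷ ⟨ j 5 , j 7 , j 8 , j 5 , j 11 ⟩ ∷
  ⟨ j 5 , j 7 , j 5 , j 8 , j 8 ⟩ ∷ ⟨ j 8 , j 5 , j 5 , j 11 , j 6 ⟩ ∷
  ⟨ j 8 , j 5 , j 5 , j 8 , j 7 ⟩ ∷ ⟨ j 8 , j 5 , j 5 , j 7 , j 8 ⟩ ∷
  ⟨ j 8 , j 5 , j 5 , j 6 , j 9 ⟩ ∷ ⟨ j 5 , j 6 , j 5 , j 8 , j 11 ⟩ ∷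
  ⟨ j 5 , j 6 , j 6 , j 5 , ∞ ⟩ ∷ ⟨ j 5 , j 6 , j 6 , j 6 , j 17 ⟩ ∷
  ⟨ j 6 , j 6 , j 6 , j 6 , j 11 ⟩ ∷ ⟨ j 6 , j 6 , j 6 , j 7 , j 8 ⟩ ∷
  ⟨ j 6 , j 6 , j 7 , j 6 , j 8 ⟩ ∷ ⟨ j 5 , j 6 , j 6 , j 11 , j 7 ⟩ ∷
  ⟨ j 5 , j 6 , j 11 , j 6 , j 7 ⟩ ∷ ⟨ j 5 , j 6 , j 6 , j 8 , j 8 ⟩ ∷
  ⟨ j 5 , j 6 , j 8 , j 6 , j 8 ⟩ ∷ ⟨ j 5 , j 7 , j 6 , j 8 , j 7 ⟩ ∷
  ⟨ j 5 , j 6 , j 7 , j 7 , j 7 ⟩ ∷ ⟨ j 5 , j 6 , j 6 , j 7 , j 11 ⟩ ∷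
  ⟨ j 5 , j 6 , j 7 , j 6 , j 11 ⟩ ∷ ⟨ j 5 , j 7 , j 6 , j 7 , j 8 ⟩ ∷
  ⟨ j 5 , j 7 , j 7 , j 6 , j 8 ⟩ ∷ ⟨ j 5 , j 7 , j 6 , j 6 , j 14 ⟩ ∷
  ⟨ j 5 , j 8 , j 6 , j 6 , j 11 ⟩ ∷ ⟨ j 5 , j 5 , j 7 , j 6 , j 14 ⟩ ∷
  ⟨ j 5 , j 6 , j 7 , j 5 , j 35 ⟩ ∷ ⟨ j 5 , j 6 , j 8 , j 5 , j 15 ⟩ ∷
  ⟨ j 5 , j 6 , j 9 , j 5 , j 10 ⟩ ∷ ⟨ j 5 , j 6 , j 11 , j 5 , j 9 ⟩ ∷
  ⟨ j 5 , j 5 , j 10 , j 5 , j 12 ⟩ ∷ ⟨ j 5 , j 7 , j 11 , j 5 , j 8 ⟩ ∷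
  ⟨ j 5 , j 6 , j 5 , j 7 , j 14 ⟩ ∷ ⟨ j 5 , j 5 , j 9 , j 5 , j 17 ⟩ ∷ []

{-# OPTIONS --safe #-}
module Submission where

-- Let N v be the number of corners at v that lie on faces of length at least 4.
-- Euler's formula gives Σ (6 - deg v - N v / 2) > 0, so it suffices to move charge
-- so that in the absence of all listed stars nothing positive remains.  A vertex of
-- degree k ≥ 7 distributes its k - 6 among its 5-neighbours: (k - 6)/k to each, and
-- the share (k - 6)/k of every neighbour of degree ≥ 6 is split between the two
-- neighbours next to it in the rotation.  Around vertices of degree 7, 11 and 13 a
-- worst-case pattern would have to alternate along an odd cycle; the slack left by
-- this parity obstruction is spent on raising the shares.  The few 5-vertices still
-- lacking charge, such as those with neighbours 5, 5, 8, 5, 18, get it from adjacent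
-- 5-vertices.  That every 5-vertex now has charge at least 1 is a finite check over
-- classes of degrees.

open import Defs
open import Data.Nat using
  (ℕ; zero; suc; _+_; _*_; _∸_; _%_; _≤_; _<_; _≤ᵇ_; _<ᵇ_; _≡ᵇ_; _≤?_; _≟_; z≤n; s≤s; NonZero)
open import Data.List.Relation.Unary.Any using (Any; here; there; index)
open import Data.Bool using (Bool; true; false; _∧_; _∨_; not; if_then_else_; T)
open import Data.Bool.ListAction using (any; all)
open import Data.Bool.Properties using (∧-comm; ∨-comm; ∨-zeroʳ; not-involutive)
open import Data.Empty using (⊥; ⊥-elim)
open import Data.Fin as Fin using (Fin; toℕ; cast)
open import Data.Fin.Properties as Finₚ using (toℕ-fromℕ<; toℕ-injective; toℕ<n)
open import Data.List as List
  using (List; []; _∷_; _++_; map; concatMap; allFin; tabulate; applyUpTo; upTo; length)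
open import Data.List.Membership.Propositional using (_∈_)
open import Data.List.Membership.Propositional.Properties
  using (∈-concatMap⁺; ∈-map⁺; ∈-map⁻; ∈-allFin; ∈-upTo⁺)
open import Data.List.Membership.Propositional.Properties.WithK using (unique∧set⇒bag)
open import Data.List.Properties using (map-++; map-∘; map-tabulate; length-tabulate)
open import Data.List.Relation.Binary.BagAndSetEquality using (∼bag⇒↭)
open import Data.List.Relation.Binary.Permutation.Propositional using (_↭_)
import Data.List.Relation.Binary.Permutation.Propositional.Properties as Perm
import Data.List.Relation.Unary.All as AllM
import Data.List.Relation.Unary.All.Properties as All
import Data.List.Relation.Unary.AllPairs.Properties as AllPairs
import Data.List.Relation.Unary.Any as Any
open import Data.List.Relation.Unary.Any.Properties using (lookup-index)
open import Data.List.Relation.Unary.Unique.Propositional using (Unique)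
import Data.List.Relation.Unary.Unique.Propositional.Properties as Unique
open import Data.Maybe using (Maybe; just; nothing)
open import Data.Nat.DivMod using (_mod_; %-distribˡ-+; [m+n]%n≡m%n; m<n⇒m%n≡m; m%n<n; m%n%n≡m%n; n%n≡0)
open import Data.Nat.ListAction using (sum)
open import Data.Nat.ListAction.Properties using (sum-↭; sum-++)
open import Data.Nat.Properties hiding (_≤?_; _≟_)
open import Data.Nat.Tactic.RingSolver using (solve-∀)
open import Data.Product using (Σ; Σ-syntax; ∃-syntax; _×_; _,_; proj₁; proj₂)
open import Data.Product.Properties using (≡-dec)
open import Data.Sum using (_⊎_; inj₁; inj₂; [_,_]′)
open import Data.Vec using (Vec; []; _∷_; lookup)
open import Function.Bundles using (mk⇔)
open import Relation.Binary.PropositionalEquality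
open import Relation.Nullary using (¬_; Dec; yes; no; does)
open import Relation.Nullary.Decidable using (from-yes; map′)


-- Degree classes and discharging rules

-- A face of length k enters Euler's formula with a surplus of 2(k - 3), which is at least k/2 once
-- k ≥ 4. Half a unit for each of its corners is therefore available, and this is the origin of N v
-- / 2; it takes the place of a triangulation of the graph. A 5-vertex with two corners off
-- triangles then needs nothing. One with a single such corner needs half a unit, but across that
-- corner the rotations at its neighbours are unknown. One with triangles all around needs a whole
-- unit, and its neighbours' rotations are partly known. Even shares are not enough because the list
-- is tight. No listed star covers the neighbourhood 5, 6, 9, 5, 11. There the 9-vertex gives half a
-- unit, so the 11-vertex must give the other half, which is a tenth of its charge 5 and not an
-- eleventh. Eleven such claims would exceed the charge, and only parity excludes them.

-- The classes refine every degree bound of the list, and within a class the smallest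
-- degree is the worst for charge.
data Cls : Set where
  c5 c6 c7 c8 c9 c10 c11 c12 c13 c14 c15 c16-17 c18-35 c36+ : Cls

classes : List Cls
classes = c5 ∷ c6 ∷ c7 ∷ c8 ∷ c9 ∷ c10 ∷ c11 ∷ c12 ∷ c13 ∷ c14 ∷ c15 ∷ c16-17 ∷ c18-35 ∷ c36+ ∷ []

lower : Cls → ℕ
lower c5 = 5
lower c6 = 6
lower c7 = 7
lower c8 = 8
lower c9 = 9
lower c10 = 10
lower c11 = 11
lower c12 = 12
lower c13 = 13
lower c14 = 14
lower c15 = 15
lower c16-17 = 16
lower c18-35 = 18
lower c36+ = 36

_≥ᶜ_ : Cls → ℕ → Bool
c ≥ᶜ k = k ≤ᵇ lower c

is5 : Cls → Bool
is5 c5 = true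
is5 _ = false

is6 is10 is11 : Cls → Bool
is6 c6 = true
is6 _ = false
is10 c10 = true
is10 _ = false
is11 c11 = true
is11 _ = false

big : Cls → Bool
big c = not (is5 c)

bit : Bool → ℕ
bit true = 1
bit false = 0

-- From here on charge is measured in units of 1/1680.  half c is half of (k - 6)/k for
-- the smallest k in the class c; degrees 7, 11 and 13 have rules of their own.
half : Cls → ℕ
half c8 = 210
half c9 = 280
half c10 = 336
half c12 = 420
half c14 = 480
half c15 = 504
half c16-17 = 525
half c18-35 = 560
half c36+ = 700
half _ = 0

-- What a 5-vertex v takes from a neighbour K.  The bits say which neighbours of K have
-- degree at least 6, at distance 1 (l₁, r₁) and 2 (l₂, r₂) from v in the rotation at K.
-- o₁ and o₂ are the neighbours of v not next to K in the rotation at v, and the last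
-- bit tells whether all corners of v, except possibly the one between o₁ and o₂, lie
-- on triangles.
take7 : (l₂ l₁ r₁ r₂ : Bool) → ℕ
take7 _ true true _ = 560
take7 _ true false _ = 280
take7 _ false true _ = 280
take7 l₂ false false r₂ = if l₂ ∨ r₂ then 280 else 240

-- The budget is 8400, and 840 is a tenth of it. If `o₁` and `o₂` have degree at least 9 and all
-- corners are triangles, each gives 3 * 280 = 840, so nothing is needed here; at degree 8 each
-- gives 3 * 210 = 630, which leaves 420. The excess of 1008 over 840 is the 168 of rule Y.
take11 : (l₂ l₁ r₁ r₂ : Bool) → (o₁ o₂ : Cls) → Bool → ℕ
take11 _ true true _ _ _ _ = 1500
take11 _ true false r₂ _ _ _ = if r₂ then 1008 else 840
take11 l₂ false true _ _ _ _ = if l₂ then 1008 else 840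
take11 _ false false _ o₁ o₂ false = 420
take11 _ false false _ o₁ o₂ true =
  if (o₁ ≥ᶜ 8) ∧ (o₂ ≥ᶜ 8) then (if (o₁ ≥ᶜ 9) ∧ (o₂ ≥ᶜ 9) then 0 else 420) else 840

-- The budget 11760 is used up by twelve shares of 924 and one of 672, and likewise, around a single
-- big neighbour, by two shares of 1260 and ten of 924.
take13 : (l₁ r₁ : Bool) → (o₁ o₂ : Cls) → Bool → ℕ
take13 true true _ _ _ = 1680
take13 true false _ _ _ = 1260
take13 false true _ _ _ = 1260
take13 false false _ _ false = 672
take13 false false o₁ o₂ true = if (o₁ ≥ᶜ 8) ∧ (o₂ ≥ᶜ 8) then 672 else 924

takeF : Cls → (l₂ l₁ r₁ r₂ : Bool) → (o₁ o₂ : Cls) → Bool → ℕ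
takeF c7 l₂ l₁ r₁ r₂ _ _ _ = take7 l₂ l₁ r₁ r₂
takeF c11 l₂ l₁ r₁ r₂ o₁ o₂ reg = take11 l₂ l₁ r₁ r₂ o₁ o₂ reg
takeF c13 _ l₁ r₁ _ o₁ o₂ reg = take13 l₁ r₁ o₁ o₂ reg
takeF c _ l₁ r₁ _ _ _ _ = half c * (2 + bit l₁ + bit r₁)

-- Second round.  A poor 5-vertex has neighbours x, K, y, B, z in cyclic order with x, y
-- and z of degree 5, and lacks up to amount K B.  Let m be the neighbour of x next to K
-- other than the poor vertex.  The payer is x if deg m ≥ 6 or some face at x is not a
-- triangle (rule X), else z (rule Z).  A 5-vertex with neighbours of degrees
-- 5, 11, 6, 5, 10 gets 168 from the first of these (rule Y).  Payments are charged to K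
-- for rule X, to B for rule Z and to the 10-vertex for rule Y.
chargeX : Cls → ℕ
chargeX c7 = 40
chargeX c8 = 140
chargeX c10 = 84
chargeX _ = 0

chargeZ : Cls → ℕ
chargeZ c13 = 84
chargeZ c14 = 84
chargeZ c15 = 84
chargeZ c16-17 = 84
chargeZ c18-35 = 140
chargeZ c36+ = 140
chargeZ _ = 0

chargeY : Cls → ℕ
chargeY c10 = 168
chargeY _ = 0

-- What remains of the smallest possible contribution of a neighbour when all payments
-- that can be charged to it are made.
low : Cls → ℕ
low c7 = 160
low c8 = 140
low c9 = 560
low c10 = 168
low c12 = 840
low c13 = 504
low c14 = 792
low c15 = 840
low c16-17 = 882
low c18-35 = 840
low c36+ = 1120
low _ = 0

-- If m above has degree at least 6 and K has degree 7, then K itself contributes the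
-- missing 40 by the last clause of take7.
chargeX′ : Cls → ℕ
chargeX′ c7 = 0
chargeX′ c = chargeX c

amount : Cls → Cls → ℕ
amount c7 c36+ = 40
amount c8 c18-35 = 140
amount c8 c36+ = 140
amount c10 c13 = 84
amount c10 c14 = 84
amount c10 c15 = 84
amount c10 c16-17 = 84
amount c10 c18-35 = 84
amount c10 c36+ = 84
amount _ _ = 0

-- Payments of a 5-vertex with neighbours a, b, c, d, e to the neighbour a; the suffix N
-- marks bounds that do not assume its faces to be triangles.
paysX paysZ paysY paysXN paysZN paysYN : (a b c d e : Cls) → ℕ
paysX a b c d e = if is5 a ∧ is5 e ∧ big c then chargeX′ b else 0
paysZ a b c d e =
  if is5 a ∧ is5 b ∧ (e ≥ᶜ 13) ∧ (c ≥ᶜ 13) then (if (e ≥ᶜ 18) ∧ (c ≥ᶜ 18) then 140 else 84) else 0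
paysY a b c d e = if is5 a ∧ is11 b ∧ is5 c then chargeY e else 0
paysXN a b c d e = if is5 a ∧ is5 e then chargeX b else 0
paysZN a b c d e = if is5 a ∧ is5 b then chargeZ e else 0
paysYN a b c d e = if is5 a ∧ is11 b then chargeY e else 0

pays paysN : (a b c d e : Cls) → ℕ
pays a b c d e = paysX a b c d e + paysZ a b c d e + paysY a b c d e
paysN a b c d e = paysXN a b c d e + paysZN a b c d e + paysYN a b c d e

rots : {A : Set} (a b c d e : Cls) → (Cls → Cls → Cls → Cls → Cls → A) → List A
rots a b c d e f =
  f a b c d e ∷ f b c d e a ∷ f c d e a b ∷ f d e a b c ∷ f e a b c d ∷
  f a e d c b ∷ f b a e d c ∷ f c b a e d ∷ f d c b a e ∷ f e d c b a ∷ []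

fitsᶜ : Cls → Maybe ℕ → Bool
fitsᶜ _ nothing = true
fitsᶜ c5 (just k) = 5 ≤ᵇ k
fitsᶜ c16-17 (just k) = 17 ≤ᵇ k
fitsᶜ c18-35 (just k) = 35 ≤ᵇ k
fitsᶜ c36+ (just _) = false
fitsᶜ c (just k) = lower c ≤ᵇ k

fitsStar : Vec (Maybe ℕ) 5 → (a b c d e : Cls) → Bool
fitsStar (p ∷ q ∷ r ∷ s ∷ t ∷ []) a b c d e =
  fitsᶜ a p ∧ fitsᶜ b q ∧ fitsᶜ c r ∧ fitsᶜ d s ∧ fitsᶜ e t

covered : (a b c d e : Cls) → Bool
covered a b c d e = any (λ f → f) (rots a b c d e (λ a b c d e → any (λ κ → fitsStar κ a b c d e) starList))

lowTake takes : (a b c d e : Cls) → ℕ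
lowTake a b c d e = takeF a false (big b) (big e) false c d true
takes a b c d e = lowTake a b c d e + lowTake b c d e a + lowTake c d e a b + lowTake d e a b c + lowTake e a b c d

poor₁ poor₂ : ℕ → (a b c d e : Cls) → Bool
poor₁ r a b c d e = is5 a ∧ is5 c ∧ is5 e ∧ (r ≤ᵇ takes a b c d e + amount b d)
poor₂ r a b c d e = is5 a ∧ is11 b ∧ is6 c ∧ is5 d ∧ is10 e ∧ (r ≤ᵇ takes a b c d e + 168)

full-ok₁ : ℕ → (a b c d e : Cls) → Bool
full-ok₁ r a b c d e = (r ≤ᵇ takes a b c d e) ∨
  any (λ x → x) (rots a b c d e (poor₁ r)) ∨ any (λ x → x) (rots a b c d e (poor₂ r))

-- The sum over `rots` is all that the vertex may itself have to pay in the second round, so the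
-- check also settles vertices that both pay and receive.
full-ok : (a b c d e : Cls) → Bool
full-ok a b c d e = full-ok₁ (1680 + sum (rots a b c d e pays)) a b c d e

-- Here the corner between e and a is the only one not on a triangle, so that the
-- neighbours of a and e across it in their rotations are unknown.
takesN : (a b c d e : Cls) → ℕ
takesN a b c d e =
  takeF a false (big b) false false c d false + takeF b false (big c) (big a) false d e false +
  takeF c false (big d) (big b) false e a true + takeF d false (big e) (big c) false a b false +
  takeF e false false (big d) false b c false

-- The corner off triangles supplies the other 840. Only vertices with triangles at all corners are
-- paid, so `a` and `e`, which lie beside that corner, receive nothing; `b`, `c` and `d` are counted
-- in both orientations.
one-ok : (a b c d e : Cls) → Bool
one-ok a b c d e =
  840 + (paysN b c d e a + paysN b a e d c + paysN c d e a b + paysN c b a e d + paysN d e a b c + paysN d c b a e)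
    ≤ᵇ takesN a b c d e

forClasses : (Cls → Bool) → Bool
forClasses f = all f classes

-- Branches on which the charge reaches m by low alone are pruned.
search : ∀ {n} → ℕ → (Vec Cls n → Bool) → ℕ → Bool
search {zero} m ok l = ok []
search {suc n} m ok l = forClasses λ c → (m ≤ᵇ l + low c) ∨ search m (λ cs → ok (c ∷ cs)) (l + low c)

or-covered : (Cls → Cls → Cls → Cls → Cls → Bool) → Vec Cls 5 → Bool
or-covered ok (a ∷ b ∷ c ∷ d ∷ e ∷ []) = ok a b c d e ∨ covered a b c d e

-- Cyclic patterns of big neighbours and 5-neighbours

windows : (Bool → Bool → Bool → Bool → ℕ) → List Bool → ℕ
windows u (a ∷ bs@(b ∷ x ∷ c ∷ d ∷ _)) = (if x then 0 else u a b c d) + windows u bs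
windows u _ = 0

forBits : ℕ → (List Bool → Bool) → Bool
forBits zero f = f []
forBits (suc k) f = forBits k (λ xs → f (true ∷ xs)) ∧ forBits k (λ xs → f (false ∷ xs))

∧-left : ∀ {a b} → a ∧ b ≡ true → a ≡ true
∧-left {true} _ = refl

∧-right : ∀ {a b} → a ∧ b ≡ true → b ≡ true
∧-right {true} p = p

forBits-sound : ∀ k f → forBits k f ≡ true → ∀ xs → length xs ≡ k → f xs ≡ true
forBits-sound zero f p [] refl = p
forBits-sound (suc k) f p (true ∷ xs) refl = forBits-sound k _ (∧-left p) xs refl
forBits-sound (suc k) f p (false ∷ xs) refl =
  forBits-sound k _ (∧-right {forBits k (λ xs → f (true ∷ xs))} p) xs refl

cyclic : (Bool → Bool → Bool → Bool → ℕ) → List Bool → ℕ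
cyclic u xs = windows u (xs ++ List.take 4 xs)

-- Attained by seven 5-neighbours, with 7 * 240, and by three big neighbours no two of which are
-- consecutive, with 2 * 560 + 2 * 280. As 7 is odd, two 5-neighbours are then consecutive, and this
-- is what permits 560 between two big ones.
bound7 : forBits 7 (λ xs → cyclic take7 xs ≤ᵇ 1680) ≡ true
bound7 = refl

-- Outer neighbours of class `c5` together with regularity select the largest share, so the bit
-- patterns can be bounded without knowledge of the outer neighbours.
upper11 upper13 : (l₂ l₁ r₁ r₂ : Bool) → ℕ
upper11 l₂ l₁ r₁ r₂ = take11 l₂ l₁ r₁ r₂ c5 c5 true
upper13 _ l₁ r₁ _ = take13 l₁ r₁ c5 c5 true

-- One big neighbour attains the bound with 10 * 840. Eleven 5-neighbours would break it with 11 *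
-- 840 = 9240; that pattern is excluded here and left to the parity argument.
bound11 : forBits 11 (λ xs → not (any (λ x → x) xs) ∨ (cyclic upper11 xs ≤ᵇ 8400)) ≡ true
bound11 = refl

bound13 : forBits 13 (λ xs → not (any (λ x → x) xs) ∨ (cyclic upper13 xs ≤ᵇ 11760)) ≡ true
bound13 = refl

∑ : ℕ → (ℕ → ℕ) → ℕ
∑ zero f = 0
∑ (suc k) f = f 0 + ∑ k (λ j → f (suc j))

cls : ℕ → Cls
cls 6 = c6
cls 7 = c7
cls 8 = c8
cls 9 = c9
cls 10 = c10
cls 11 = c11
cls 12 = c12
cls 13 = c13
cls 14 = c14
cls 15 = c15
cls 16 = c16-17
cls 17 = c16-17
cls (suc (suc (suc (suc (suc (suc (suc (suc (suc (suc (suc (suc (suc (suc (suc (suc (suc (suc k)))))))))))))))))) =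
  if k ≤ᵇ 17 then c18-35 else c36+
cls _ = c5

is5-≡ : ∀ {c} → is5 c ≡ true → c ≡ c5
is5-≡ {c5} _ = refl

is6-≡ : ∀ {c} → is6 c ≡ true → c ≡ c6
is6-≡ {c6} _ = refl

is10-≡ : ∀ {c} → is10 c ≡ true → c ≡ c10
is10-≡ {c10} _ = refl

is11-≡ : ∀ {c} → is11 c ≡ true → c ≡ c11
is11-≡ {c11} _ = refl

amount′ : Cls → Cls → ℕ
amount′ c7 _ = 0
amount′ c b = amount c b

iterate : {A : Set} → (A → A) → ℕ → A → A
iterate f zero x = x
iterate f (suc k) x = iterate f k (f x)

-- Dart systems

-- Darts with the next and previous dart around the same source (N, P), the reversed
-- dart (R) and the degree of the source; tri d says that the corner between P d and d
-- lies on a triangle.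
record DartSystem : Set₁ where
  field
    D : Set
    N P R : D → D
    dg : D → ℕ
    NP : ∀ d → N (P d) ≡ d
    PN : ∀ d → P (N d) ≡ d
    RR : ∀ d → R (R d) ≡ d
    dgN : ∀ d → dg (N d) ≡ dg d
    period : ∀ d → iterate N (dg d) d ≡ d
    5≤dg : ∀ d → 5 ≤ dg d
    tri : D → Bool
    tri-sound : ∀ d → tri d ≡ true → N (R (N (R (N (R d))))) ≡ d
    tri-complete : ∀ d → N (R (N (R (N (R d))))) ≡ d → tri d ≡ true

  -- Either orientation, so that each configuration is treated together with its mirror
  -- image.
  S : Bool → D → D
  S true = N
  S false = P

  t : D → Cls
  t d = cls (dg (R d))

  star : {A : Set} → Bool → D → (Cls → Cls → Cls → Cls → Cls → A) → A
  star o d f = f (t d) (t (S o d)) (t (S o (S o d))) (t (S o (S o (S o d)))) (t (S o (S o (S o (S o d)))))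

  corner : Bool → D → Bool
  corner true d = tri (N d)
  corner false d = tri d

  full : D → Bool
  full d = tri d ∧ tri (N d) ∧ tri (N (N d)) ∧ tri (N (N (N d))) ∧ tri (N (N (N (N d))))

  reg : D → Bool
  reg d = corner true d ∧ corner false d ∧ corner true (N d) ∧ corner false (P d)

  take : D → ℕ
  take d = if is5 (t d)
    then takeF (cls (dg d)) (big (t (P (P d)))) (big (t (P d))) (big (t (N d))) (big (t (N (N d))))
           (t (N (N (R d)))) (t (P (P (R d)))) (reg (R d))
    else 0

  poorAt : Bool → D → Bool
  poorAt o e = is5 (cls (dg e)) ∧ full e ∧ is5 (t e) ∧ is5 (t (S o (S o e))) ∧ is5 (t (S o (S o (S o (S o e)))))

  need need′ : Bool → D → ℕ
  need o e = amount (t (S o e)) (t (S o (S o (S o e))))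
  need′ o e = amount′ (t (S o e)) (t (S o (S o (S o e))))

  beyond : Bool → D → Cls
  beyond o d = t (S (not o) (S (not o) d))

  -- The amounts paid along d, from its source to its target.
  payX payZ payY : Bool → D → ℕ
  payX o d = if poorAt o (R d)
    then (if full d then (if big (beyond o d) then need′ o (R d) else 0) else need o (R d))
    else 0
  payZ o d = if poorAt o e ∧ full (R e) ∧ is5 (beyond o (R e)) then need o e else 0
    where
    e = S o (R d)
  payY o d = if is5 (cls (dg e)) ∧ full e ∧ is5 (t e) ∧ is11 (t (S o e)) ∧ is6 (t (S o (S o e))) ∧
                is5 (t (S o (S o (S o e)))) ∧ is10 (t (S o (S o (S o (S o e))))) ∧ (not (full d) ∨ is5 (beyond o d))
    then 168 else 0
    where
    e = R d

  pay : Bool → D → ℕ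
  pay o d = payX o d + payZ o d + payY o d

  S-inv : ∀ o d → S o (S (not o) d) ≡ d
  S-inv true = NP
  S-inv false = PN

  S-inv′ : ∀ o d → S (not o) (S o d) ≡ d
  S-inv′ true = PN
  S-inv′ false = NP

  dgS : ∀ o d → dg (S o d) ≡ dg d
  dgS true d = dgN d
  dgS false d = trans (sym (dgN (P d))) (cong dg (NP d))

  N⁵ : ∀ d → dg d ≡ 5 → N (N (N (N (N d)))) ≡ d
  N⁵ d p = trans (cong (λ k → iterate N k d) (sym p)) (period d)

  S⁵ : ∀ o d → dg d ≡ 5 → S o (S o (S o (S o (S o d)))) ≡ d
  S⁵ true d p = N⁵ d p
  S⁵ false d p = trans (cong (λ x → P (P (P (P (P x))))) (sym (N⁵ d p)))
    (trans (cong (λ x → P (P (P (P x)))) (PN _)) (trans (cong (λ x → P (P (P x))) (PN _))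
    (trans (cong (λ x → P (P x)) (PN _)) (trans (cong P (PN _)) (PN _)))))

  S⁴ : ∀ o d → dg d ≡ 5 → S o (S o (S o (S o d))) ≡ S (not o) d
  S⁴ o d p = trans (sym (S-inv′ o _)) (cong (S (not o)) (S⁵ o d p))

  S³ : ∀ o d → dg d ≡ 5 → S o (S o (S o d)) ≡ S (not o) (S (not o) d)
  S³ o d p = trans (sym (S-inv′ o _)) (cong (S (not o)) (S⁴ o d p))

  S² : ∀ o d → dg d ≡ 5 → S o (S o d) ≡ S (not o) (S (not o) (S (not o) d))
  S² o d p = trans (sym (S-inv′ o _)) (cong (S (not o)) (S³ o d p))

  S¹ : ∀ o d → dg d ≡ 5 → S o d ≡ S (not o) (S (not o) (S (not o) (S (not o) d)))
  S¹ o d p = trans (sym (S-inv′ o _)) (cong (S (not o)) (S² o d p))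

  star-rot : ∀ {A : Set} o d → dg d ≡ 5 → (f : Cls → Cls → Cls → Cls → Cls → A) →
    star o (S o d) f ≡ star o d (λ a b c d e → f b c d e a)
  star-rot o d p f rewrite S⁵ o d p = refl

  star-flip : ∀ {A : Set} o d → dg d ≡ 5 → (f : Cls → Cls → Cls → Cls → Cls → A) →
    star (not o) d f ≡ star o d (λ a b c d e → f a e d c b)
  star-flip o d p f rewrite S⁴ o d p | S³ o d p | S² o d p | S¹ o d p = refl

  -- The third side of the triangle at the corner, reached from either of the other two sides. All
  -- knowledge about the rotation at a neighbour of a 5-vertex comes from this identity.
  rot : ∀ o d → corner o d ≡ true → R (S (not o) (R d)) ≡ S o (R (S o d))
  rot false d c = trans (sym (PN _)) (cong P (trans (sym (RR _)) (cong R (trans (sym (PN _)) (cong P (tri-sound d c))))))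
  rot true d c = trans (cong (λ x → R (P x)) e) (trans (cong R (PN _)) (RR _))
    where
    e : R d ≡ N (R (N (R (N d))))
    e = trans (cong R (trans (sym (PN d)) (trans (cong P (sym (tri-sound (N d) c))) (PN _)))) (RR _)

  cornerR : ∀ o d → corner o d ≡ true → corner (not o) (R d) ≡ true
  cornerR false d c = tri-complete _ (cong (λ x → N (R x)) (tri-sound d c))
  cornerR true d c = tri-complete _ (trans (cong (λ x → N (R (N (R (N x))))) (RR d))
    (trans (sym (RR _)) (cong R (trans (sym (PN _)) (trans (cong P (tri-sound (N d) c)) (PN d))))))

  side : ∀ o d → corner o d ≡ true → t (S (not o) (R d)) ≡ t (S o d)
  side o d c = cong cls (trans (cong dg (rot o d c)) (dgS o _))

-- Symmetry, monotonicity and lower bounds of the shares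

if-≤ : ∀ b {x y} → (b ≡ true → x ≤ y) → (if b then x else 0) ≤ y
if-≤ true p = p refl
if-≤ false p = z≤n

≤ᵇ-sound : ∀ {m n} → (m ≤ᵇ n) ≡ true → m ≤ n
≤ᵇ-sound {m} {n} p = ≤ᵇ⇒≤ m n (subst (λ b → T b) (sym p) _)

if-≤′ : ∀ b {x y z} → x ≤ z → y ≤ z → (if b then x else y) ≤ z
if-≤′ true p q = p
if-≤′ false p q = q

≤-if : ∀ b {x y z} → z ≤ x → z ≤ y → z ≤ (if b then x else y)
≤-if true p q = p
≤-if false p q = q

charge : Cls → ℕ
charge K = 2 * chargeX K + 2 * chargeZ K + 2 * chargeY K

-- Separates the three degrees with rules of their own from the classes that follow the linear
-- formula, so that a property of shares takes four cases instead of fourteen.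
data View : Cls → Set where
  seven : View c7
  eleven : View c11
  thirteen : View c13
  plain : ∀ {K} → (∀ l₂ l r r₂ o₁ o₂ g → takeF K l₂ l r r₂ o₁ o₂ g ≡ half K * (2 + bit l + bit r)) →
    low K + charge K ≤ half K * 2 → View K

view : ∀ K → View K
view c5 = plain (λ _ _ _ _ _ _ _ → refl) (≤ᵇ-sound refl)
view c6 = plain (λ _ _ _ _ _ _ _ → refl) (≤ᵇ-sound refl)
view c7 = seven
view c8 = plain (λ _ _ _ _ _ _ _ → refl) (≤ᵇ-sound refl)
view c9 = plain (λ _ _ _ _ _ _ _ → refl) (≤ᵇ-sound refl)
view c10 = plain (λ _ _ _ _ _ _ _ → refl) (≤ᵇ-sound refl)
view c11 = eleven
view c12 = plain (λ _ _ _ _ _ _ _ → refl) (≤ᵇ-sound refl)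
view c13 = thirteen
view c14 = plain (λ _ _ _ _ _ _ _ → refl) (≤ᵇ-sound refl)
view c15 = plain (λ _ _ _ _ _ _ _ → refl) (≤ᵇ-sound refl)
view c16-17 = plain (λ _ _ _ _ _ _ _ → refl) (≤ᵇ-sound refl)
view c18-35 = plain (λ _ _ _ _ _ _ _ → refl) (≤ᵇ-sound refl)
view c36+ = plain (λ _ _ _ _ _ _ _ → refl) (≤ᵇ-sound refl)

takeF-sym : ∀ K l₂ l r r₂ o₁ o₂ g → takeF K l₂ l r r₂ o₁ o₂ g ≡ takeF K r₂ r l l₂ o₂ o₁ g
takeF-sym K with view K
... | plain e _ = λ l₂ l r r₂ o₁ o₂ g → trans (e l₂ l r r₂ o₁ o₂ g)
  (trans (cong (λ x → half K * (2 + x)) (+-comm (bit l) (bit r))) (sym (e r₂ r l l₂ o₂ o₁ g)))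
... | seven = λ where
  l₂ true true r₂ o₁ o₂ g → refl
  l₂ true false r₂ o₁ o₂ g → refl
  l₂ false true r₂ o₁ o₂ g → refl
  l₂ false false r₂ o₁ o₂ g → cong (λ b → if b then 280 else 240) (∨-comm l₂ r₂)
... | eleven = λ where
  l₂ true true r₂ o₁ o₂ g → refl
  l₂ true false r₂ o₁ o₂ g → refl
  l₂ false true r₂ o₁ o₂ g → refl
  l₂ false false r₂ o₁ o₂ true → cong₂ (λ b c → if b then (if c then 0 else 420) else 840)
    (∧-comm (o₁ ≥ᶜ 8) (o₂ ≥ᶜ 8)) (∧-comm (o₁ ≥ᶜ 9) (o₂ ≥ᶜ 9))
  l₂ false false r₂ o₁ o₂ false → refl
... | thirteen = λ where
  l₂ true true r₂ o₁ o₂ g → refl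
  l₂ true false r₂ o₁ o₂ g → refl
  l₂ false true r₂ o₁ o₂ g → refl
  l₂ false false r₂ o₁ o₂ true → cong (λ b → if b then 672 else 924) (∧-comm (o₁ ≥ᶜ 8) (o₂ ≥ᶜ 8))
  l₂ false false r₂ o₁ o₂ false → refl

-- The neighbours of `K` at distance 2 from the 5-vertex are not neighbours of it, so the finite
-- checks do not see them. Counting them as 5-vertices is safe.
takeF-mono : ∀ K l₂ l r r₂ o₁ o₂ g → takeF K false l r false o₁ o₂ g ≤ takeF K l₂ l r r₂ o₁ o₂ g
takeF-mono K with view K
... | plain e _ = λ l₂ l r r₂ o₁ o₂ g →
  ≤-reflexive (trans (e false l r false o₁ o₂ g) (sym (e l₂ l r r₂ o₁ o₂ g)))
... | seven = λ where
  l₂ true true r₂ o₁ o₂ g → ≤-refl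
  l₂ true false r₂ o₁ o₂ g → ≤-refl
  l₂ false true r₂ o₁ o₂ g → ≤-refl
  l₂ false false r₂ o₁ o₂ g → ≤-if (l₂ ∨ r₂) (≤ᵇ-sound refl) ≤-refl
... | eleven = λ where
  l₂ true true r₂ o₁ o₂ g → ≤-refl
  l₂ true false r₂ o₁ o₂ g → ≤-if r₂ (≤ᵇ-sound refl) ≤-refl
  l₂ false true r₂ o₁ o₂ g → ≤-if l₂ (≤ᵇ-sound refl) ≤-refl
  l₂ false false r₂ o₁ o₂ true → ≤-refl
  l₂ false false r₂ o₁ o₂ false → ≤-refl
... | thirteen = λ where
  l₂ true true r₂ o₁ o₂ g → ≤-refl
  l₂ true false r₂ o₁ o₂ g → ≤-refl
  l₂ false true r₂ o₁ o₂ g → ≤-refl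
  l₂ false false r₂ o₁ o₂ true → ≤-refl
  l₂ false false r₂ o₁ o₂ false → ≤-refl

-- Across a corner off triangles even the next neighbour of `K` is unknown, and it too may be
-- counted as a 5-vertex.
takeF-monoʳ : ∀ K l r o₁ o₂ g → takeF K false l false false o₁ o₂ g ≤ takeF K false l r false o₁ o₂ g
takeF-monoʳ K l false o₁ o₂ g = ≤-refl
takeF-monoʳ K l true o₁ o₂ g with view K | l | g
... | plain e _ | l | g = subst₂ _≤_ (sym (e false l false false o₁ o₂ g)) (sym (e false l true false o₁ o₂ g))
  (*-monoʳ-≤ (half K) (+-monoʳ-≤ (2 + bit l) z≤n))
... | seven | true | _ = ≤ᵇ-sound refl
... | seven | false | _ = ≤ᵇ-sound refl
... | eleven | true | _ = ≤ᵇ-sound refl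
... | eleven | false | true =
  if-≤′ ((o₁ ≥ᶜ 8) ∧ (o₂ ≥ᶜ 8)) (if-≤′ ((o₁ ≥ᶜ 9) ∧ (o₂ ≥ᶜ 9)) z≤n (≤ᵇ-sound refl)) ≤-refl
... | eleven | false | false = ≤ᵇ-sound refl
... | thirteen | true | _ = ≤ᵇ-sound refl
... | thirteen | false | true = if-≤′ ((o₁ ≥ᶜ 8) ∧ (o₂ ≥ᶜ 8)) (≤ᵇ-sound refl) (≤ᵇ-sound refl)
... | thirteen | false | false = ≤ᵇ-sound refl

takeF-monoˡ : ∀ K l r o₁ o₂ g → takeF K false false r false o₁ o₂ g ≤ takeF K false l r false o₁ o₂ g
takeF-monoˡ K l r o₁ o₂ g = subst₂ _≤_
  (takeF-sym K false r false false o₂ o₁ g) (takeF-sym K false r l false o₂ o₁ g) (takeF-monoʳ K r l o₂ o₁ g)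

takeF-low : ∀ K l₂ l r r₂ o₁ o₂ g → low K + charge K ≤ takeF K l₂ l r r₂ o₁ o₂ g
takeF-low K with view K
... | plain e p = λ l₂ l r r₂ o₁ o₂ g → subst (low K + charge K ≤_) (sym (e l₂ l r r₂ o₁ o₂ g))
  (≤-trans p (*-monoʳ-≤ (half K) (≤-trans (m≤m+n 2 (bit l)) (m≤m+n (2 + bit l) (bit r)))))
... | seven = λ where
  l₂ true true r₂ o₁ o₂ g → ≤ᵇ-sound refl
  l₂ true false r₂ o₁ o₂ g → ≤ᵇ-sound refl
  l₂ false true r₂ o₁ o₂ g → ≤ᵇ-sound refl
  l₂ false false r₂ o₁ o₂ g → ≤-if (l₂ ∨ r₂) (≤ᵇ-sound refl) ≤-refl
... | eleven = λ _ _ _ _ _ _ _ → z≤n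
... | thirteen = λ where
  l₂ true true r₂ o₁ o₂ g → ≤ᵇ-sound refl
  l₂ true false r₂ o₁ o₂ g → ≤ᵇ-sound refl
  l₂ false true r₂ o₁ o₂ g → ≤ᵇ-sound refl
  l₂ false false r₂ o₁ o₂ true → ≤-if ((o₁ ≥ᶜ 8) ∧ (o₂ ≥ᶜ 8)) ≤-refl (≤ᵇ-sound refl)
  l₂ false false r₂ o₁ o₂ false → ≤-refl

-- The neighbourhood of a 5-vertex

Uncovered : DartSystem → Set
Uncovered sys = ∀ o d → DartSystem.dg sys d ≡ 5 → DartSystem.star sys o d covered ≡ false

zip+ : ∀ a b c d e a′ b′ c′ d′ e′ →
  (a + a′) + (b + b′) + (c + c′) + (d + d′) + (e + e′) ≡ (a + b + c + d + e) + (a′ + b′ + c′ + d′ + e′)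
zip+ = solve-∀

cycle+ : ∀ a b c d e → b + c + d + e + a ≡ a + b + c + d + e
cycle+ = solve-∀

reverse+ : ∀ a b c d e → a + b + c + d + e ≡ a + e + d + c + b
reverse+ = solve-∀

gain+ : ∀ a b c d e g → a + b + c + d + e + g ≡ a + (b + g) + c + d + e
gain+ = solve-∀

module Local (sys : DartSystem) where
  open DartSystem sys

  ∧-split : ∀ {a b} → a ∧ b ≡ true → a ≡ true × b ≡ true
  ∧-split {true} p = refl , p

  ∧-join : ∀ {a b} → a ≡ true → b ≡ true → a ∧ b ≡ true
  ∧-join refl p = p

  full-N : ∀ d → dg d ≡ 5 → full d ≡ true → full (N d) ≡ true
  full-N d p f rewrite N⁵ d p = h (tri d) (tri (N d)) (tri (N (N d))) (tri (N (N (N d)))) (tri (N (N (N (N d))))) f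
    where
    h : ∀ a b c d e → a ∧ b ∧ c ∧ d ∧ e ≡ true → b ∧ c ∧ d ∧ e ∧ a ≡ true
    h true b c d e q rewrite ∧-comm e true = q

  full-S : ∀ o d → dg d ≡ 5 → full d ≡ true → full (S o d) ≡ true
  full-S true d p f = full-N d p f
  full-S false d p f = subst (λ x → full x ≡ true) (S⁴ true d p)
    (full-N _ (q (q (q p))) (full-N _ (q (q p)) (full-N _ (q p) (full-N d p f))))
    where
    q : ∀ {d} → dg d ≡ 5 → dg (N d) ≡ 5
    q p = trans (dgN _) p

  full-corner : ∀ o d → dg d ≡ 5 → full d ≡ true → corner o d ≡ true
  full-corner false d p f = proj₁ (∧-split f)
  full-corner true d p f = proj₁ (∧-split (full-N d p f))

  full-reg : ∀ d → dg d ≡ 5 → full d ≡ true → reg d ≡ true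
  full-reg d p f = ∧-join (full-corner true d p f) (∧-join (full-corner false d p f)
    (∧-join (full-corner true (N d) (trans (dgN d) p) (full-N d p f))
      (full-corner false (P d) (trans (dgS false d) p) (full-S false d p f))))

  take-unfold : ∀ e → dg e ≡ 5 → take (R e) ≡
    takeF (t e) (big (t (P (P (R e))))) (big (t (P (R e)))) (big (t (N (R e)))) (big (t (N (N (R e)))))
      (t (N (N e))) (t (P (P e))) (reg e)
  take-unfold e p rewrite RR e | p = refl

  takeF-cong : ∀ K l₂ r₂ o {a a′ b b′ c c′ g g′} → a ≡ a′ → b ≡ b′ → c ≡ c′ → g ≡ g′ →
    takeF K l₂ (big a) (big b) r₂ o c g ≡ takeF K l₂ (big a′) (big b′) r₂ o c′ g′
  takeF-cong _ _ _ _ refl refl refl refl = refl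

  take-full : ∀ o e → dg e ≡ 5 → full e ≡ true → take (R e) ≡
    takeF (t e) (big (t (S (not o) (S (not o) (R e))))) (big (t (S o e))) (big (t (S (not o) e)))
      (big (t (S o (S o (R e))))) (t (S o (S o e))) (t (S o (S o (S o e)))) true
  take-full true e p f = trans (take-unfold e p)
    (takeF-cong (t e) _ _ _ (side true e (full-corner true e p f)) (side false e (full-corner false e p f))
      (cong t (sym (S³ true e p))) (full-reg e p f))
  take-full false e p f = trans (take-unfold e p) (trans
    (takeF-cong (t e) _ _ _ (side true e (full-corner true e p f)) (side false e (full-corner false e p f))
      refl (full-reg e p f)) (trans (takeF-sym (t e) (big (t (P (P (R e))))) (big (t (N e))) (big (t (P e)))
        (big (t (N (N (R e))))) (t (N (N e))) (t (P (P e))) true)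
    (takeF-cong (t e) _ _ _ refl refl (cong t (sym (S³ false e p))) refl)))

  lowTake-≤ : ∀ o e → dg e ≡ 5 → full e ≡ true → star o e lowTake ≤ take (R e)
  lowTake-≤ o e p f rewrite take-full o e p f | S⁴ o e p = takeF-mono (t e) _ _ _ _ _ _ true

  fiveSum : Bool → (D → ℕ) → D → ℕ
  fiveSum o f d = f d + f (S o d) + f (S o (S o d)) + f (S o (S o (S o d))) + f (S o (S o (S o (S o d))))

  fiveSum-mono : ∀ o {f g} d → dg d ≡ 5 → (∀ e → dg e ≡ 5 → f e ≤ g e) → fiveSum o f d ≤ fiveSum o g d
  fiveSum-mono o d p h = +-mono-≤ (+-mono-≤ (+-mono-≤ (+-mono-≤ (h _ p) (h _ (q p))) (h _ (q (q p))))
    (h _ (q (q (q p))))) (h _ (q (q (q (q p)))))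
    where
    q : ∀ {d} → dg d ≡ 5 → dg (S o d) ≡ 5
    q p = trans (dgS o _) p

  fiveSum-+ : ∀ o f g d → fiveSum o (λ e → f e + g e) d ≡ fiveSum o f d + fiveSum o g d
  fiveSum-+ o f g d = zip+ (f d) (f (S o d)) _ _ _ (g d) (g (S o d)) _ _ _

  fiveSum-S : ∀ o f d → dg d ≡ 5 → fiveSum o f (S o d) ≡ fiveSum o f d
  fiveSum-S o f d p rewrite S⁵ o d p = cycle+ (f d) _ _ _ _

  fiveSum-flip : ∀ o f d → dg d ≡ 5 → fiveSum (not o) f d ≡ fiveSum o f d
  fiveSum-flip o f d p rewrite S⁴ o d p | S³ o d p | S² o d p | S¹ o d p = reverse+ (f d) _ _ _ _

  turn : {A : Set} → (Cls → Cls → Cls → Cls → Cls → A) → Cls → Cls → Cls → Cls → Cls → A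
  turn f a b c d e = f b c d e a

  star-rot² : ∀ {A : Set} o d → dg d ≡ 5 → (f : Cls → Cls → Cls → Cls → Cls → A) →
    star o (S o (S o d)) f ≡ star o d (turn (turn f))
  star-rot² o d p f = trans (star-rot o (S o d) (trans (dgS o d) p) f) (star-rot o d p (turn f))

  star-rot³ : ∀ {A : Set} o d → dg d ≡ 5 → (f : Cls → Cls → Cls → Cls → Cls → A) →
    star o (S o (S o (S o d))) f ≡ star o d (turn (turn (turn f)))
  star-rot³ o d p f = trans (star-rot² o (S o d) (trans (dgS o d) p) f) (star-rot o d p (turn (turn f)))

  star-rot⁴ : ∀ {A : Set} o d → dg d ≡ 5 → (f : Cls → Cls → Cls → Cls → Cls → A) →
    star o (S o (S o (S o (S o d)))) f ≡ star o d (turn (turn (turn (turn f))))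
  star-rot⁴ o d p f = trans (star-rot³ o (S o d) (trans (dgS o d) p) f) (star-rot o d p (turn (turn (turn f))))

  takes-gain : ∀ o e g → dg e ≡ 5 → full e ≡ true → star o e (turn lowTake) + g ≤ take (R (S o e)) →
    star o e takes + g ≤ fiveSum o (λ x → take (R x)) e
  takes-gain o e g p f l₁ = ≤-trans (≤-reflexive (gain+ (star o e lowTake) (star o e (turn lowTake)) _ _ _ g))
    (+-mono-≤ (+-mono-≤ (+-mono-≤ (+-mono-≤ (lowTake-≤ o e p f) l₁) l₂) l₃) l₄)
    where
    q : ∀ {d} → dg d ≡ 5 → dg (S o d) ≡ 5
    q p = trans (dgS o _) p
    h : ∀ {d} → dg d ≡ 5 → full d ≡ true → full (S o d) ≡ true
    h p f = full-S o _ p f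
    l₂ : star o e (λ a b c d e → lowTake c d e a b) ≤ take (R (S o (S o e)))
    l₂ = subst (_≤ take (R (S o (S o e)))) (star-rot² o e p lowTake)
      (lowTake-≤ o _ (q (q p)) (h (q p) (h p f)))
    l₃ : star o e (λ a b c d e → lowTake d e a b c) ≤ take (R (S o (S o (S o e))))
    l₃ = subst (_≤ take (R (S o (S o (S o e))))) (star-rot³ o e p lowTake)
      (lowTake-≤ o _ (q (q (q p))) (h (q (q p)) (h (q p) (h p f))))
    l₄ : star o e (λ a b c d e → lowTake e a b c d) ≤ take (R (S o (S o (S o (S o e)))))
    l₄ = subst (_≤ take (R (S o (S o (S o (S o e)))))) (star-rot⁴ o e p lowTake)
      (lowTake-≤ o _ (q (q (q (q p)))) (h (q (q (q p))) (h (q (q p)) (h (q p) (h p f)))))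

  takes-≤ : ∀ o e → dg e ≡ 5 → full e ≡ true → star o e takes ≤ fiveSum o (λ x → take (R x)) e
  takes-≤ o e p f = subst (_≤ fiveSum o (λ x → take (R x)) e) (+-identityʳ (star o e takes))
    (takes-gain o e 0 p f (subst (_≤ take (R (S o e))) (trans (star-rot o e p lowTake) (sym (+-identityʳ _)))
      (lowTake-≤ o (S o e) (trans (dgS o e) p) (full-S o e p f))))

-- From degrees to classes, and checks over all classes

cls-5 : ∀ k → 5 ≤ k → is5 (cls k) ≡ true → k ≡ 5
cls-5 0 () _
cls-5 1 (s≤s ()) _
cls-5 2 (s≤s (s≤s ())) _
cls-5 3 (s≤s (s≤s (s≤s ()))) _
cls-5 4 (s≤s (s≤s (s≤s (s≤s ())))) _
cls-5 5 _ _ = refl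
cls-5 6 _ ()
cls-5 7 _ ()
cls-5 8 _ ()
cls-5 9 _ ()
cls-5 10 _ ()
cls-5 11 _ ()
cls-5 12 _ ()
cls-5 13 _ ()
cls-5 14 _ ()
cls-5 15 _ ()
cls-5 16 _ ()
cls-5 17 _ ()
cls-5 (suc (suc (suc (suc (suc (suc (suc (suc (suc (suc (suc (suc (suc (suc (suc (suc (suc (suc k)))))))))))))))))) _ q
  with k ≤ᵇ 17
cls-5 _ _ () | true
cls-5 _ _ () | false

∈-classes : ∀ c → c ∈ classes
∈-classes c5 = here refl
∈-classes c6 = there (here refl)
∈-classes c7 = there (there (here refl))
∈-classes c8 = there (there (there (here refl)))
∈-classes c9 = there (there (there (there (here refl))))
∈-classes c10 = there (there (there (there (there (here refl)))))
∈-classes c11 = there (there (there (there (there (there (here refl))))))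
∈-classes c12 = there (there (there (there (there (there (there (here refl)))))))
∈-classes c13 = there (there (there (there (there (there (there (there (here refl))))))))
∈-classes c14 = there (there (there (there (there (there (there (there (there (here refl)))))))))
∈-classes c15 = there (there (there (there (there (there (there (there (there (there (here refl))))))))))
∈-classes c16-17 = there (there (there (there (there (there (there (there (there (there (there (here refl)))))))))))
∈-classes c18-35 =
  there (there (there (there (there (there (there (there (there (there (there (there (here refl))))))))))))
∈-classes c36+ =
  there (there (there (there (there (there (there (there (there (there (there (there (there (here refl)))))))))))))

all-sound : ∀ {A : Set} (f : A → Bool) xs → all f xs ≡ true → ∀ {x} → x ∈ xs → f x ≡ true
all-sound f (x ∷ xs) p (here refl) = ∧-left p
all-sound f (x ∷ xs) p (there q) = all-sound f xs (∧-right {f x} p) q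

forClasses-sound : ∀ f → forClasses f ≡ true → ∀ c → f c ≡ true
forClasses-sound f p c = all-sound f classes p (∈-classes c)

∨-elim : ∀ a {b} → a ∨ b ≡ true → a ≡ true ⊎ b ≡ true
∨-elim true _ = inj₁ refl
∨-elim false p = inj₂ p

amount-X : ∀ k b → amount k b ≤ chargeX k
amount-X k b = ≤ᵇ-sound (forClasses-sound (λ b → amount k b ≤ᵇ chargeX k)
  (forClasses-sound (λ k → forClasses λ b → amount k b ≤ᵇ chargeX k) refl k) b)

amount′-X : ∀ k b → amount′ k b ≤ chargeX′ k
amount′-X k b = ≤ᵇ-sound (forClasses-sound (λ b → amount′ k b ≤ᵇ chargeX′ k)
  (forClasses-sound (λ k → forClasses λ b → amount′ k b ≤ᵇ chargeX′ k) refl k) b)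

amount-Z : ∀ k b → amount k b ≤ chargeZ b
amount-Z k b = ≤ᵇ-sound (forClasses-sound (λ b → amount k b ≤ᵇ chargeZ b)
  (forClasses-sound (λ k → forClasses λ b → amount k b ≤ᵇ chargeZ b) refl k) b)

amount′-≤ : ∀ k b → amount′ k b ≤ amount k b
amount′-≤ k b = ≤ᵇ-sound (forClasses-sound (λ b → amount′ k b ≤ᵇ amount k b)
  (forClasses-sound (λ k → forClasses λ b → amount′ k b ≤ᵇ amount k b) refl k) b)

-- In rule Z the vertex x has the neighbours v, K, m, s, z in cyclic order, where v is the poor
-- vertex and v, m, z have degree 5. For K of degree 7, 8 or 10 the stars ⟨5,6,7,5,35⟩, ⟨5,5,9,5,17⟩
-- and ⟨5,5,10,5,12⟩ force s to be large. As s is also a neighbour of the payer z, the payer is rich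
-- enough.
amount-paysZ : ∀ k s d b → covered c5 k c5 s c5 ≡ false → amount k b ≤ paysZ c5 c5 s d b
amount-paysZ k s d b u with ∨-elim (covered c5 k c5 s c5)
  (forClasses-sound (λ b → covered c5 k c5 s c5 ∨ (amount k b ≤ᵇ paysZ c5 c5 s d b))
  (forClasses-sound (λ s → forClasses λ b → covered c5 k c5 s c5 ∨ (amount k b ≤ᵇ paysZ c5 c5 s d b))
  (forClasses-sound (λ k → forClasses λ s → forClasses λ b →
    covered c5 k c5 s c5 ∨ (amount k b ≤ᵇ paysZ c5 c5 s d b)) refl k) s) b)
... | inj₁ q with () ← trans (sym u) q
... | inj₂ q = ≤ᵇ-sound q

-- Second-round payments as seen by the payer

module Payments (sys : DartSystem) where
  open DartSystem sys
  open Local sys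

  side⁻ : ∀ o d → corner (not o) d ≡ true → t (S o (R d)) ≡ t (S (not o) d)
  side⁻ true d c = side false d c
  side⁻ false d c = side true d c

  side′ : ∀ o d → corner o (R d) ≡ true → t (S (not o) d) ≡ t (S o (R d))
  side′ o d c = trans (cong (λ x → t (S (not o) x)) (sym (RR d))) (side o (R d) c)

  side⁻′ : ∀ o d → corner (not o) (R d) ≡ true → t (S o d) ≡ t (S (not o) (R d))
  side⁻′ o d c = trans (cong (λ x → t (S o x)) (sym (RR d))) (side⁻ o (R d) c)

  full-cornerR : ∀ o d → dg (R d) ≡ 5 → full (R d) ≡ true → corner o d ≡ true
  full-cornerR o d p f = subst₂ (λ b x → corner b x ≡ true) (not-involutive o) (RR d)
    (cornerR (not o) (R d) (full-corner (not o) (R d) p f))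

  dg-5 : ∀ d → is5 (cls (dg d)) ≡ true → dg d ≡ 5
  dg-5 d = cls-5 (dg d) (5≤dg d)

  t-5 : ∀ d → dg (R d) ≡ 5 → t d ≡ c5
  t-5 d p = cong cls p

  dgR-5 : ∀ d → t d ≡ c5 → dg (R d) ≡ 5
  dgR-5 d q = dg-5 (R d) (cong is5 q)

  tR-5 : ∀ d → dg d ≡ 5 → t (R d) ≡ c5
  tR-5 d p = cong cls (trans (cong dg (RR d)) p)

  record Poor (o : Bool) (e : D) : Set where
    field
      dg-v : dg e ≡ 5
      full-v : full e ≡ true
      tx : t e ≡ c5
      ty : t (S o (S o e)) ≡ c5
      tz : t (S o (S o (S o (S o e)))) ≡ c5

  poorAt-sound : ∀ o e → poorAt o e ≡ true → Poor o e
  poorAt-sound o e = go (is5 (cls (dg e))) (full e) (is5 (t e)) (is5 (t (S o (S o e))))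
      (is5 (t (S o (S o (S o (S o e)))))) refl refl refl refl refl
    where
    go : ∀ a b c d f → is5 (cls (dg e)) ≡ a → full e ≡ b → is5 (t e) ≡ c → is5 (t (S o (S o e))) ≡ d →
      is5 (t (S o (S o (S o (S o e))))) ≡ f → a ∧ b ∧ c ∧ d ∧ f ≡ true → Poor o e
    go true true true true true p q r s u _ = record
      { dg-v = dg-5 e p ; full-v = q ; tx = is5-≡ r ; ty = is5-≡ s ; tz = is5-≡ u }

  record PoorZ (o : Bool) (e : D) : Set where
    field
      poorZ : Poor o e
      full-x : full (R e) ≡ true
      tm : beyond o (R e) ≡ c5
    open Poor poorZ public

  condZ : Bool → D → Bool
  condZ o e = poorAt o e ∧ full (R e) ∧ is5 (beyond o (R e))

  condZ-sound : ∀ o e → condZ o e ≡ true → PoorZ o e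
  condZ-sound o e = go (poorAt o e) (full (R e)) (is5 (beyond o (R e))) refl refl refl
    where
    go : ∀ a b c → poorAt o e ≡ a → full (R e) ≡ b → is5 (beyond o (R e)) ≡ c → a ∧ b ∧ c ≡ true → PoorZ o e
    go true true true p q r _ = record { poorZ = poorAt-sound o e p ; full-x = q ; tm = is5-≡ r }

  record PoorY (o : Bool) (d : D) (e : D) : Set where
    field
      dg-v : dg e ≡ 5
      full-v : full e ≡ true
      t₀ : t e ≡ c5
      t₁ : t (S o e) ≡ c11
      t₂ : t (S o (S o e)) ≡ c6
      t₄ : t (S o (S o (S o (S o e)))) ≡ c10
      end : not (full d) ∨ is5 (beyond o d) ≡ true

  condY : Bool → D → D → Bool
  condY o d e = is5 (cls (dg e)) ∧ full e ∧ is5 (t e) ∧ is11 (t (S o e)) ∧ is6 (t (S o (S o e))) ∧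
    is5 (t (S o (S o (S o e)))) ∧ is10 (t (S o (S o (S o (S o e))))) ∧ (not (full d) ∨ is5 (beyond o d))

  condY-sound : ∀ o d e → condY o d e ≡ true → PoorY o d e
  condY-sound o d e = go (is5 (cls (dg e))) (full e) (is5 (t e)) (is11 (t (S o e))) (is6 (t (S o (S o e))))
      (is5 (t (S o (S o (S o e))))) (is10 (t (S o (S o (S o (S o e))))))
      (not (full d) ∨ is5 (beyond o d)) refl refl refl refl refl refl refl refl
    where
    go : ∀ a b c a′ b′ c′ d′ e′ → is5 (cls (dg e)) ≡ a → full e ≡ b → is5 (t e) ≡ c → is11 (t (S o e)) ≡ a′ →
      is6 (t (S o (S o e))) ≡ b′ → is5 (t (S o (S o (S o e)))) ≡ c′ → is10 (t (S o (S o (S o (S o e))))) ≡ d′ →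
      (not (full d) ∨ is5 (beyond o d)) ≡ e′ →
      a ∧ b ∧ c ∧ a′ ∧ b′ ∧ c′ ∧ d′ ∧ e′ ≡ true → PoorY o d e
    go true true true true true true true true p q r p′ q′ _ s′ u _ = record
      { dg-v = dg-5 e p ; full-v = q ; t₀ = is5-≡ r ; t₁ = is11-≡ p′ ; t₂ = is6-≡ q′
      ; t₄ = is10-≡ s′ ; end = u }

module At (a b c d e : Cls) where
  paysX-≥ : ∀ {x} → a ≡ c5 → e ≡ c5 → big c ≡ true → x ≤ chargeX′ b → x ≤ paysX a b c d e
  paysX-≥ refl refl q h rewrite q = h

  paysZ-≥ : ∀ {x} → a ≡ c5 → b ≡ c5 → x ≤ paysZ c5 c5 c d e → x ≤ paysZ a b c d e
  paysZ-≥ refl refl h = h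

  paysY-≥ : a ≡ c5 → b ≡ c11 → c ≡ c5 → e ≡ c10 → 168 ≤ paysY a b c d e
  paysY-≥ refl refl refl refl = ≤-refl

  paysXN-≥ : ∀ {x} → a ≡ c5 → e ≡ c5 → x ≤ chargeX b → x ≤ paysXN a b c d e
  paysXN-≥ refl refl h = h

  paysZN-≥ : ∀ {x} → a ≡ c5 → b ≡ c5 → x ≤ chargeZ e → x ≤ paysZN a b c d e
  paysZN-≥ refl refl h = h

  paysYN-≥ : a ≡ c5 → b ≡ c11 → e ≡ c10 → 168 ≤ paysYN a b c d e
  paysYN-≥ refl refl refl = ≤-refl

module Bounds (sys : DartSystem) (uncov : Uncovered sys) where
  open DartSystem sys
  open Local sys
  open Payments sys

  S-dg : ∀ o {d} → dg d ≡ 5 → dg (S o d) ≡ 5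
  S-dg o p = trans (dgS o _) p

  fourth : ∀ o d → dg d ≡ 5 → t (S (not o) (S (not o) (S (not o) (S (not o) d)))) ≡ t (S o d)
  fourth o d p = cong t (sym (S¹ o d p))

  open module StarAt (o : Bool) (d : D) = At (t d) (t (S (not o) d)) (t (S (not o) (S (not o) d)))
    (t (S (not o) (S (not o) (S (not o) d)))) (t (S (not o) (S (not o) (S (not o) (S (not o) d)))))

  -- The poor vertex has triangles at all corners, so the payer's neighbours on both sides of it are
  -- neighbours of the poor vertex as well: K and z in rule X, x and B in rule Z, and the 11-vertex
  -- and the 10-vertex in rule Y.
  module FactsX (o : Bool) (d : D) (q : poorAt o (R d) ≡ true) where
    open Poor (poorAt-sound o (R d) q)
    dg-u : dg d ≡ 5
    dg-u = trans (cong dg (sym (RR d))) (dgR-5 (R d) tx)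
    a : t d ≡ c5
    a = t-5 d dg-v
    b : t (S (not o) d) ≡ t (S o (R d))
    b = side′ o d (full-corner o (R d) dg-v full-v)
    e : t (S (not o) (S (not o) (S (not o) (S (not o) d)))) ≡ c5
    e = trans (fourth o d dg-u) (trans (side⁻′ o d (full-corner (not o) (R d) dg-v full-v))
      (trans (cong t (sym (S⁴ o (R d) dg-v))) tz))

  module FactsZ (o : Bool) (d : D) (dg-u : dg d ≡ 5) (q : condZ o (S o (R d)) ≡ true) where
    open PoorZ (condZ-sound o (S o (R d)) q)
    dg-R : dg (R d) ≡ 5
    dg-R = trans (sym (dgS o (R d))) dg-v
    full-R : full (R d) ≡ true
    full-R = subst (λ x → full x ≡ true) (S-inv′ o (R d)) (full-S (not o) _ dg-v full-v)
    a : t d ≡ c5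
    a = t-5 d dg-R
    b : t (S (not o) d) ≡ c5
    b = trans (side′ o d (full-corner o (R d) dg-R full-R)) tx
    e : t (S (not o) (S (not o) (S (not o) (S (not o) d)))) ≡ t (S o (S o (S o (S o (R d)))))
    e = trans (fourth o d dg-u) (trans (side⁻′ o d (full-corner (not o) (R d) dg-R full-R))
      (cong t (sym (S⁴ o (R d) dg-R))))

  module FactsY (o : Bool) (d : D) (q : condY o d (R d) ≡ true) where
    open PoorY (condY-sound o d (R d) q)
    dg-u : dg d ≡ 5
    dg-u = trans (cong dg (sym (RR d))) (dgR-5 (R d) t₀)
    a : t d ≡ c5
    a = t-5 d dg-v
    b : t (S (not o) d) ≡ c11
    b = trans (side′ o d (full-corner o (R d) dg-v full-v)) t₁
    e : t (S (not o) (S (not o) (S (not o) (S (not o) d)))) ≡ c10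
    e = trans (fourth o d dg-u) (trans (side⁻′ o d (full-corner (not o) (R d) dg-v full-v))
      (trans (cong t (sym (S⁴ o (R d) dg-v))) t₄))

  payX-N : ∀ o d → payX o d ≤ star (not o) d paysXN
  payX-N o d = if-≤ (poorAt o (R d)) λ q → let open FactsX o d q in
    ≤-trans (if-≤′ (full d) (if-≤′ (big (beyond o d)) (amount′-≤ (t (S o (R d))) (t (S o (S o (S o (R d)))))) z≤n) ≤-refl)
      (paysXN-≥ o d a e (subst (λ k → need o (R d) ≤ chargeX k) (sym b) (amount-X (t (S o (R d))) _)))

  payX-full : ∀ o d → full d ≡ true → payX o d ≤ star (not o) d paysX
  payX-full o d f = if-≤ (poorAt o (R d)) λ q → let open FactsX o d q in
    subst (λ z → (if z then (if big (beyond o d) then need′ o (R d) else 0) else need o (R d)) ≤ star (not o) d paysX)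
      (sym f) (if-≤ (big (beyond o d)) λ m →
        paysX-≥ o d a e m (subst (λ k → need′ o (R d) ≤ chargeX′ k) (sym b) (amount′-X (t (S o (R d))) _)))

  payZ-N : ∀ o d → dg d ≡ 5 → payZ o d ≤ star (not o) d paysZN
  payZ-N o d p = if-≤ (condZ o (S o (R d))) λ q → let open FactsZ o d p q in
    paysZN-≥ o d a b (subst (λ k → need o (S o (R d)) ≤ chargeZ k) (sym e) (amount-Z (t (S o (S o (R d)))) _))

  payZ-full : ∀ o d → dg d ≡ 5 → full d ≡ true → payZ o d ≤ star (not o) d paysZ
  payZ-full o d p f = if-≤ (condZ o (S o (R d))) λ q → let open FactsZ o d p q in
    paysZ-≥ o d a b (subst (λ k → need o (S o (R d)) ≤ paysZ c5 c5 (t (S (not o) (S (not o) d)))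
        (t (S (not o) (S (not o) (S (not o) d)))) k) (sym e)
      (amount-paysZ (t (S o (S o (R d)))) (t (S (not o) (S (not o) d)))
        (t (S (not o) (S (not o) (S (not o) d)))) (t (S o (S o (S o (S o (R d)))))) (x-star q)))
    where
    v = S o (R d)
    x-star : condZ o v ≡ true → covered c5 (t (S o v)) c5 (t (S (not o) (S (not o) d))) c5 ≡ false
    x-star q = subst₅ tf tK tm ts tz′ (uncov (not o) (R v) dg-x)
      where
      open FactsZ o d p q
      open PoorZ (condZ-sound o v q)
      subst₅ : ∀ {a a′ b b′ c c′ d d′ e e′} → a ≡ a′ → b ≡ b′ → c ≡ c′ → d ≡ d′ → e ≡ e′ →
        covered a b c d e ≡ false → covered a′ b′ c′ d′ e′ ≡ false
      subst₅ refl refl refl refl refl h = h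
      dg-x : dg (R v) ≡ 5
      dg-x = dgR-5 v tx
      tf : t (R v) ≡ c5
      tf = tR-5 v dg-v
      tK : t (S (not o) (R v)) ≡ t (S o v)
      tK = side o v (full-corner o v dg-v full-v)
      -- The edge from x to z lies on a second triangle, at a corner of the payer z. Its third
      -- vertex s comes next to z around x and next to x around z.
      ts : t (S (not o) (S (not o) (S (not o) (R v)))) ≡ t (S (not o) (S (not o) d))
      ts = trans (cong t (sym (S² o (R v) dg-x)))
        (trans (cong (λ x → t (S o x)) (trans (sym (rot o (R d) (full-corner o (R d) dg-R full-R)))
          (cong (λ x → R (S (not o) x)) (RR d))))
        (side⁻ o (S (not o) d) (full-corner (not o) _ (S-dg (not o) p) (full-S (not o) d p f))))
      tz′ : t (S (not o) (S (not o) (S (not o) (S (not o) (R v))))) ≡ c5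
      tz′ = trans (fourth o (R v) dg-x) (trans (side⁻ o v (full-corner (not o) v dg-v full-v))
        (trans (cong t (sym (S⁴ o v dg-v))) tz))

  payY-N : ∀ o d → payY o d ≤ star (not o) d paysYN
  payY-N o d = if-≤ (condY o d (R d)) λ q → let open FactsY o d q in paysYN-≥ o d a b e

  payY-full : ∀ o d → full d ≡ true → payY o d ≤ star (not o) d paysY
  payY-full o d f = if-≤ (condY o d (R d)) λ q → let open FactsY o d q in
    paysY-≥ o d a b (is5-≡ (subst (λ z → not z ∨ is5 (beyond o d) ≡ true) f (PoorY.end (condY-sound o d (R d) q)))) e

  pay-N : ∀ o d → dg d ≡ 5 → pay o d ≤ star (not o) d paysN
  pay-N o d p = +-mono-≤ (+-mono-≤ (payX-N o d) (payZ-N o d p)) (payY-N o d)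

  pay-full : ∀ o d → dg d ≡ 5 → full d ≡ true → pay o d ≤ star (not o) d pays
  pay-full o d p f = +-mono-≤ (+-mono-≤ (payX-full o d f) (payZ-full o d p f)) (payY-full o d f)

  -- Only a vertex with triangles at all corners is paid, and its triangles also contain the payer's
  -- two corners beside the dart.
  pay-zero : ∀ o o′ d → corner o′ d ≡ false → pay o d ≡ 0
  pay-zero o o′ d c = n≤0⇒n≡0 (+-mono-≤ (+-mono-≤
    (if-≤ (poorAt o (R d)) λ q → let open Poor (poorAt-sound o (R d) q) in absurd dg-v full-v)
    (if-≤ (condZ o (S o (R d))) λ q → let open PoorZ (condZ-sound o (S o (R d)) q) in
      absurd (trans (sym (dgS o (R d))) dg-v)
        (subst (λ x → full x ≡ true) (S-inv′ o (R d)) (full-S (not o) _ dg-v full-v))))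
    (if-≤ (condY o d (R d)) λ q → let open PoorY (condY-sound o d (R d) q) in absurd dg-v full-v))
    where
    absurd : ∀ {x} → dg (R d) ≡ 5 → full (R d) ≡ true → x ≤ 0
    absurd p f with () ← trans (sym c) (full-cornerR o′ d p f)

-- The balance at a 5-vertex

one-search : search 840 (or-covered one-ok) 0 ≡ true
one-search = refl

full-search : search 1680 (or-covered full-ok) 0 ≡ true
full-search = refl

total : ∀ {n} → ℕ → Vec Cls n → ℕ
total l [] = l
total l (c ∷ cs) = total (l + low c) cs

total-≥ : ∀ {n} l (cs : Vec Cls n) → l ≤ total l cs
total-≥ l [] = ≤-refl
total-≥ l (c ∷ cs) = ≤-trans (m≤m+n l (low c)) (total-≥ (l + low c) cs)

search-sound : ∀ {n} m (ok : Vec Cls n → Bool) l → search m ok l ≡ true → ∀ cs → m ≤ total l cs ⊎ ok cs ≡ true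
search-sound m ok l p [] = inj₂ p
search-sound m ok l p (c ∷ cs) with ∨-elim (m ≤ᵇ l + low c)
  (forClasses-sound (λ c → (m ≤ᵇ l + low c) ∨ search m (λ cs → ok (c ∷ cs)) (l + low c)) p c)
... | inj₁ q = inj₁ (≤-trans (≤ᵇ-sound q) (total-≥ (l + low c) cs))
... | inj₂ q = search-sound m (λ cs → ok (c ∷ cs)) (l + low c) q cs

rots+ : ∀ a b c d e a′ b′ c′ d′ e′ →
  (a′ + a) + (b′ + b) + (c′ + c) + (d′ + d) + (e′ + e) ≡
  a + (b + (c + (d + (e + (a′ + (b′ + (c′ + (d′ + (e′ + 0)))))))))
rots+ = solve-∀

module FiveVertex (sys : DartSystem) (uncov : Uncovered sys) where
  open DartSystem sys
  open Local sys
  open Payments sys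
  open Bounds sys uncov

  out nt : D → ℕ
  out d = pay true d + pay false d
  nt d = bit (not (tri d))

  Balanced : D → Set
  Balanced d = 1680 + fiveSum true out d ≤
    840 * fiveSum true nt d + (fiveSum true (λ e → take (R e)) d + fiveSum true (λ e → out (R e)) d)

  lows : D → ℕ
  lows = fiveSum true (λ e → low (t e))

  shift : ∀ o (h : D → ℕ) d → dg d ≡ 5 → fiveSum true (λ e → h (S o e)) d ≡ fiveSum true h d
  shift true h d p = fiveSum-S true h d p
  shift false h d p = trans (sym (fiveSum-flip true (λ e → h (P e)) d p))
    (trans (fiveSum-S false h d p) (fiveSum-flip true h d p))

  chargeZY : Cls → ℕ
  chargeZY c = chargeZ c + chargeY c

  -- A payment along `d` is charged to a neighbour beside `d`: K lies on one side, and B or the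
  -- 10-vertex on the other. Over the five darts and both orientations each neighbour is charged at
  -- most twice under each rule, hence the factors 2 in `charge`.
  pay-charge : ∀ o d → dg d ≡ 5 → pay o d ≤ chargeX (t (S (not o) d)) + chargeZY (t (S o d))
  pay-charge o d p = ≤-trans (pay-N o d p) (≤-trans
    (+-mono-≤ (+-mono-≤ (if-≤ (is5 a ∧ is5 e) λ _ → ≤-refl) (if-≤ (is5 a ∧ is5 b) λ _ → ≤-refl))
      (if-≤ (is5 a ∧ is11 b) λ _ → ≤-refl))
    (≤-reflexive (trans (+-assoc (chargeX b) _ _)
      (cong (λ c → chargeX b + chargeZY c) (fourth o d p)))))
    where
    a = t d
    b = t (S (not o) d)
    e = t (S (not o) (S (not o) (S (not o) (S (not o) d))))

  charge-split : ∀ x y z → (x + (y + z)) + (x + (y + z)) ≡ 2 * x + 2 * y + 2 * z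
  charge-split = solve-∀

  paid-charge : ∀ d → dg d ≡ 5 → fiveSum true out d ≤ fiveSum true (λ e → charge (t e)) d
  paid-charge d p = begin
    fiveSum true out d
      ≤⟨ fiveSum-mono true d p (λ e q → +-mono-≤ (pay-charge true e q) (pay-charge false e q)) ⟩
    fiveSum true (λ e → (x (P e) + y (N e)) + (x (N e) + y (P e))) d
      ≡⟨ fiveSum-+ true (λ e → x (P e) + y (N e)) (λ e → x (N e) + y (P e)) d ⟩
    fiveSum true (λ e → x (P e) + y (N e)) d + fiveSum true (λ e → x (N e) + y (P e)) d
      ≡⟨ cong₂ _+_ (eq false true) (eq true false) ⟩
    fiveSum true (λ e → x e + y e) d + fiveSum true (λ e → x e + y e) d
      ≡⟨ sym (fiveSum-+ true (λ e → x e + y e) (λ e → x e + y e) d) ⟩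
    fiveSum true (λ e → (x e + y e) + (x e + y e)) d
      ≤⟨ fiveSum-mono true d p (λ e _ → ≤-reflexive (charge-split (x e) (chargeZ (t e)) (chargeY (t e)))) ⟩
    fiveSum true (λ e → charge (t e)) d ∎
    where
    open ≤-Reasoning
    x y : D → ℕ
    x e = chargeX (t e)
    y e = chargeZY (t e)
    eq : ∀ o o′ → fiveSum true (λ e → x (S o e) + y (S o′ e)) d ≡ fiveSum true (λ e → x e + y e) d
    eq o o′ = trans (fiveSum-+ true (λ e → x (S o e)) (λ e → y (S o′ e)) d)
      (trans (cong₂ _+_ (shift o x d p) (shift o′ y d p)) (sym (fiveSum-+ true x y d)))

  take-low : ∀ e → dg e ≡ 5 → low (t e) + charge (t e) ≤ take (R e)
  take-low e p = subst (low (t e) + charge (t e) ≤_) (sym (take-unfold e p)) (takeF-low (t e) _ _ _ _ _ _ _)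

  base : ∀ d → dg d ≡ 5 → lows d + fiveSum true out d ≤ fiveSum true (λ e → take (R e)) d
  base d p = ≤-trans (+-monoʳ-≤ (lows d) (paid-charge d p)) (subst (_≤ fiveSum true (λ e → take (R e)) d)
    (fiveSum-+ true (λ e → low (t e)) (λ e → charge (t e)) d) (fiveSum-mono true d p take-low))

  -- The pruned branches of `search` end here, as do the vertices with two corners off triangles:
  -- once `low` meets the demand, all payments that could be owed have been allowed for.
  base-balanced : ∀ d → dg d ≡ 5 → 1680 ≤ 840 * fiveSum true nt d + lows d → Balanced d
  base-balanced d p h = begin
    1680 + o ≤⟨ +-monoˡ-≤ o h ⟩
    n + lows d + o ≡⟨ +-assoc n _ _ ⟩
    n + (lows d + o) ≤⟨ +-monoʳ-≤ n (base d p) ⟩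
    n + τ ≤⟨ +-monoʳ-≤ n (m≤m+n τ _) ⟩
    n + (τ + fiveSum true (λ e → out (R e)) d) ∎
    where
    open ≤-Reasoning
    o = fiveSum true out d
    n = 840 * fiveSum true nt d
    τ = fiveSum true (λ e → take (R e)) d

  Tally : Set
  Tally = Cls → Cls → Cls → Cls → Cls → ℕ

  flip : Tally → Tally
  flip g a b c d e = g a e d c b

  paid-by : ∀ (g : Tally) d e → dg e ≡ 5 → (∀ o → pay o e ≤ star (not o) e g) → (tr : Tally → Tally) →
    (∀ h → star true e h ≡ star true d (tr h)) → out e ≤ star true d (tr (flip g)) + star true d (tr g)
  paid-by g d e p h tr q = +-mono-≤
    (≤-trans (h true) (≤-reflexive (trans (star-flip true e p g) (q (flip g)))))
    (≤-trans (h false) (≤-reflexive (q g)))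

  paid-full : ∀ d → dg d ≡ 5 → full d ≡ true →
    fiveSum true out d ≤ star true d (λ a b c d e → sum (rots a b c d e pays))
  paid-full d p f = ≤-trans
    (+-mono-≤ (+-mono-≤ (+-mono-≤ (+-mono-≤
      (paid-by pays d d p (λ o → pay-full o d p f) (λ h → h) (λ _ → refl))
      (paid-by pays d d₁ p₁ (λ o → pay-full o d₁ p₁ f₁) turn (star-rot true d p)))
      (paid-by pays d d₂ p₂ (λ o → pay-full o d₂ p₂ f₂) (λ h → turn (turn h)) (star-rot² true d p)))
      (paid-by pays d d₃ p₃ (λ o → pay-full o d₃ p₃ f₃) (λ h → turn (turn (turn h))) (star-rot³ true d p)))
      (paid-by pays d d₄ p₄ (λ o → pay-full o d₄ p₄ f₄) (λ h → turn (turn (turn (turn h)))) (star-rot⁴ true d p)))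
    (≤-reflexive (rots+ (star true d pays) (s turn) (s (λ h → turn (turn h))) (s (λ h → turn (turn (turn h))))
      (s (λ h → turn (turn (turn (turn h))))) (star true d (flip pays)) (s′ turn) (s′ (λ h → turn (turn h)))
      (s′ (λ h → turn (turn (turn h)))) (s′ (λ h → turn (turn (turn (turn h)))))))
    where
    s s′ : (Tally → Tally) → ℕ
    s tr = star true d (tr pays)
    s′ tr = star true d (tr (flip pays))
    d₁ = N d
    d₂ = N d₁
    d₃ = N d₂
    d₄ = N d₃
    p₁ = S-dg true p
    p₂ = S-dg true p₁
    p₃ = S-dg true p₂
    p₄ = S-dg true p₃
    f₁ = full-S true d p f
    f₂ = full-S true d₁ p₁ f₁
    f₃ = full-S true d₂ p₂ f₂
    f₄ = full-S true d₃ p₃ f₃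

module Rotations (sys : DartSystem) where
  open DartSystem sys
  open Local sys

  fiveSum-flip′ : ∀ o f d → dg d ≡ 5 → fiveSum o f d ≡ fiveSum true f d
  fiveSum-flip′ true f d p = refl
  fiveSum-flip′ false f d p = fiveSum-flip true f d p

  record Around (d e : D) : Set where
    field
      dg-e : dg e ≡ 5
      full-e : full d ≡ true → full e ≡ true
      sum-e : ∀ f → fiveSum true f e ≡ fiveSum true f d

  around-refl : ∀ d → dg d ≡ 5 → Around d d
  around-refl d p = record { dg-e = p ; full-e = λ f → f ; sum-e = λ _ → refl }

  around-S : ∀ o d e → Around d e → Around d (S o e)
  around-S o d e a = record
    { dg-e = trans (dgS o e) dg-e ; full-e = λ f → full-S o e dg-e (full-e f)
    ; sum-e = λ f → trans (sym (fiveSum-flip′ o f _ (trans (dgS o e) dg-e)))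
        (trans (fiveSum-S o f e dg-e) (trans (fiveSum-flip′ o f e dg-e) (sum-e f))) }
    where open Around a

  -- The ten entries of `rots` are five starting darts in each of two orientations, so a successful
  -- entry yields a dart and an orientation. This serves for the poor vertices and again for turning
  -- `covered` into an actual star.
  rots-elim : ∀ {A : Set} o d → dg d ≡ 5 → (f : Cls → Cls → Cls → Cls → Cls → Bool) →
    (∀ o e → Around d e → star o e f ≡ true → A) →
    star o d (λ a b c d e → any (λ x → x) (rots a b c d e f)) ≡ true → A
  rots-elim {A} o d p f h q =
    or (h o d a₀)
    (or (λ x → h o d₁ a₁ (trans (star-rot o d p f) x))
    (or (λ x → h o d₂ a₂ (trans (star-rot² o d p f) x))
    (or (λ x → h o d₃ a₃ (trans (star-rot³ o d p f) x))
    (or (λ x → h o d₄ a₄ (trans (star-rot⁴ o d p f) x))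
    (or (λ x → h (not o) d a₀ (trans (star-flip o d p f) x))
    (or (λ x → h (not o) d₁ a₁ (trans (star-flip o d₁ p₁ f) (trans (star-rot o d p (flipᵇ f)) x)))
    (or (λ x → h (not o) d₂ a₂ (trans (star-flip o d₂ p₂ f) (trans (star-rot² o d p (flipᵇ f)) x)))
    (or (λ x → h (not o) d₃ a₃ (trans (star-flip o d₃ p₃ f) (trans (star-rot³ o d p (flipᵇ f)) x)))
    (or (λ x → h (not o) d₄ a₄ (trans (star-flip o d₄ p₄ f) (trans (star-rot⁴ o d p (flipᵇ f)) x))) (λ ())))))))))) q
    where
    or : ∀ {a b} → (a ≡ true → A) → (b ≡ true → A) → a ∨ b ≡ true → A
    or {true} x y q = x q
    or {false} x y q = y q
    flipᵇ : (Cls → Cls → Cls → Cls → Cls → Bool) → Cls → Cls → Cls → Cls → Cls → Bool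
    flipᵇ g a b c d e = g a e d c b
    d₁ = S o d
    d₂ = S o d₁
    d₃ = S o d₂
    d₄ = S o d₃
    a₀ = around-refl d p
    a₁ = around-S o d d a₀
    a₂ = around-S o d d₁ a₁
    a₃ = around-S o d d₂ a₂
    a₄ = around-S o d d₃ a₃
    dg5 : ∀ {e} → dg e ≡ 5 → dg (S o e) ≡ 5
    dg5 q = trans (dgS o _) q
    p₁ = dg5 p
    p₂ = dg5 p₁
    p₃ = dg5 p₂
    p₄ = dg5 p₃

module Fives (sys : DartSystem) (uncov : Uncovered sys) where
  open DartSystem sys
  open Local sys
  open Payments sys
  open Bounds sys uncov
  open FiveVertex sys uncov
  open Rotations sys

  received taken : D → ℕ
  received e = out (R e)
  taken e = take (R e)

  -- The triangles at x make x and then m the next two vertices after the poor one in the rotation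
  -- at K. Thus the degree of m, which selects the payer, is also what the distance-2 bit in the
  -- share of K records.
  beyond-shared : ∀ o e → dg e ≡ 5 → full e ≡ true → t e ≡ c5 → full (R e) ≡ true →
    t (S o (S o (R (S o e)))) ≡ beyond o (R e)
  beyond-shared o e p f q fx = trans (cong (λ x → t (S o x)) (sym (rot o e (full-corner o e p f))))
    (side⁻ o (S (not o) (R e)) (full-corner (not o) _ (S-dg (not o) px) (full-S (not o) (R e) px fx)))
    where
    px = dgR-5 e q

  take-shared : ∀ o e → dg e ≡ 5 → full e ≡ true → t e ≡ c5 → full (R e) ≡ true → big (beyond o (R e)) ≡ true →
    ∃[ l₂ ] take (R (S o e)) ≡ takeF (t (S o e)) l₂ (big (t (S o (S o e)))) false true
      (t (S o (S o (S o e)))) (t (S o (S o (S o (S o e))))) true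
  take-shared o e p f q fx m = _ , trans (take-full o (S o e) (S-dg o p) (full-S o e p f))
    (cong₂ (λ r r₂ → takeF (t (S o e)) (big (t (S (not o) (S (not o) (R (S o e)))))) (big (t (S o (S o e)))) r r₂
        (t (S o (S o (S o e)))) (t (S o (S o (S o (S o e))))) true)
      (cong big (trans (cong t (S-inv′ o e)) q))
      (trans (cong big (beyond-shared o e p f q fx)) m))

  gain7 : ∀ {k b l₂ o₁ o₂ x y} → k ≡ c7 → x ≡ c5 → y ≡ c5 →
    takeF k false (big x) (big y) false o₁ o₂ true + amount k b ≤ takeF k l₂ (big x) false true o₁ o₂ true
  gain7 {b = b} {l₂ = l₂} refl refl refl rewrite ∨-zeroʳ l₂ = +-monoʳ-≤ 240 (amount-X c7 b)

  gain11 : ∀ {k l₂ o₁ o₂ x y} → k ≡ c11 → x ≡ c6 → y ≡ c5 →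
    takeF k false (big x) (big y) false o₁ o₂ true + 168 ≤ takeF k l₂ (big x) false true o₁ o₂ true
  gain11 refl refl refl = ≤-refl

  is-c7 : ∀ k b → k ≡ c7 ⊎ amount k b ≡ amount′ k b
  is-c7 c5 b = inj₂ refl
  is-c7 c6 b = inj₂ refl
  is-c7 c7 b = inj₁ refl
  is-c7 c8 b = inj₂ refl
  is-c7 c9 b = inj₂ refl
  is-c7 c10 b = inj₂ refl
  is-c7 c11 b = inj₂ refl
  is-c7 c12 b = inj₂ refl
  is-c7 c13 b = inj₂ refl
  is-c7 c14 b = inj₂ refl
  is-c7 c15 b = inj₂ refl
  is-c7 c16-17 b = inj₂ refl
  is-c7 c18-35 b = inj₂ refl
  is-c7 c36+ b = inj₂ refl

  pay-≤-out : ∀ o d → pay o d ≤ out d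
  pay-≤-out true d = m≤m+n (pay true d) (pay false d)
  pay-≤-out false d = m≤n+m (pay false d) (pay true d)

  payX-≤ : ∀ o d → payX o d ≤ pay o d
  payX-≤ o d = ≤-trans (m≤m+n (payX o d) (payZ o d)) (m≤m+n (payX o d + payZ o d) (payY o d))

  payZ-≤ : ∀ o d → payZ o d ≤ pay o d
  payZ-≤ o d = ≤-trans (m≤n+m (payZ o d) (payX o d)) (m≤m+n (payX o d + payZ o d) (payY o d))

  payY-≤ : ∀ o d → payY o d ≤ pay o d
  payY-≤ o d = m≤n+m (payY o d) (payX o d + payZ o d)

  first-≤ : ∀ o (f : D → ℕ) e → f e ≤ fiveSum o f e
  first-≤ o f e = ≤-trans (≤-trans (≤-trans (m≤m+n (f e) _) (m≤m+n (f e + f (S o e)) _))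
    (m≤m+n (f e + f (S o e) + f (S o (S o e))) _)) (m≤m+n (f e + f (S o e) + f (S o (S o e)) + f (S o (S o (S o e)))) _)

  last-≤ : ∀ o (f : D → ℕ) e → dg e ≡ 5 → f (S (not o) e) ≤ fiveSum o f e
  last-≤ o f e p = subst (λ x → f x ≤ fiveSum o f e) (S⁴ o e p)
    (m≤n+m (f (S o (S o (S o (S o e))))) (f e + f (S o e) + f (S o (S o e)) + f (S o (S o (S o e)))))

  Gets : Bool → D → ℕ → Set
  Gets o e g = star o e takes + g ≤ fiveSum o taken e + fiveSum o received e

  gets-first : ∀ o e {g} → dg e ≡ 5 → full e ≡ true → g ≤ pay o (R e) → Gets o e g
  gets-first o e p f h = +-mono-≤ (takes-≤ o e p f) (≤-trans h (≤-trans (pay-≤-out o (R e)) (first-≤ o received e)))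

  gets-last : ∀ o e {g} → dg e ≡ 5 → full e ≡ true → g ≤ pay o (R (S (not o) e)) → Gets o e g
  gets-last o e p f h = +-mono-≤ (takes-≤ o e p f)
    (≤-trans h (≤-trans (pay-≤-out o (R (S (not o) e))) (last-≤ o received e p)))

  gets-take : ∀ o e {g} → dg e ≡ 5 → full e ≡ true → star o e (turn lowTake) + g ≤ take (R (S o e)) → Gets o e g
  gets-take o e {g} p f h = ≤-trans (takes-gain o e g p f h) (m≤m+n (fiveSum o taken e) _)

  payX-eq : ∀ o e → poorAt o e ≡ true → payX o (R e) ≡
    (if full (R e) then (if big (beyond o (R e)) then need′ o e else 0) else need o e)
  payX-eq o e q rewrite RR e | q = refl

  payZ-eq : ∀ o e → payZ o (R (S (not o) e)) ≡ (if condZ o e then need o e else 0)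
  payZ-eq o e rewrite RR (S (not o) e) | S-inv o e = refl

  payY-eq : ∀ o e → payY o (R e) ≡ (if condY o (R e) e then 168 else 0)
  payY-eq o e rewrite RR e = refl

  gets-need : ∀ o e → poorAt o e ≡ true → Gets o e (need o e)
  gets-need o e q = go (full (R e)) (big (beyond o (R e))) refl refl
    where
    open Poor (poorAt-sound o e q)
    go : ∀ a b → full (R e) ≡ a → big (beyond o (R e)) ≡ b → Gets o e (need o e)
    go false b fx m = gets-first o e dg-v full-v (subst (_≤ pay o (R e)) h (payX-≤ o (R e)))
      where
      h : payX o (R e) ≡ need o e
      h = trans (payX-eq o e q) (cong (λ z → if z then (if big (beyond o (R e)) then need′ o e else 0) else need o e) fx)
    go true true fx m with is-c7 (t (S o e)) (t (S o (S o (S o e))))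
    ... | inj₂ s = gets-first o e dg-v full-v (subst (_≤ pay o (R e)) (trans h (sym s)) (payX-≤ o (R e)))
      where
      h : payX o (R e) ≡ need′ o e
      h = trans (payX-eq o e q) (cong₂ (λ z y → if z then (if y then need′ o e else 0) else need o e) fx m)
    ... | inj₁ s = gets-take o e dg-v full-v (subst (star o e (turn lowTake) + need o e ≤_)
      (sym (proj₂ (take-shared o e dg-v full-v tx fx m))) (gain7 s ty tx))
    go true false fx m = gets-last o e dg-v full-v (subst (_≤ pay o (R (S (not o) e))) h (payZ-≤ o (R (S (not o) e))))
      where
      h : payZ o (R (S (not o) e)) ≡ need o e
      h = trans (payZ-eq o e) (cong (λ z → if z then need o e else 0)
        (∧-join q (∧-join fx (trans (sym (not-involutive _)) (cong not m)))))

  -- The shares 840 of the 11-vertex and 672 of the 10-vertex leave 168 missing. Rule Y is silent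
  -- only if x has all its corners on triangles and m is big; then m lies at distance 2 around the
  -- 11-vertex, whose share rises from 840 to 1008.
  gets-168 : ∀ o e → dg e ≡ 5 → full e ≡ true → t e ≡ c5 → t (S o e) ≡ c11 → t (S o (S o e)) ≡ c6 →
    t (S o (S o (S o e))) ≡ c5 → t (S o (S o (S o (S o e)))) ≡ c10 → Gets o e 168
  gets-168 o e p f q₀ q₁ q₂ q₃ q₄ = go (full (R e)) (is5 (beyond o (R e))) refl refl
    where
    pays-168 : not (full (R e)) ∨ is5 (beyond o (R e)) ≡ true → Gets o e 168
    pays-168 z = gets-first o e p f (subst (_≤ pay o (R e)) h (payY-≤ o (R e)))
      where
      h : payY o (R e) ≡ 168
      h = trans (payY-eq o e) (cong (λ z → if z then 168 else 0)
        (∧-join (cong (λ k → is5 (cls k)) p) (∧-join f (∧-join (cong is5 q₀) (∧-join (cong is11 q₁)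
          (∧-join (cong is6 q₂) (∧-join (cong is5 q₃) (∧-join (cong is10 q₄) z))))))))
    go : ∀ a b → full (R e) ≡ a → is5 (beyond o (R e)) ≡ b → Gets o e 168
    go false b fx m = pays-168 (cong (λ z → not z ∨ is5 (beyond o (R e))) fx)
    go true true fx m = pays-168 (trans (cong (not (full (R e)) ∨_) m) (∨-comm (not (full (R e))) true))
    go true false fx m = gets-take o e p f (subst (star o e (turn lowTake) + 168 ≤_)
      (sym (proj₂ (take-shared o e p f q₀ fx (cong not m)))) (gain11 q₁ q₂ q₀))

  ≤-gets : ∀ o d e {r g} → Around d e → r ≤ star o e takes + g → Gets o e g →
    r ≤ fiveSum true taken d + fiveSum true received d
  ≤-gets o d e {r} a h k = subst₂ (λ x y → r ≤ x + y) (eq taken) (eq received) (≤-trans h k)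
    where
    open Around a
    eq : ∀ f → fiveSum o f e ≡ fiveSum true f d
    eq f = trans (fiveSum-flip′ o f e dg-e) (sum-e f)

  from-poor₁ : ∀ d r → full d ≡ true → ∀ o e → Around d e → star o e (poor₁ r) ≡ true →
    r ≤ fiveSum true taken d + fiveSum true received d
  from-poor₁ d r f o e ar = go _ _ _ _ refl refl refl refl
    where
    open Around ar
    go : ∀ a b c z → is5 (t e) ≡ a → is5 (t (S o (S o e))) ≡ b → is5 (t (S o (S o (S o (S o e))))) ≡ c →
      (r ≤ᵇ star o e takes + need o e) ≡ z → a ∧ b ∧ c ∧ z ≡ true →
      r ≤ fiveSum true taken d + fiveSum true received d
    go true true true true q₀ q₂ q₄ h _ = ≤-gets o d e ar (≤ᵇ-sound h) (gets-need o e
      (∧-join (cong (λ k → is5 (cls k)) dg-e) (∧-join (full-e f) (∧-join q₀ (∧-join q₂ q₄)))))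

  from-poor₂ : ∀ d r → full d ≡ true → ∀ o e → Around d e → star o e (poor₂ r) ≡ true →
    r ≤ fiveSum true taken d + fiveSum true received d
  from-poor₂ d r f o e ar = go _ _ _ _ _ _ refl refl refl refl refl refl
    where
    open Around ar
    go : ∀ a b c a′ b′ z → is5 (t e) ≡ a → is11 (t (S o e)) ≡ b → is6 (t (S o (S o e))) ≡ c →
      is5 (t (S o (S o (S o e)))) ≡ a′ → is10 (t (S o (S o (S o (S o e))))) ≡ b′ →
      (r ≤ᵇ star o e takes + 168) ≡ z → a ∧ b ∧ c ∧ a′ ∧ b′ ∧ z ≡ true →
      r ≤ fiveSum true taken d + fiveSum true received d
    go true true true true true true q₀ q₁ q₂ q₃ q₄ h _ = ≤-gets o d e ar (≤ᵇ-sound h)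
      (gets-168 o e dg-e (full-e f) (is5-≡ q₀) (is11-≡ q₁) (is6-≡ q₂) (is5-≡ q₃) (is10-≡ q₄))

  starVec : D → Vec Cls 5
  starVec d = t d ∷ t (N d) ∷ t (N (N d)) ∷ t (N (N (N d))) ∷ t (N (N (N (N d)))) ∷ []

  or-covered-elim : ∀ ok d → dg d ≡ 5 → or-covered ok (starVec d) ≡ true → star true d ok ≡ true
  or-covered-elim ok d p q with ∨-elim (star true d ok) q
  ... | inj₁ r = r
  ... | inj₂ r with () ← trans (sym r) (uncov true d p)

  full-balanced : ∀ d → dg d ≡ 5 → full d ≡ true → Balanced d
  full-balanced d p f =
    [ (λ h → base-balanced d p (≤-trans h (m≤n+m (lows d) (840 * fiveSum true nt d))))
    , (λ h → ≤-trans (+-monoʳ-≤ 1680 (paid-full d p f)) (≤-trans (goal (or-covered-elim full-ok d p h))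
        (m≤n+m _ (840 * fiveSum true nt d))))
    ]′ (search-sound 1680 (or-covered full-ok) 0 full-search (starVec d))
    where
    r = 1680 + star true d (λ a b c d e → sum (rots a b c d e pays))
    any-poor : (ℕ → Cls → Cls → Cls → Cls → Cls → Bool) → Bool
    any-poor poor = star true d (λ a b c d e → any (λ x → x) (rots a b c d e (poor r)))
    goal : (r ≤ᵇ star true d takes) ∨ any-poor poor₁ ∨ any-poor poor₂ ≡ true →
      r ≤ fiveSum true taken d + fiveSum true received d
    goal q =
      [ (λ q → ≤-trans (≤ᵇ-sound q) (≤-trans (takes-≤ true d p f) (m≤m+n (fiveSum true taken d) _)))
      , (λ q → [ rots-elim true d p (poor₁ r) (from-poor₁ d r f) , rots-elim true d p (poor₂ r) (from-poor₂ d r f) ]′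
          (∨-elim (any-poor poor₁) q))
      ]′ (∨-elim (r ≤ᵇ star true d takes) q)

∧-false₂ : ∀ a {b c} → b ≡ false → a ∧ b ∧ c ≡ false
∧-false₂ true refl = refl
∧-false₂ false refl = refl

∧-false₃ : ∀ a b {c d} → c ≡ false → a ∧ b ∧ c ∧ d ≡ false
∧-false₃ true b p = ∧-false₂ b p
∧-false₃ false b p = refl

∧-false₄ : ∀ a b c {d} → d ≡ false → a ∧ b ∧ c ∧ d ≡ false
∧-false₄ true true true p = p
∧-false₄ true true false p = refl
∧-false₄ true false c p = refl
∧-false₄ false b c p = refl

swap+ : ∀ a b c d e f → 0 + (a + b) + (c + d) + (e + f) + 0 ≡ b + a + d + c + f + e
swap+ = solve-∀

one-more : ∀ {n} x y → n ≡ 1 → 840 + x ≤ y → 1680 + x ≤ 840 * n + y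
one-more x y refl h = ≤-trans (≤-reflexive (+-assoc 840 840 x)) (+-monoʳ-≤ 840 h)

data Corners : (a b c d e : Bool) → Set where
  all-tri : Corners true true true true true
  at₀ : Corners false true true true true
  at₁ : Corners true false true true true
  at₂ : Corners true true false true true
  at₃ : Corners true true true false true
  at₄ : Corners true true true true false
  many : ∀ {a b c d e} → 2 ≤ bit (not a) + bit (not b) + bit (not c) + bit (not d) + bit (not e) → Corners a b c d e

corners : ∀ a b c d e → Corners a b c d e
corners true true true true true = all-tri
corners false true true true true = at₀
corners true false true true true = at₁
corners true true false true true = at₂
corners true true true false true = at₃
corners true true true true false = at₄
corners false false _ _ _ = many (s≤s (s≤s z≤n))
corners false true false _ _ = many (s≤s (s≤s z≤n))
corners false true true false _ = many (s≤s (s≤s z≤n))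
corners false true true true false = many (s≤s (s≤s z≤n))
corners true false false _ _ = many (s≤s (s≤s z≤n))
corners true false true false _ = many (s≤s (s≤s z≤n))
corners true false true true false = many (s≤s (s≤s z≤n))
corners true true false false _ = many (s≤s (s≤s z≤n))
corners true true false true false = many (s≤s (s≤s z≤n))
corners true true true false false = many (s≤s (s≤s z≤n))

module Balance (sys : DartSystem) (uncov : Uncovered sys) where
  open DartSystem sys
  open Local sys
  open Payments sys
  open Bounds sys uncov
  open FiveVertex sys uncov
  open Fives sys uncov

  take-≥ : ∀ e {l r o₁ o₂ g} → dg e ≡ 5 → big (t (P (R e))) ≡ l → big (t (N (R e))) ≡ r →
    t (N (N e)) ≡ o₁ → t (P (P e)) ≡ o₂ → reg e ≡ g → takeF (t e) false l r false o₁ o₂ g ≤ take (R e)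
  take-≥ e p refl refl refl refl refl = ≤-trans
    (takeF-mono (t e) (big (t (P (P (R e))))) (big (t (P (R e)))) (big (t (N (R e)))) (big (t (N (N (R e)))))
      (t (N (N e))) (t (P (P e))) (reg e))
    (≤-reflexive (sym (take-unfold e p)))

  module OneCorner (d : D) (p : dg d ≡ 5) (n₀ : tri d ≡ false) (n₁ : tri (N d) ≡ true) (n₂ : tri (N (N d)) ≡ true)
    (n₃ : tri (N (N (N d))) ≡ true) (n₄ : tri (N (N (N (N d)))) ≡ true) where

    d₁ = N d
    d₂ = N d₁
    d₃ = N d₂
    d₄ = N d₃
    p₁ : dg d₁ ≡ 5
    p₁ = S-dg true p
    p₂ : dg d₂ ≡ 5
    p₂ = S-dg true p₁
    p₃ : dg d₃ ≡ 5
    p₃ = S-dg true p₂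
    p₄ : dg d₄ ≡ 5
    p₄ = S-dg true p₃

    n₅ : tri (N d₄) ≡ false
    n₅ = trans (cong tri (N⁵ d p)) n₀

    out-zero : ∀ e o → corner o e ≡ false → out e ≡ 0
    out-zero e o c = cong₂ _+_ (pay-zero true o e c) (pay-zero false o e c)

    paid : ℕ
    paid = star true d (λ a b c d e →
      paysN b c d e a + paysN b a e d c + paysN c d e a b + paysN c b a e d + paysN d e a b c + paysN d c b a e)

    paid-≤ : fiveSum true out d ≤ paid
    paid-≤ = ≤-trans (+-mono-≤ (+-mono-≤ (+-mono-≤ (+-mono-≤ (≤-reflexive (out-zero d false n₀))
        (paid-by paysN d d₁ p₁ (λ o → pay-N o d₁ p₁) turn (star-rot true d p)))
        (paid-by paysN d d₂ p₂ (λ o → pay-N o d₂ p₂) (λ h → turn (turn h)) (star-rot² true d p)))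
        (paid-by paysN d d₃ p₃ (λ o → pay-N o d₃ p₃) (λ h → turn (turn (turn h))) (star-rot³ true d p)))
        (≤-reflexive (out-zero d₄ true n₅)))
      (≤-reflexive (swap+ (s′ turn) (s turn) (s′ (λ h → turn (turn h))) (s (λ h → turn (turn h)))
        (s′ (λ h → turn (turn (turn h)))) (s (λ h → turn (turn (turn h))))))
      where
      s s′ : (Tally → Tally) → ℕ
      s tr = star true d (tr paysN)
      s′ tr = star true d (tr (flip paysN))

    takes-N : star true d takesN ≤ fiveSum true taken d
    takes-N = +-mono-≤ (+-mono-≤ (+-mono-≤ (+-mono-≤
      (≤-trans (takeF-monoʳ (t d) (big (t d₁)) (big (t (N (R d)))) _ _ false)
        (take-≥ d p (cong big (side true d n₁)) refl refl (cong t (sym (S³ true d p)))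
          (∧-false₂ (corner true d) n₀)))
      (take-≥ d₁ p₁ (cong big (side true d₁ n₂)) (cong big (trans (side false d₁ n₁) (cong t (PN d)))) refl
        (cong t (trans (cong P (PN d)) (sym (S⁴ true d p))))
        (∧-false₄ (corner true d₁) (corner false d₁) (corner true d₂) (trans (cong tri (PN d)) n₀))))
      (take-≥ d₂ p₂ (cong big (side true d₂ n₃)) (cong big (trans (side false d₂ n₂) (cong t (PN d₁)))) refl
        (cong t (trans (cong P (PN d₁)) (PN d)))
        (∧-join n₃ (∧-join n₂ (∧-join n₄ (trans (cong tri (PN d₁)) n₁))))))
      (take-≥ d₃ p₃ (cong big (side true d₃ n₄)) (cong big (trans (side false d₃ n₃) (cong t (PN d₂))))
        (cong t (N⁵ d p)) (cong t (trans (cong P (PN d₂)) (PN d₁)))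
        (∧-false₃ (corner true d₃) (corner false d₃) n₅)))
      (≤-trans (takeF-monoˡ (t d₄) (big (t (P (R d₄)))) (big (t d₃)) _ _ false)
        (take-≥ d₄ p₄ refl (cong big (trans (side false d₄ n₄) (cong t (PN d₃))))
          (cong (λ x → t (N x)) (N⁵ d p)) (cong t (trans (cong P (PN d₃)) (PN d₂)))
          (cong (_∧ (corner false d₄ ∧ corner true (N d₄) ∧ corner false (P d₄))) n₅)))

    nt-one : fiveSum true nt d ≡ 1
    nt-one rewrite n₀ | n₁ | n₂ | n₃ | n₄ = refl

    from-search : or-covered one-ok (starVec d) ≡ true → 840 + fiveSum true out d ≤ fiveSum true taken d + fiveSum true received d
    from-search h = ≤-trans (+-monoʳ-≤ 840 paid-≤) (≤-trans
      (≤ᵇ-sound {840 + paid} {star true d takesN} (or-covered-elim one-ok d p h))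
      (≤-trans takes-N (m≤m+n (fiveSum true taken d) (fiveSum true received d))))

    from-lows : 840 ≤ lows d → 1680 ≤ 840 * fiveSum true nt d + lows d
    from-lows h = subst (_≤ 840 * fiveSum true nt d + lows d) (+-identityʳ 1680) (one-more 0 (lows d) nt-one h)

    balanced : Balanced d
    balanced =
      [ (λ h → base-balanced d p (from-lows h))
      , (λ h → one-more (fiveSum true out d) (fiveSum true taken d + fiveSum true received d) nt-one (from-search h))
      ]′ (search-sound 840 (or-covered one-ok) 0 one-search (starVec d))

  balanced-N : ∀ d → dg d ≡ 5 → Balanced (N d) → Balanced d
  balanced-N d p h = subst₂ (λ x y → 1680 + x ≤ y) (fiveSum-S true out d p)
    (cong₂ (λ n m → 840 * n + m) (fiveSum-S true nt d p)
      (cong₂ _+_ (fiveSum-S true taken d p) (fiveSum-S true received d p))) h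

  tri-N⁵ : ∀ {b} d → dg d ≡ 5 → tri d ≡ b → tri (N (N (N (N (N d))))) ≡ b
  tri-N⁵ d p q = trans (cong tri (N⁵ d p)) q

  Shape : (a b c a′ b′ : Bool) → Set
  Shape a b c a′ b′ = ∀ d → dg d ≡ 5 → tri d ≡ a → tri (N d) ≡ b → tri (N (N d)) ≡ c →
    tri (N (N (N d))) ≡ a′ → tri (N (N (N (N d)))) ≡ b′ → Balanced d

  turn-shape : ∀ {a b c a′ b′} → Shape b c a′ b′ a → Shape a b c a′ b′
  turn-shape h d p n₀ n₁ n₂ n₃ n₄ = balanced-N d p (h (N d) (S-dg true p) n₁ n₂ n₃ n₄ (tri-N⁵ d p n₀))

  shape : ∀ {a b c a′ b′} → Corners a b c a′ b′ → Shape a b c a′ b′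
  shape all-tri d p n₀ n₁ n₂ n₃ n₄ = full-balanced d p (∧-join n₀ (∧-join n₁ (∧-join n₂ (∧-join n₃ n₄))))
  -- Two corners off triangles already supply 2 * 840 = 1680.
  shape (many h) d p refl refl refl refl refl =
    base-balanced d p (≤-trans (*-monoʳ-≤ 840 h) (m≤m+n (840 * fiveSum true nt d) (lows d)))
  shape at₀ = OneCorner.balanced
  shape at₁ = turn-shape OneCorner.balanced
  shape at₂ = turn-shape (turn-shape OneCorner.balanced)
  shape at₃ = turn-shape (turn-shape (turn-shape OneCorner.balanced))
  shape at₄ = turn-shape (turn-shape (turn-shape (turn-shape OneCorner.balanced)))

  balanced : ∀ d → dg d ≡ 5 → Balanced d
  balanced d p = shape (corners (tri d) (tri (N d)) (tri (N (N d))) (tri (N (N (N d)))) (tri (N (N (N (N d))))))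
    d p refl refl refl refl refl

-- Vertices of degree at least 6

∑-mono : ∀ k {f g} → (∀ j → f j ≤ g j) → ∑ k f ≤ ∑ k g
∑-mono zero h = z≤n
∑-mono (suc k) h = +-mono-≤ (h 0) (∑-mono k (λ j → h (suc j)))

∑-cong : ∀ k {f g} → (∀ j → f j ≡ g j) → ∑ k f ≡ ∑ k g
∑-cong zero h = refl
∑-cong (suc k) h = cong₂ _+_ (h 0) (∑-cong k (λ j → h (suc j)))

interchange+ : ∀ a b c d → (a + b) + (c + d) ≡ (a + c) + (b + d)
interchange+ = solve-∀

∑-+ : ∀ k f g → ∑ k (λ j → f j + g j) ≡ ∑ k f + ∑ k g
∑-+ zero f g = refl
∑-+ (suc k) f g = trans (cong (f 0 + g 0 +_) (∑-+ k _ _)) (interchange+ (f 0) (g 0) _ _)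

∑-const : ∀ k c → ∑ k (λ _ → c) ≡ k * c
∑-const zero c = refl
∑-const (suc k) c = cong (c +_) (∑-const k c)

∑-* : ∀ k c f → ∑ k (λ j → c * f j) ≡ c * ∑ k f
∑-* zero c f = sym (*-zeroʳ c)
∑-* (suc k) c f = trans (cong (c * f 0 +_) (∑-* k c (λ j → f (suc j)))) (sym (*-distribˡ-+ c (f 0) (∑ k (λ j → f (suc j)))))

∑-shift : ∀ k f → f 0 + ∑ k (λ j → f (suc j)) ≡ ∑ k f + f k
∑-shift zero f = +-comm (f 0) 0
∑-shift (suc k) f = trans (cong (f 0 +_) (∑-shift k (λ j → f (suc j)))) (sym (+-assoc (f 0) _ _))

∑-cycle : ∀ k f → f k ≡ f 0 → ∑ k (λ j → f (suc j)) ≡ ∑ k f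
∑-cycle k f p = +-cancelˡ-≡ (f 0) _ _ (trans (∑-shift k f) (trans (cong (∑ k f +_) p) (+-comm (∑ k f) (f 0))))

∑-≤ : ∀ k {f} M → (∀ j → f j ≤ M) → ∑ k f ≤ k * M
∑-≤ k M h = ≤-trans (∑-mono k h) (≤-reflexive (∑-const k M))

∑-≤-one : ∀ k {f} M m → (∀ j → f j ≤ M) → ∀ j → j < suc k → f j ≤ m → ∑ (suc k) f ≤ m + k * M
∑-≤-one k M m h zero _ q = +-mono-≤ q (∑-≤ k M (λ j → h (suc j)))
∑-≤-one zero M m h (suc j) (s≤s ()) q
∑-≤-one (suc k) {f} M m h (suc j) (s≤s j<k) q = ≤-trans (+-mono-≤ (h 0) (∑-≤-one k M m (λ j → h (suc j)) j j<k q))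
  (≤-reflexive (trans (sym (+-assoc M m (k * M))) (trans (cong (_+ k * M) (+-comm M m)) (+-assoc m M (k * M)))))

find : ∀ n (p : ℕ → Bool) → (∃[ j ] j < n × p j ≡ true) ⊎ (∀ j → j < n → p j ≡ false)
find zero p = inj₂ λ _ ()
find (suc n) p with p 0 in p₀ | find n (λ j → p (suc j))
... | true | _ = inj₁ (0 , s≤s z≤n , p₀)
... | false | inj₁ (j , q , r) = inj₁ (suc j , s≤s q , r)
... | false | inj₂ h = inj₂ λ where
  zero _ → p₀
  (suc j) (s≤s q) → h j q

windows-∑ : ∀ u k b → windows u (applyUpTo b (4 + k)) ≡
  ∑ k (λ j → if b (2 + j) then 0 else u (b j) (b (1 + j)) (b (3 + j)) (b (4 + j)))
windows-∑ u zero b = refl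
windows-∑ u (suc k) b = cong ((if b 2 then 0 else u (b 0) (b 1) (b 3) (b 4)) +_) (windows-∑ u k (λ j → b (suc j)))

take-cycle : ∀ k (b : ℕ → Bool) → (∀ j → b (4 + k + j) ≡ b j) →
  applyUpTo (λ j → b (4 + k + j)) 4 ≡ List.take 4 (applyUpTo b (4 + k))
take-cycle k b h rewrite h 0 | h 1 | h 2 | h 3 = refl

applyUpTo-+ : ∀ (b : ℕ → Bool) m n → applyUpTo b (m + n) ≡ applyUpTo b m ++ applyUpTo (λ j → b (m + j)) n
applyUpTo-+ b zero n = refl
applyUpTo-+ b (suc m) n = cong (b 0 ∷_) (applyUpTo-+ (λ j → b (suc j)) m n)

length-applyUpTo : ∀ (b : ℕ → Bool) k → length (applyUpTo b k) ≡ k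
length-applyUpTo b zero = refl
length-applyUpTo b (suc k) = cong suc (length-applyUpTo (λ j → b (suc j)) k)

any-false : ∀ b k → any (λ x → x) (applyUpTo b k) ≡ false → ∀ j → j < k → b j ≡ false
any-false b (suc k) p j q with b 0 in b₀
any-false b (suc k) p zero q | false = b₀
any-false b (suc k) p (suc j) (s≤s q) | false = any-false (λ j → b (suc j)) k p j q

Plain : ℕ → Set
Plain k = (∀ l₂ l r r₂ o₁ o₂ g → takeF (cls k) l₂ l r r₂ o₁ o₂ g ≡ half (cls k) * (2 + bit l + bit r)) ×
  2 * half (cls k) * k + 10080 ≤ 1680 * k

-- Each further degree adds 1680 to the budget and at most that much to the shares, so the smallest
-- degree of an open range decides. It is applied with `c` twice the `half` of the last two classes.
large : ∀ c m k → c ≤ 1680 → c * m + 10080 ≤ 1680 * m → c * (m + k) + 10080 ≤ 1680 * (m + k)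
large c m k p q = begin
  c * (m + k) + 10080 ≡⟨ split c m k 10080 ⟩
  (c * m + 10080) + c * k ≤⟨ +-mono-≤ q (*-monoˡ-≤ k p) ⟩
  1680 * m + 1680 * k ≡⟨ *-distribˡ-+ 1680 m k ⟨
  1680 * (m + k) ∎
  where
  open ≤-Reasoning
  split : ∀ c m k x → c * (m + k) + x ≡ (c * m + x) + c * k
  split = solve-∀

k>17 : ∀ {k} → (k ≤ᵇ 17) ≡ false → 18 ≤ k
k>17 {k} q = ≰⇒> λ p → subst T q (≤⇒≤ᵇ p)

plain-or : ∀ k → 6 ≤ k → k ≡ 7 ⊎ k ≡ 11 ⊎ k ≡ 13 ⊎ Plain k
plain-or 0 ()
plain-or 1 (s≤s ())
plain-or 2 (s≤s (s≤s ()))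
plain-or 3 (s≤s (s≤s (s≤s ())))
plain-or 4 (s≤s (s≤s (s≤s (s≤s ()))))
plain-or 5 (s≤s (s≤s (s≤s (s≤s (s≤s ())))))
plain-or 6 _ = inj₂ (inj₂ (inj₂ ((λ _ _ _ _ _ _ _ → refl) , ≤ᵇ-sound refl)))
plain-or 7 _ = inj₁ refl
plain-or 8 _ = inj₂ (inj₂ (inj₂ ((λ _ _ _ _ _ _ _ → refl) , ≤ᵇ-sound refl)))
plain-or 9 _ = inj₂ (inj₂ (inj₂ ((λ _ _ _ _ _ _ _ → refl) , ≤ᵇ-sound refl)))
plain-or 10 _ = inj₂ (inj₂ (inj₂ ((λ _ _ _ _ _ _ _ → refl) , ≤ᵇ-sound refl)))
plain-or 11 _ = inj₂ (inj₁ refl)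
plain-or 12 _ = inj₂ (inj₂ (inj₂ ((λ _ _ _ _ _ _ _ → refl) , ≤ᵇ-sound refl)))
plain-or 13 _ = inj₂ (inj₂ (inj₁ refl))
plain-or 14 _ = inj₂ (inj₂ (inj₂ ((λ _ _ _ _ _ _ _ → refl) , ≤ᵇ-sound refl)))
plain-or 15 _ = inj₂ (inj₂ (inj₂ ((λ _ _ _ _ _ _ _ → refl) , ≤ᵇ-sound refl)))
plain-or 16 _ = inj₂ (inj₂ (inj₂ ((λ _ _ _ _ _ _ _ → refl) , ≤ᵇ-sound refl)))
plain-or 17 _ = inj₂ (inj₂ (inj₂ ((λ _ _ _ _ _ _ _ → refl) , ≤ᵇ-sound refl)))
plain-or (suc (suc (suc (suc (suc (suc (suc (suc (suc (suc (suc (suc (suc (suc (suc (suc (suc (suc k)))))))))))))))))) _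
  with k ≤ᵇ 17 in q
... | true = inj₂ (inj₂ (inj₂ ((λ _ _ _ _ _ _ _ → refl) , large 1120 18 k (≤ᵇ-sound refl) (≤ᵇ-sound refl))))
... | false = inj₂ (inj₂ (inj₂ ((λ _ _ _ _ _ _ _ → refl) , subst (λ n → 1400 * n + 10080 ≤ 1680 * n) (cong (18 +_) (m+[n∸m]≡n {18} {k} (k>17 q)))
    (large 1400 36 (k ∸ 18) (≤ᵇ-sound refl) (≤ᵇ-sound refl)))))

module Degrees (sys : DartSystem) where
  open DartSystem sys
  open Local sys
  open Payments sys

  infixl 10 _↻_
  _↻_ : D → ℕ → D
  d ↻ j = iterate N j d

  orbit : (D → ℕ) → D → ℕ
  orbit F d = ∑ (dg d) (λ j → F (d ↻ j))

  ↻-N : ∀ j d → N (d ↻ j) ≡ N d ↻ j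
  ↻-N zero d = refl
  ↻-N (suc j) d = ↻-N j (N d)

  dg-↻ : ∀ j d → dg (d ↻ j) ≡ dg d
  dg-↻ zero d = refl
  dg-↻ (suc j) d = trans (dg-↻ j (N d)) (dgN d)

  ∑-N : ∀ k F d → d ↻ k ≡ d → ∑ k (λ j → F (N d ↻ j)) ≡ ∑ k (λ j → F (d ↻ j))
  ∑-N k F d p = ∑-cycle k (λ j → F (d ↻ j)) (cong F p)

  orbit-N : ∀ F d → orbit F (N d) ≡ orbit F d
  orbit-N F d rewrite dgN d = ∑-N (dg d) F d (period d)

  orbit-↻ : ∀ F j d → orbit F (d ↻ j) ≡ orbit F d
  orbit-↻ F zero d = refl
  orbit-↻ F (suc j) d = trans (orbit-↻ F j (N d)) (orbit-N F d)

  orbit-∘N : ∀ F d → orbit (λ e → F (N e)) d ≡ orbit F d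
  orbit-∘N F d = trans (∑-cong (dg d) (λ j → cong F (↻-N j d))) (∑-N (dg d) F d (period d))

  orbit-∘P : ∀ F d → orbit (λ e → F (P e)) d ≡ orbit F d
  orbit-∘P F d = trans (sym (orbit-∘N (λ e → F (P e)) d)) (∑-cong (dg d) (λ j → cong F (PN _)))

  bigᵈ : D → Bool
  bigᵈ e = big (t e)

  module PlainDegree (d : D) (pl : Plain (dg d)) where
    h = half (cls (dg d))

    x : D → ℕ
    x e = bit (bigᵈ e)

    -- A big neighbour forgoes 2h and hands h to each side. With the forgone part written on the
    -- left there is no subtraction, and around the vertex the same multiple of the number of big
    -- neighbours appears on both sides and cancels.
    pointwise : ∀ e → dg e ≡ dg d → take e + 2 * h * x e ≤ 2 * h + (h * x (P e) + h * x (N e))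
    pointwise e p with is5 (t e)
    ... | false = ≤-trans (≤-reflexive (*-identityʳ (2 * h))) (m≤m+n (2 * h) _)
    ... | true rewrite p | proj₁ pl (bigᵈ (P (P e))) (bigᵈ (P e)) (bigᵈ (N e)) (bigᵈ (N (N e)))
        (t (N (N (R e)))) (t (P (P (R e)))) (reg (R e)) = ≤-reflexive (eq h (x (P e)) (x (N e)))
      where
      eq : ∀ h a b → h * (2 + a + b) + 2 * h * 0 ≡ 2 * h + (h * a + h * b)
      eq = solve-∀

    bound : orbit take d + 10080 ≤ 1680 * dg d
    bound = ≤-trans (+-monoˡ-≤ 10080 (+-cancelʳ-≤ (2 * h * X) _ _ main)) (proj₂ pl)
      where
      open ≤-Reasoning
      k = dg d
      X = orbit x d
      main : orbit take d + 2 * h * X ≤ 2 * h * k + 2 * h * X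
      main = begin
        orbit take d + 2 * h * X ≡⟨ cong (orbit take d +_) (∑-* k (2 * h) (λ j → x (d ↻ j))) ⟨
        orbit take d + orbit (λ e → 2 * h * x e) d ≡⟨ ∑-+ k (λ j → take (d ↻ j)) (λ j → 2 * h * x (d ↻ j)) ⟨
        orbit (λ e → take e + 2 * h * x e) d ≤⟨ ∑-mono k (λ j → pointwise (d ↻ j) (dg-↻ j d)) ⟩
        orbit (λ e → 2 * h + (h * x (P e) + h * x (N e))) d
          ≡⟨ ∑-+ k (λ _ → 2 * h) (λ j → h * x (P (d ↻ j)) + h * x (N (d ↻ j))) ⟩
        ∑ k (λ _ → 2 * h) + orbit (λ e → h * x (P e) + h * x (N e)) d
          ≡⟨ cong₂ _+_ (trans (∑-const k (2 * h)) (*-comm k (2 * h)))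
             (trans (∑-+ k (λ j → h * x (P (d ↻ j))) (λ j → h * x (N (d ↻ j))))
             (cong₂ _+_ (trans (∑-* k h (λ j → x (P (d ↻ j)))) (cong (h *_) (orbit-∘P x d)))
               (trans (∑-* k h (λ j → x (N (d ↻ j)))) (cong (h *_) (orbit-∘N x d))))) ⟩
        2 * h * k + (h * X + h * X) ≡⟨ cong (2 * h * k +_) (twice h X) ⟩
        2 * h * k + 2 * h * X ∎
        where
        twice : ∀ h X → h * X + h * X ≡ 2 * h * X
        twice = solve-∀

  take-window : ∀ {K} (u : Bool → Bool → Bool → Bool → ℕ) → (∀ l₂ l r r₂ o₁ o₂ g → takeF K l₂ l r r₂ o₁ o₂ g ≤ u l₂ l r r₂) → ∀ e → cls (dg e) ≡ K →
    take (N (N e)) ≤ (if bigᵈ (N (N e)) then 0 else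
      u (bigᵈ e) (bigᵈ (N e)) (bigᵈ (N (N (N e)))) (bigᵈ (N (N (N (N e))))))
  take-window u h e p with is5 (t (N (N e)))
  ... | false = z≤n
  ... | true rewrite PN (N e) | PN e | dgN (N e) | dgN e | p = h _ _ _ _ _ _ _

  orbit-window : ∀ {K} (u : Bool → Bool → Bool → Bool → ℕ) → (∀ l₂ l r r₂ o₁ o₂ g → takeF K l₂ l r r₂ o₁ o₂ g ≤ u l₂ l r r₂) →
    ∀ k d → dg d ≡ 4 + k → cls (4 + k) ≡ K → orbit take d ≤ cyclic u (applyUpTo (λ j → bigᵈ (d ↻ j)) (4 + k))
  orbit-window {K} u h k d p q = begin
    -- A window starting at `j` has its centre at `j + 2`, so the orbit is turned by two darts
    -- before the comparison.
    orbit take d ≡⟨ trans (sym (orbit-↻ take 2 d)) (cong (λ n → ∑ n (λ j → take (d ↻ (2 + j))))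
      (trans (dg-↻ 2 d) p)) ⟩
    ∑ (4 + k) (λ j → take (d ↻ (2 + j))) ≤⟨ ∑-mono (4 + k) step ⟩
    ∑ (4 + k) (λ j → if b (2 + j) then 0 else u (b j) (b (1 + j)) (b (3 + j)) (b (4 + j)))
      ≡⟨ windows-∑ u (4 + k) b ⟨
    windows u (applyUpTo b (4 + (4 + k)))
      ≡⟨ cong (windows u) (trans (cong (applyUpTo b) (+-comm 4 (4 + k))) (trans (applyUpTo-+ b (4 + k) 4)
         (cong (applyUpTo b (4 + k) ++_) (take-cycle k b per)))) ⟩
    cyclic u (applyUpTo b (4 + k)) ∎
    where
    open ≤-Reasoning
    b : ℕ → Bool
    b j = bigᵈ (d ↻ j)
    ↻-+ : ∀ m j e → e ↻ (m + j) ≡ (e ↻ m) ↻ j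
    ↻-+ zero j e = refl
    ↻-+ (suc m) j e = ↻-+ m j (N e)
    per : ∀ j → b (4 + k + j) ≡ b j
    per j = cong bigᵈ (trans (↻-+ (4 + k) j d) (cong (_↻ j) (trans (cong (d ↻_) (sym p)) (period d))))
    step : ∀ j → take (d ↻ (2 + j)) ≤ (if b (2 + j) then 0 else u (b j) (b (1 + j)) (b (3 + j)) (b (4 + j)))
    step j with take-window u h (d ↻ j) (trans (cong cls (trans (dg-↻ j d) p)) q)
    ... | w rewrite ↻-N j d | ↻-N j (N d) | ↻-N j (N (N d)) | ↻-N j (N (N (N d))) = w

  bits : D → ℕ → List Bool
  bits d k = applyUpTo (λ j → bigᵈ (d ↻ j)) k

  degree7 : ∀ d → dg d ≡ 7 → orbit take d ≤ 1680
  degree7 d p = ≤-trans (orbit-window take7 (λ _ _ _ _ _ _ _ → ≤-refl) 3 d p refl)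
    (≤ᵇ-sound (forBits-sound 7 (λ xs → cyclic take7 xs ≤ᵇ 1680) bound7 (bits d 7) (length-applyUpTo (λ j → bigᵈ (d ↻ j)) 7)))

  AllFive : ℕ → D → Set
  AllFive k d = ∀ j → j < k → bigᵈ (d ↻ j) ≡ false

  unless-five : ∀ {K} (u : Bool → Bool → Bool → Bool → ℕ) m → (∀ l₂ l r r₂ o₁ o₂ g → takeF K l₂ l r r₂ o₁ o₂ g ≤ u l₂ l r r₂) →
    ∀ k d → dg d ≡ 4 + k → cls (4 + k) ≡ K →
    forBits (4 + k) (λ xs → not (any (λ x → x) xs) ∨ (cyclic u xs ≤ᵇ m)) ≡ true →
    orbit take d ≤ m ⊎ AllFive (4 + k) d
  unless-five u m h k d p q c
    with any (λ x → x) (bits d (4 + k)) in a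
       | forBits-sound (4 + k) (λ xs → not (any (λ x → x) xs) ∨ (cyclic u xs ≤ᵇ m)) c (bits d (4 + k))
           (length-applyUpTo (λ j → bigᵈ (d ↻ j)) (4 + k))
  ... | false | _ = inj₂ (any-false (λ j → bigᵈ (d ↻ j)) (4 + k) a)
  ... | true | w = inj₁ (≤-trans (orbit-window u h k d p q) (≤ᵇ-sound {cyclic u (bits d (4 + k))} w))

  take11-upper : ∀ l₂ l r r₂ o₁ o₂ g → takeF c11 l₂ l r r₂ o₁ o₂ g ≤ upper11 l₂ l r r₂
  take11-upper l₂ true true r₂ o₁ o₂ g = ≤-refl
  take11-upper l₂ true false r₂ o₁ o₂ g = ≤-refl
  take11-upper l₂ false true r₂ o₁ o₂ g = ≤-refl
  take11-upper l₂ false false r₂ o₁ o₂ true =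
    if-≤′ ((o₁ ≥ᶜ 8) ∧ (o₂ ≥ᶜ 8)) (if-≤′ ((o₁ ≥ᶜ 9) ∧ (o₂ ≥ᶜ 9)) z≤n (≤ᵇ-sound refl)) ≤-refl
  take11-upper l₂ false false r₂ o₁ o₂ false = ≤ᵇ-sound refl

  take13-upper : ∀ l₂ l r r₂ o₁ o₂ g → takeF c13 l₂ l r r₂ o₁ o₂ g ≤ upper13 l₂ l r r₂
  take13-upper l₂ true true r₂ o₁ o₂ g = ≤-refl
  take13-upper l₂ true false r₂ o₁ o₂ g = ≤-refl
  take13-upper l₂ false true r₂ o₁ o₂ g = ≤-refl
  take13-upper l₂ false false r₂ o₁ o₂ true = if-≤′ ((o₁ ≥ᶜ 8) ∧ (o₂ ≥ᶜ 8)) (≤ᵇ-sound refl) ≤-refl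
  take13-upper l₂ false false r₂ o₁ o₂ false = ≤ᵇ-sound refl

  degree11-or : ∀ d → dg d ≡ 11 → orbit take d ≤ 8400 ⊎ AllFive 11 d
  degree11-or d p = unless-five upper11 8400 take11-upper 7 d p refl bound11

  degree13-or : ∀ d → dg d ≡ 13 → orbit take d ≤ 11760 ⊎ AllFive 13 d
  degree13-or d p = unless-five upper13 11760 take13-upper 9 d p refl bound13

-- If a 5-vertex takes the full share from an 11- or 13-vertex surrounded by 5-vertices,
-- then exactly one of its two outer neighbours is large (at least m) and the other is
-- at most 7.  Consecutive 5-vertices share an outer neighbour, so the kinds alternate.
kind : ℕ → Bool → Cls → Bool
kind m true o = o ≥ᶜ m
kind m false o = not (o ≥ᶜ 8)

mixed : ℕ → Cls → Cls → Bool
mixed m o₁ o₂ = (kind m true o₁ ∧ kind m false o₂) ∨ (kind m false o₁ ∧ kind m true o₂)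

both : ℕ → Cls → Cls → Bool
both m o₁ o₂ = (o₁ ≥ᶜ m) ∧ (o₂ ≥ᶜ m)

outer-check : Cls → ℕ → Bool
outer-check K m = forClasses λ o₁ → forClasses λ o₂ → covered K c5 o₁ o₂ c5 ∨ both 8 o₁ o₂ ∨ mixed m o₁ o₂

-- Around an 11- or 13-vertex, ⟨5,7,7,5,17⟩ excludes two outer neighbours of degree at most 7.
-- Around an 11-vertex, ⟨5,7,8,5,11⟩ also excludes degree 8 beside degree at most 7, so large begins
-- at 9 there and at 8 around a 13-vertex.
outer-check-11 : outer-check c11 9 ≡ true
outer-check-11 = refl

outer-check-13 : outer-check c13 8 ≡ true
outer-check-13 = refl

outers-mixed : ∀ K m o₁ o₂ → outer-check K m ≡ true → covered K c5 o₁ o₂ c5 ≡ false → both 8 o₁ o₂ ≡ false →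
  ∃[ a ] kind m a o₁ ≡ true × kind m (not a) o₂ ≡ true
outers-mixed K m o₁ o₂ c u b = go (covered K c5 o₁ o₂ c5) (both 8 o₁ o₂) (kind m true o₁) (kind m false o₂)
    (kind m false o₁) (kind m true o₂) refl refl refl refl u b
    (forClasses-sound (λ o₂ → covered K c5 o₁ o₂ c5 ∨ both 8 o₁ o₂ ∨ mixed m o₁ o₂)
      (forClasses-sound (λ o₁ → forClasses λ o₂ → covered K c5 o₁ o₂ c5 ∨ both 8 o₁ o₂ ∨ mixed m o₁ o₂) c o₁) o₂)
  where
  go : ∀ x y p q r s → kind m true o₁ ≡ p → kind m false o₂ ≡ q → kind m false o₁ ≡ r → kind m true o₂ ≡ s →
    x ≡ false → y ≡ false → x ∨ y ∨ (p ∧ q) ∨ (r ∧ s) ≡ true → ∃[ a ] kind m a o₁ ≡ true × kind m (not a) o₂ ≡ true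
  go _ _ true true _ _ p q _ _ refl refl _ = true , p , q
  go _ _ true false true true _ _ r s refl refl _ = false , r , s
  go _ _ false _ true true _ _ r s refl refl _ = false , r , s

≤ᵇ-true : ∀ {m n} → m ≤ n → (m ≤ᵇ n) ≡ true
≤ᵇ-true {m} {n} p with m ≤ᵇ n | ≤⇒≤ᵇ p
... | true | _ = refl

kind-unique : ∀ m → 8 ≤ m → ∀ a b o → kind m a o ≡ true → kind m b o ≡ true → a ≡ b
kind-unique m h true true o p q = refl
kind-unique m h false false o p q = refl
kind-unique m h true false o p q = ⊥-elim (clash m h o p q)
  where
  clash : ∀ m → 8 ≤ m → ∀ o → (o ≥ᶜ m) ≡ true → not (o ≥ᶜ 8) ≡ true → ⊥
  clash m h o p q with () ← trans (sym q) (cong not (≤ᵇ-true (≤-trans h (≤ᵇ-sound p))))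
kind-unique m h false true o p q = sym (kind-unique m h true false o q p)

not^ : ℕ → Bool → Bool
not^ zero a = a
not^ (suc n) a = not^ n (not a)

not^-even : ∀ n a → not^ (n + n) a ≡ a
not^-even zero a = refl
not^-even (suc n) a rewrite +-suc n n = trans (cong (not^ (n + n)) (not-involutive a)) (not^-even n a)

-- Parity around 11- and 13-vertices

module Parity (sys : DartSystem) (uncov : Uncovered sys) where
  open DartSystem sys
  open Local sys
  open Payments sys
  open Degrees sys

  outer₁ outer₂ : D → Cls
  outer₁ e = t (N (N (R e)))
  outer₂ e = t (P (P (R e)))

  Regular : D → Set
  Regular e = reg (R e) ≡ true

  reg-split : ∀ e → reg e ≡ true →
    (corner true e ≡ true × corner true (N e) ≡ true) × (corner false e ≡ true × corner false (P e) ≡ true)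
  reg-split e = go (corner true e) (corner false e) (corner true (N e)) (corner false (P e)) refl refl refl refl
    where
    go : ∀ a b c d → corner true e ≡ a → corner false e ≡ b → corner true (N e) ≡ c → corner false (P e) ≡ d →
      a ∧ b ∧ c ∧ d ≡ true → (corner true e ≡ true × corner true (N e) ≡ true) × (corner false e ≡ true × corner false (P e) ≡ true)
    go true true true true p q r s _ = (p , r) , (q , s)

  -- The ends of `e` and `N e` are adjacent because of the triangle at the centre. The triangle on
  -- the other side of the edge between them contains their common outer neighbour.
  outer-shared : ∀ e → corner false (R e) ≡ true → corner false (P (R e)) ≡ true → outer₁ (N e) ≡ outer₂ e
  outer-shared e p q = trans (cong (λ x → t (N (N x))) (trans (cong (λ x → R (N x)) (sym (RR e))) (rot false (R e) p)))
    (trans (cong (λ x → t (N x)) (NP (R (P (R e))))) (side false (P (R e)) q))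

  -- Of the four corners that `reg` requires, two lie on triangles that have a required corner at
  -- the end of `N e`, and the other two on triangles that have one at the end of `P e`.
  regular-from : ∀ e → Regular (N e) → Regular (P e) → Regular e
  regular-from e n p = ∧-join r₁ (∧-join r₂ (∧-join r₃ r₄))
    where
    n₁ = proj₁ (proj₁ (reg-split (R (N e)) n))
    n₂ = proj₂ (proj₁ (reg-split (R (N e)) n))
    p₁ = proj₁ (proj₂ (reg-split (R (P e)) p))
    p₂ = proj₂ (proj₂ (reg-split (R (P e)) p))
    r₁ : corner true (R e) ≡ true
    r₁ = cornerR false e (trans (cong tri (trans (sym (NP e)) (cong N (sym (RR (P e)))))) (cornerR false (R (P e)) p₁))
    r₂ : corner false (R e) ≡ true
    r₂ = cornerR true e (trans (cong tri (sym (RR (N e)))) (cornerR true (R (N e)) n₁))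
    r₃ : corner true (N (R e)) ≡ true
    r₃ = subst (λ x → corner true x ≡ true) (RR (N (R e))) (cornerR false (R (N (R e))) (trans (cong tri eq) p₂))
      where
      eq : R (N (R e)) ≡ P (R (P e))
      eq = sym (trans (cong P (trans (cong (λ x → R (P x)) (sym (RR e))) (rot true (R e) r₁))) (PN _))
    r₄ : corner false (P (R e)) ≡ true
    r₄ = subst (λ x → tri x ≡ true) (RR (P (R e))) (cornerR true (R (P (R e))) (trans (cong tri (cong N eq)) n₂))
      where
      eq : R (P (R e)) ≡ N (R (N e))
      eq = trans (sym (NP _)) (cong N (sym (trans (cong (λ x → R (N x)) (sym (RR e))) (rot false (R e) r₂))))

  Mixed : ℕ → D → Set
  Mixed m e = Regular e × ∃[ a ] kind m a (outer₁ e) ≡ true × kind m (not a) (outer₂ e) ≡ true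

  step : ∀ {m e} → 8 ≤ m → Mixed m e → ∀ a → kind m a (outer₁ e) ≡ true → kind m (not a) (outer₁ (N e)) ≡ true
  step {m} {e} h (r , b , p , q) a k = subst₂ (λ a o → kind m (not a) o ≡ true) (kind-unique m h b a (outer₁ e) p k)
    (sym (outer-shared e (proj₁ (proj₂ (reg-split (R e) r))) (proj₂ (proj₂ (reg-split (R e) r))))) q

  chain : ∀ {m} → 8 ≤ m → ∀ n e → (∀ j → j < n → Mixed m (e ↻ j)) → ∀ a → kind m a (outer₁ e) ≡ true →
    kind m (not^ n a) (outer₁ (e ↻ n)) ≡ true
  chain h zero e mx a k = k
  chain h (suc n) e mx a k = chain h n (N e) (λ j q → mx (suc j) (s≤s q)) (not a) (step h (mx 0 (s≤s z≤n)) a k)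

  Five : D → Set
  Five e = bigᵈ e ≡ false

  five-t : ∀ e → Five e → t e ≡ c5
  five-t e p = is5-≡ (trans (sym (not-involutive (is5 (t e)))) (cong not p))

  five-take : ∀ e K → cls (dg e) ≡ K → Five e → Five (P e) → Five (N e) → take e ≡
    takeF K (bigᵈ (P (P e))) false false (bigᵈ (N (N e))) (outer₁ e) (outer₂ e) (reg (R e))
  five-take e K refl p q r rewrite five-t e p | q | r = refl

  center-uncovered : ∀ e K → cls (dg e) ≡ K → Five e → Five (P e) → Five (N e) → Regular e →
    covered K c5 (outer₁ e) (outer₂ e) c5 ≡ false
  center-uncovered e K k p q r g = subst₅ (trans (cong (λ x → cls (dg x)) (RR e)) k)
      (trans (sym (side true (R e) (proj₁ (proj₁ (reg-split (R e) g))))) (trans (cong (λ x → t (P x)) (RR e)) (five-t _ q)))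
      (refl {x = outer₁ e}) (cong t (S³ true (R e) d5))
      (trans (cong t (S⁴ true (R e) d5)) (trans (sym (side false (R e) (proj₁ (proj₂ (reg-split (R e) g)))))
        (trans (cong (λ x → t (N x)) (RR e)) (five-t _ r))))
      (uncov true (R e) d5)
    where
    d5 = dgR-5 e (five-t e p)
    subst₅ : ∀ {a a′ b b′ c c′ d d′ e e′} → a ≡ a′ → b ≡ b′ → c ≡ c′ → d ≡ d′ → e ≡ e′ →
      covered a b c d e ≡ false → covered a′ b′ c′ d′ e′ ≡ false
    subst₅ refl refl refl refl refl h = h

  all-five-N : ∀ {k} d → dg d ≡ suc k → AllFive (suc k) d → AllFive (suc k) (N d)
  all-five-N {k} d p h j (s≤s q) with m≤n⇒m<n∨m≡n q
  ... | inj₁ j<k = h (suc j) (s≤s j<k)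
  ... | inj₂ refl = subst Five (sym (trans (cong (d ↻_) (sym p)) (period d))) (h 0 (s≤s z≤n))

  all-five-↻ : ∀ {k} d → dg d ≡ suc k → AllFive (suc k) d → ∀ j → AllFive (suc k) (d ↻ j)
  all-five-↻ d p h zero = h
  all-five-↻ d p h (suc j) = all-five-↻ (N d) (trans (dgN d) p) (all-five-N d p h) j

  P-last : ∀ {k} d → dg d ≡ suc k → d ↻ k ≡ P d
  P-last {k} d p = trans (sym (PN _)) (cong P (trans (↻-N k d) (trans (cong (d ↻_) (sym p)) (period d))))

  module _ {k : ℕ} (d : D) (p : dg d ≡ suc (suc k)) (h : AllFive (suc (suc k)) d) where
    five₀ : Five d
    five₀ = h 0 (s≤s z≤n)

    five₁ : Five (N d)
    five₁ = h 1 (s≤s (s≤s z≤n))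

    five₋ : Five (P d)
    five₋ = subst Five (P-last d p) (h (suc k) ≤-refl)

    five-mixed : ∀ m → outer-check (cls (suc (suc k))) m ≡ true → Regular d → both 8 (outer₁ d) (outer₂ d) ≡ false →
      Mixed m d
    five-mixed m c g b = g , outers-mixed (cls (suc (suc k))) m (outer₁ d) (outer₂ d) c
      (center-uncovered d (cls (suc (suc k))) (cong cls p) five₀ five₋ five₁ g) b

  large13 : ∀ o₁ o₂ g → (take13 false false o₁ o₂ g ≤ᵇ 672) ≡ false → g ≡ true × both 8 o₁ o₂ ≡ false
  large13 o₁ o₂ true p with both 8 o₁ o₂
  ... | false = refl , refl

  large11 : ∀ l r o₁ o₂ g → (take11 l false false r o₁ o₂ g ≤ᵇ 420) ≡ false → g ≡ true × both 8 o₁ o₂ ≡ false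
  large11 l r o₁ o₂ true p with both 8 o₁ o₂ | both 9 o₁ o₂
  large11 l r o₁ o₂ true () | true | true
  large11 l r o₁ o₂ true () | true | false
  ... | false | _ = refl , refl

  mixed13 : ∀ d → dg d ≡ 13 → AllFive 13 d → (take d ≤ᵇ 672) ≡ false → Mixed 8 d
  mixed13 d p h q = five-mixed d p h 8 outer-check-13 (proj₁ l) (proj₂ l)
    where
    l = large13 (outer₁ d) (outer₂ d) (reg (R d)) (subst (λ x → (x ≤ᵇ 672) ≡ false)
      (five-take d c13 (cong cls p) (five₀ d p h) (five₋ d p h) (five₁ d p h)) q)

  mixed11 : ∀ d → dg d ≡ 11 → AllFive 11 d → (take d ≤ᵇ 420) ≡ false → Mixed 9 d
  mixed11 d p h q = five-mixed d p h 9 outer-check-11 (proj₁ l) (proj₂ l)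
    where
    l = large11 _ _ (outer₁ d) (outer₂ d) (reg (R d)) (subst (λ x → (x ≤ᵇ 420) ≡ false)
      (five-take d c11 (cong cls p) (five₀ d p h) (five₋ d p h) (five₁ d p h)) q)

  not^-odd : ∀ n a → not^ (suc (n + n)) a ≡ a → ⊥
  not^-odd n true q with () ← trans (sym q) (not^-even n false)
  not^-odd n false q with () ← trans (sym q) (not^-even n true)

  odd-cycle : ∀ {m} → 8 ≤ m → ∀ n d → dg d ≡ suc (n + n) → (∀ j → j < suc (n + n) → Mixed m (d ↻ j)) → ⊥
  odd-cycle {m} m≥8 n d p mx with mx 0 (s≤s z≤n)
  ... | _ , a , q , _ = not^-odd n a (kind-unique m m≥8 _ a (outer₁ d)
    (subst (λ e → kind m (not^ (suc (n + n)) a) (outer₁ e) ≡ true) (trans (cong (d ↻_) (sym p)) (period d))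
      (chain m≥8 (suc (n + n)) d mx a q)) q)

  module Thirteen (d : D) (p : dg d ≡ 13) (h : AllFive 13 d) where
    at : ∀ j → dg (d ↻ j) ≡ 13
    at j = trans (dg-↻ j d) p

    h′ : ∀ j → AllFive 13 (d ↻ j)
    h′ = all-five-↻ d p h

    take-≤924 : ∀ j → take (d ↻ j) ≤ 924
    take-≤924 j = subst (_≤ 924) (sym (five-take (d ↻ j) c13 (cong cls (at j)) (five₀ _ (at j) (h′ j))
        (five₋ _ (at j) (h′ j)) (five₁ _ (at j) (h′ j))))
      (take13-upper false false false false (outer₁ (d ↻ j)) (outer₂ (d ↻ j)) (reg (R (d ↻ j))))

    bound : orbit take d ≤ 11760
    bound with find 13 (λ j → take (d ↻ j) ≤ᵇ 672)
    ... | inj₁ (j , q , r) = subst (λ n → ∑ n (λ j → take (d ↻ j)) ≤ 11760) (sym p)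
      (∑-≤-one 12 924 672 take-≤924 j q (≤ᵇ-sound r))
    ... | inj₂ q = ⊥-elim (odd-cycle (≤ᵇ-sound refl) 6 d p (λ j r → mixed13 (d ↻ j) (at j) (h′ j) (q j r)))

  module Eleven (d : D) (p : dg d ≡ 11) (h : AllFive 11 d) where
    at : ∀ j → dg (d ↻ j) ≡ 11
    at j = trans (dg-↻ j d) p

    h′ : ∀ j → AllFive 11 (d ↻ j)
    h′ = all-five-↻ d p h

    take-eq : take d ≡ takeF c11 (bigᵈ (P (P d))) false false (bigᵈ (N (N d))) (outer₁ d) (outer₂ d) (reg (R d))
    take-eq = five-take d c11 (cong cls p) (five₀ d p h) (five₋ d p h) (five₁ d p h)

    -- Ten alternations lead from one outer neighbour of the exceptional 5-vertex to the other, so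
    -- both are of the same kind. Two of degree at most 7 would give a listed star; hence both have
    -- degree at least 9, and `take11` is 0.
    zero-take : (∀ j → j < 10 → Mixed 9 (N d ↻ j)) → take d ≡ 0
    zero-take mx with mx 0 (s≤s z≤n)
    ... | g₁ , a , k₁ , _ = trans take-eq (go a o₁ o₂)
      where
      g : Regular d
      g = regular-from d g₁ (subst Regular (P-last d p) (proj₁ (mx 9 ≤-refl)))
      o₁ : kind 9 a (outer₁ d) ≡ true
      o₁ = subst₂ (λ b e → kind 9 b (outer₁ e) ≡ true) (not^-even 5 a) (trans (cong (d ↻_) (sym p)) (period d))
        (chain (≤ᵇ-sound refl) 10 (N d) mx a k₁)
      o₂ : kind 9 a (outer₂ d) ≡ true
      o₂ = subst (λ o → kind 9 a o ≡ true) (outer-shared d (proj₁ (proj₂ (reg-split (R d) g)))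
        (proj₂ (proj₂ (reg-split (R d) g)))) k₁
      drop : ∀ o → (o ≥ᶜ 9) ≡ true → (o ≥ᶜ 8) ≡ true
      drop o q = ≤ᵇ-true {8} {lower o} (≤-trans (≤ᵇ-sound refl) (≤ᵇ-sound {9} {lower o} q))
      go : ∀ a → kind 9 a (outer₁ d) ≡ true → kind 9 a (outer₂ d) ≡ true →
        takeF c11 (bigᵈ (P (P d))) false false (bigᵈ (N (N d))) (outer₁ d) (outer₂ d) (reg (R d)) ≡ 0
      go true q₁ q₂ rewrite g | drop (outer₁ d) q₁ | drop (outer₂ d) q₂ | q₁ | q₂ = refl
      go false q₁ q₂ with five-mixed d p h 9 outer-check-11 g
        (cong (_∧ (outer₂ d ≥ᶜ 8)) (trans (sym (not-involutive _)) (cong not q₁)))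
      ... | _ , b , r₁ , r₂ with kind-unique 9 (≤ᵇ-sound refl) b false (outer₁ d) r₁ q₁
           | kind-unique 9 (≤ᵇ-sound refl) (not b) false (outer₂ d) r₂ q₂
      ... | refl | ()

  take-≤840 : ∀ d → dg d ≡ 11 → AllFive 11 d → take d ≤ 840
  take-≤840 d p h = subst (_≤ 840) (sym (Eleven.take-eq d p h))
    (take11-upper (bigᵈ (P (P d))) false false (bigᵈ (N (N d))) (outer₁ d) (outer₂ d) (reg (R d)))

  split-first : ∀ d → dg d ≡ 11 → orbit take d ≡ take d + ∑ 10 (λ j → take (N d ↻ j))
  split-first d p = cong (λ n → ∑ n (λ j → take (d ↻ j))) p

  -- The excess of 11 * 840 over 8400 is 840. It is saved either by two shares of at most 420 or by
  -- a single exceptional share, which is then 0.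
  one-small : ∀ d → dg d ≡ 11 → AllFive 11 d → (take d ≤ᵇ 420) ≡ true → orbit take d ≤ 8400
  one-small d p h q with find 10 (λ j → take (N d ↻ j) ≤ᵇ 420)
  ... | inj₁ (j , r , s) = ≤-trans (≤-reflexive (split-first d p)) (+-mono-≤ {take d} {420} (≤ᵇ-sound q)
    (∑-≤-one 9 840 420 (λ j → take-≤840 _ (Eleven.at d p h (suc j)) (Eleven.h′ d p h (suc j))) j r (≤ᵇ-sound s)))
  ... | inj₂ r = ≤-trans (≤-reflexive (trans (split-first d p) (cong (_+ ∑ 10 (λ j → take (N d ↻ j)))
      (Eleven.zero-take d p h (λ j s → mixed11 _ (Eleven.at d p h (suc j)) (Eleven.h′ d p h (suc j)) (r j s))))))
    (∑-≤ 10 840 (λ j → take-≤840 _ (Eleven.at d p h (suc j)) (Eleven.h′ d p h (suc j))))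

  eleven-bound : ∀ d → dg d ≡ 11 → AllFive 11 d → orbit take d ≤ 8400
  eleven-bound d p h with find 11 (λ j → take (d ↻ j) ≤ᵇ 420)
  ... | inj₁ (j , q , r) = subst (_≤ 8400) (orbit-↻ take j d) (one-small (d ↻ j) (Eleven.at d p h j) (Eleven.h′ d p h j) r)
  ... | inj₂ q = ⊥-elim (odd-cycle (≤ᵇ-sound refl) 5 d p
    (λ j r → mixed11 (d ↻ j) (Eleven.at d p h j) (Eleven.h′ d p h j) (q j r)))

  orbit-take : ∀ d → 6 ≤ dg d → orbit take d + 10080 ≤ 1680 * dg d
  orbit-take d p with plain-or (dg d) p
  ... | inj₁ q = subst (λ n → orbit take d + 10080 ≤ 1680 * n) (sym q) (+-monoˡ-≤ 10080 (degree7 d q))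
  ... | inj₂ (inj₁ q) = subst (λ n → orbit take d + 10080 ≤ 1680 * n) (sym q)
    (+-monoˡ-≤ 10080 ([ (λ b → b) , eleven-bound d q ]′ (degree11-or d q)))
  ... | inj₂ (inj₂ (inj₁ q)) = subst (λ n → orbit take d + 10080 ≤ 1680 * n) (sym q)
    (+-monoˡ-≤ 10080 ([ (λ b → b) , Thirteen.bound d q ]′ (degree13-or d q)))
  ... | inj₂ (inj₂ (inj₂ q)) = PlainDegree.bound d q

-- Rotation graphs

prev : {d : ℕ} → Fin d → Fin d
prev {suc m} i = (toℕ i + m) mod suc m

toℕ-mod : ∀ a k .{{_ : NonZero k}} → toℕ (a mod k) ≡ a % k
toℕ-mod a k = toℕ-fromℕ< (m%n<n a k)

%-+ : ∀ a b k .{{_ : NonZero k}} → (a % k + b) % k ≡ (a + b) % k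
%-+ a b k = trans (%-distribˡ-+ (a % k) b k) (trans (cong (λ x → (x + b % k) % k) (m%n%n≡m%n a k))
  (sym (%-distribˡ-+ a b k)))

toℕ-% : ∀ {k} (i : Fin (suc k)) → toℕ i % suc k ≡ toℕ i
toℕ-% i = m<n⇒m%n≡m (toℕ<n i)

module Instance (G : RotationGraph) (md : MinDegree≥ G 5) where
  open RotationGraph G

  next-prev : ∀ {d} (i : Fin d) → next G (prev i) ≡ i
  next-prev {suc m} i = toℕ-injective (begin
    toℕ (suc (toℕ (prev i)) mod suc m) ≡⟨ toℕ-mod (suc (toℕ (prev i))) (suc m) ⟩
    suc (toℕ (prev i)) % suc m ≡⟨ cong (_% suc m) (trans (cong suc (toℕ-mod (toℕ i + m) (suc m))) (+-comm 1 _)) ⟩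
    ((toℕ i + m) % suc m + 1) % suc m ≡⟨ %-+ (toℕ i + m) 1 (suc m) ⟩
    (toℕ i + m + 1) % suc m ≡⟨ cong (_% suc m) (trans (+-assoc (toℕ i) m 1) (cong (toℕ i +_) (+-comm m 1))) ⟩
    (toℕ i + suc m) % suc m ≡⟨ trans ([m+n]%n≡m%n (toℕ i) (suc m)) (toℕ-% i) ⟩
    toℕ i ∎)
    where open ≡-Reasoning

  prev-next : ∀ {d} (i : Fin d) → prev (next G i) ≡ i
  prev-next {suc m} i = toℕ-injective (begin
    toℕ ((toℕ (next G i) + m) mod suc m) ≡⟨ toℕ-mod (toℕ (next G i) + m) (suc m) ⟩
    (toℕ (next G i) + m) % suc m ≡⟨ cong (λ x → (x + m) % suc m) (toℕ-mod (suc (toℕ i)) (suc m)) ⟩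
    (suc (toℕ i) % suc m + m) % suc m ≡⟨ %-+ (suc (toℕ i)) m (suc m) ⟩
    (suc (toℕ i) + m) % suc m ≡⟨ cong (_% suc m) (sym (+-suc (toℕ i) m)) ⟩
    (toℕ i + suc m) % suc m ≡⟨ trans ([m+n]%n≡m%n (toℕ i) (suc m)) (toℕ-% i) ⟩
    toℕ i ∎)
    where open ≡-Reasoning

  toℕ-iterate : ∀ {m} j (i : Fin (suc m)) → toℕ (iterate (next G) j i) ≡ (toℕ i + j) % suc m
  toℕ-iterate {m} zero i = sym (trans (cong (_% suc m) (+-identityʳ (toℕ i))) (toℕ-% i))
  toℕ-iterate {m} (suc j) i = begin
    toℕ (iterate (next G) j (next G i)) ≡⟨ toℕ-iterate j (next G i) ⟩
    (toℕ (next G i) + j) % suc m ≡⟨ cong (λ x → (x + j) % suc m) (toℕ-mod (suc (toℕ i)) (suc m)) ⟩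
    (suc (toℕ i) % suc m + j) % suc m ≡⟨ %-+ (suc (toℕ i)) j (suc m) ⟩
    (suc (toℕ i) + j) % suc m ≡⟨ cong (_% suc m) (sym (+-suc (toℕ i) j)) ⟩
    (toℕ i + suc j) % suc m ∎
    where open ≡-Reasoning

  iterate-period : ∀ {d} (i : Fin d) → iterate (next G) d i ≡ i
  iterate-period {suc m} i = toℕ-injective (trans (toℕ-iterate (suc m) i)
    (trans ([m+n]%n≡m%n (toℕ i) (suc m)) (toℕ-% i)))

  next-≢ : ∀ {d} → 2 ≤ d → (i : Fin d) → next G i ≢ i
  next-≢ {suc (suc m)} _ i q with m≤n⇒m<n∨m≡n (toℕ<n i)
  ... | inj₁ lt = 1+n≢n (trans (sym (trans (toℕ-mod (suc (toℕ i)) (suc (suc m))) (m<n⇒m%n≡m lt))) (cong toℕ q))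
  ... | inj₂ eq = 0≢1+n (trans (sym (trans (toℕ-mod (suc (toℕ i)) (suc (suc m)))
    (trans (cong (_% suc (suc m)) eq) (n%n≡0 (suc (suc m)))))) (trans (cong toℕ q) (suc-injective eq)))
  next-≢ {suc zero} (s≤s ()) i q

  nextᵈ prevᵈ flipᵈ : Dart G → Dart G
  nextᵈ (v , i) = v , next G i
  prevᵈ (v , i) = v , prev i
  flipᵈ (v , i) = nb v i , rev v i

  dart-≡ : ∀ {v w} {i : Fin (deg v)} {j : Fin (deg w)} → w ≡ v → nb w j ≡ nb v i → (w , j) ≡ (v , i)
  dart-≡ {v} refl q = cong (v ,_) (nb-inj v _ _ q)

  flip-flip : ∀ d → flipᵈ (flipᵈ d) ≡ d
  flip-flip (v , i) = dart-≡ (nb-rev v i) (nb-rev (nb v i) (rev v i))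

  _≟ᵈ_ : (d e : Dart G) → Dec (d ≡ e)
  _≟ᵈ_ = ≡-dec Fin._≟_ Fin._≟_

  iterate-nextᵈ : ∀ j v i → iterate nextᵈ j (v , i) ≡ (v , iterate (next G) j i)
  iterate-nextᵈ zero v i = refl
  iterate-nextᵈ (suc j) v i = iterate-nextᵈ j v (next G i)

  triᵈ : Dart G → Bool
  triᵈ d = does (faceStep G (faceStep G (faceStep G d)) ≟ᵈ d)

  triᵈ-sound : ∀ d → triᵈ d ≡ true → faceStep G (faceStep G (faceStep G d)) ≡ d
  triᵈ-sound d p with faceStep G (faceStep G (faceStep G d)) ≟ᵈ d
  ... | yes q = q

  triᵈ-complete : ∀ d → faceStep G (faceStep G (faceStep G d)) ≡ d → triᵈ d ≡ true
  triᵈ-complete d p with faceStep G (faceStep G (faceStep G d)) ≟ᵈ d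
  ... | yes q = refl
  ... | no ¬q = ⊥-elim (¬q p)

  system : DartSystem
  system = record
    { D = Dart G ; N = nextᵈ ; P = prevᵈ ; R = flipᵈ ; dg = λ d → deg (proj₁ d)
    ; NP = λ d → cong (proj₁ d ,_) (next-prev (proj₂ d)) ; PN = λ d → cong (proj₁ d ,_) (prev-next (proj₂ d))
    ; RR = flip-flip ; dgN = λ _ → refl
    ; period = λ d → trans (iterate-nextᵈ (deg (proj₁ d)) (proj₁ d) (proj₂ d))
        (cong (proj₁ d ,_) (iterate-period (proj₂ d)))
    ; 5≤dg = λ d → md (proj₁ d)
    ; tri = triᵈ ; tri-sound = triᵈ-sound ; tri-complete = triᵈ-complete }

  open DartSystem system using (S; t; star; dg)

  fitsᶜ-sound : ∀ k κ → fitsᶜ (cls k) κ ≡ true → Fits G k κ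
  fitsᶜ-sound k nothing _ = _
  fitsᶜ-sound 0 (just m) p = z≤n
  fitsᶜ-sound 1 (just m) p = ≤-trans (≤ᵇ-sound refl) (≤ᵇ-sound p)
  fitsᶜ-sound 2 (just m) p = ≤-trans (≤ᵇ-sound refl) (≤ᵇ-sound p)
  fitsᶜ-sound 3 (just m) p = ≤-trans (≤ᵇ-sound refl) (≤ᵇ-sound p)
  fitsᶜ-sound 4 (just m) p = ≤-trans (≤ᵇ-sound refl) (≤ᵇ-sound p)
  fitsᶜ-sound 5 (just m) p = ≤ᵇ-sound p
  fitsᶜ-sound 6 (just m) p = ≤ᵇ-sound p
  fitsᶜ-sound 7 (just m) p = ≤ᵇ-sound p
  fitsᶜ-sound 8 (just m) p = ≤ᵇ-sound p
  fitsᶜ-sound 9 (just m) p = ≤ᵇ-sound p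
  fitsᶜ-sound 10 (just m) p = ≤ᵇ-sound p
  fitsᶜ-sound 11 (just m) p = ≤ᵇ-sound p
  fitsᶜ-sound 12 (just m) p = ≤ᵇ-sound p
  fitsᶜ-sound 13 (just m) p = ≤ᵇ-sound p
  fitsᶜ-sound 14 (just m) p = ≤ᵇ-sound p
  fitsᶜ-sound 15 (just m) p = ≤ᵇ-sound p
  fitsᶜ-sound 16 (just m) p = ≤-trans (≤ᵇ-sound refl) (≤ᵇ-sound p)
  fitsᶜ-sound 17 (just m) p = ≤ᵇ-sound p
  fitsᶜ-sound (suc (suc (suc (suc (suc (suc (suc (suc (suc (suc (suc (suc (suc (suc (suc (suc (suc (suc k))))))))))))))))))
    (just m) p with k ≤ᵇ 17 in q
  ... | true = ≤-trans (+-monoʳ-≤ 18 (≤ᵇ-sound {k} {17} q)) (≤ᵇ-sound p)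

  turned : Bool → ∀ {d} → Fin d → Fin d
  turned true = next G
  turned false = prev

  -- Adding 4 modulo 5 is one step back, so the two ways of listing positions are the iterates of
  -- `next` and of `prev`.
  pos-5 : ∀ o (i j : Fin 5) → pos G i o j ≡ iterate (turned o) (toℕ j) i
  pos-5 true = from-yes (Finₚ.all? λ i → Finₚ.all? λ j → pos G i true j Fin.≟ iterate (turned true) (toℕ j) i)
  pos-5 false = from-yes (Finₚ.all? λ i → Finₚ.all? λ j → pos G i false j Fin.≟ iterate (turned false) (toℕ j) i)

  pos-cast : ∀ {d} (e : d ≡ 5) o (i : Fin d) j → cast (sym e) (pos G (cast e i) o j) ≡ iterate (turned o) (toℕ j) i
  pos-cast refl o i j = trans (Finₚ.cast-is-id refl _) (trans (cong (λ x → pos G x o j) (Finₚ.cast-is-id refl i)) (pos-5 o i j))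

  star-degrees : ∀ {A : Set} o v i (f : Cls → Cls → Cls → Cls → Cls → A) →
    let c = λ j → cls (deg (nb v (iterate (turned o) j i))) in
    star o (v , i) f ≡ f (c 0) (c 1) (c 2) (c 3) (c 4)
  star-degrees true v i f = refl
  star-degrees false v i f = refl

  fitsStar-sound : ∀ o v i κ → deg v ≡ 5 → star o (v , i) (fitsStar κ) ≡ true → HasStar G κ
  fitsStar-sound o v i κ@(p ∷ q ∷ r ∷ s ∷ u ∷ []) e h = v , e , cast e i , o , λ j →
    subst (λ x → Fits G (deg (nb v x)) (lookup κ j)) (sym (pos-cast e o i j))
      (fitsᶜ-sound _ (lookup κ j) (fit j))
    where
    c : ℕ → Cls
    c j = cls (deg (nb v (iterate (turned o) j i)))
    h′ : fitsStar κ (c 0) (c 1) (c 2) (c 3) (c 4) ≡ true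
    h′ = trans (sym (star-degrees o v i (fitsStar κ))) h
    split : ∀ {a b c d e} → a ∧ b ∧ c ∧ d ∧ e ≡ true →
      a ≡ true × b ≡ true × c ≡ true × d ≡ true × e ≡ true
    split {true} {true} {true} {true} x = refl , refl , refl , refl , x
    parts : _
    parts = split {fitsᶜ (c 0) p} {fitsᶜ (c 1) q} {fitsᶜ (c 2) r} {fitsᶜ (c 3) s} h′
    fit : ∀ j → fitsᶜ (c (toℕ j)) (lookup κ j) ≡ true
    fit Fin.zero = proj₁ parts
    fit (Fin.suc Fin.zero) = proj₁ (proj₂ parts)
    fit (Fin.suc (Fin.suc Fin.zero)) = proj₁ (proj₂ (proj₂ parts))
    fit (Fin.suc (Fin.suc (Fin.suc Fin.zero))) = proj₁ (proj₂ (proj₂ (proj₂ parts)))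
    fit (Fin.suc (Fin.suc (Fin.suc (Fin.suc Fin.zero)))) = proj₂ (proj₂ (proj₂ (proj₂ parts)))

  any-sound : ∀ {A : Set} {Q : A → Set} (f : A → Bool) xs → (∀ x → f x ≡ true → Q x) → any f xs ≡ true → Any Q xs
  any-sound f (x ∷ xs) h p with f x in q
  ... | true = here (h x q)
  ... | false = there (any-sound f xs h p)

  uncovered : ¬ Any (HasStar G) starList → ∀ o d → dg d ≡ 5 → star o d covered ≡ false
  uncovered none o d p with star o d covered in q
  ... | false = refl
  ... | true = ⊥-elim (Rotations.rots-elim system o d p (λ a b c d e → any (λ κ → fitsStar κ a b c d e) starList)
    (λ o′ e ar r → none (any-sound (λ κ → star o′ e (fitsStar κ)) starList
      (λ κ → fitsStar-sound o′ (proj₁ e) (proj₂ e) κ (Rotations.Around.dg-e ar)) r)) q)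

-- The balance at an arbitrary vertex

nested+ : ∀ a b c d e → a + (b + (c + (d + (e + 0)))) ≡ a + b + c + d + e
nested+ = solve-∀

settle₅ : ∀ c k o x → c ≡ 1680 * k → 1680 + o ≤ x → o + (c + 1680) ≤ 1680 * k + x
settle₅ c k o x refl h = ≤-trans (≤-reflexive (trans (+-comm o (1680 * k + 1680)) (+-assoc (1680 * k) 1680 o)))
  (+-monoʳ-≤ (1680 * k) h)

module Vertices (sys : DartSystem) (uncov : Uncovered sys) where
  open DartSystem sys
  open Local sys
  open Payments sys
  open Bounds sys uncov
  open FiveVertex sys uncov
  open Fives sys uncov
  open Balance sys uncov
  open Degrees sys
  open Parity sys uncov

  pay-5 : ∀ o d → dg d ≢ 5 → pay o d ≡ 0
  pay-5 o d ≢5 = n≤0⇒n≡0 (+-mono-≤ (+-mono-≤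
    (if-≤ (poorAt o (R d)) {y = 0} λ q → ⊥-elim (≢5 (FactsX.dg-u o d q)))
    (if-≤ (condZ o (S o (R d))) {y = 0} λ q → let open PoorZ (condZ-sound o (S o (R d)) q) in
      ⊥-elim (≢5 (trans (cong dg (sym (RR d))) (dgR-5 (R d)
        (trans (cong t (trans (sym (S-inv′ o (R d))) (sym (S⁴ o _ dg-v)))) tz))))))
    (if-≤ (condY o d (R d)) {y = 0} λ q → ⊥-elim (≢5 (FactsY.dg-u o d q))))

  take-5 : ∀ d → dg d ≡ 5 → take d ≡ 0
  take-5 d p rewrite p with is5 (t d)
  ... | true = refl
  ... | false = refl

  orbit-zero : ∀ F d → (∀ e → dg e ≡ dg d → F e ≡ 0) → orbit F d ≡ 0
  orbit-zero F d h = trans (∑-cong (dg d) (λ j → h (d ↻ j) (dg-↻ j d))) (trans (∑-const (dg d) 0) (*-zeroʳ (dg d)))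

  orbit-5 : ∀ F d → dg d ≡ 5 → orbit F d ≡ fiveSum true F d
  orbit-5 F d p = trans (cong (λ k → ∑ k (λ j → F (d ↻ j))) p) (nested+ (F d) (F (N d)) _ _ _)

  -- The final charge at a vertex is at most 0, written without subtraction: what it gives plus 6
  -- units (10080) is at most its degree, its corners off triangles and what it gets. At degree 5
  -- the degree accounts for 8400, which leaves the 1680 of `Balanced`.
  settled : ∀ d → orbit take d + orbit out d + 10080 ≤
    1680 * dg d + (840 * orbit nt d + (orbit taken d + orbit received d))
  settled d with m≤n⇒m<n∨m≡n (5≤dg d)
  ... | inj₁ 6≤ = ≤-trans (≤-reflexive (cong (_+ 10080) (trans (cong (orbit take d +_) no-out) (+-identityʳ (orbit take d)))))
      (≤-trans (orbit-take d 6≤) (m≤m+n (1680 * dg d) _))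
    where
    ≢5 : ∀ e → dg e ≡ dg d → dg e ≢ 5
    ≢5 e p q = <⇒≢ 6≤ (sym (trans (sym p) q))
    no-out : orbit out d ≡ 0
    no-out = orbit-zero out d (λ e p → cong₂ _+_ (pay-5 true e (≢5 e p)) (pay-5 false e (≢5 e p)))
  ... | inj₂ eq = ≤-trans (≤-reflexive (cong (_+ 10080) (cong₂ _+_ no-take (orbit-5 out d p))))
      (≤-trans (settle₅ 8400 (dg d) (fiveSum true out d) _ (cong (1680 *_) eq) (balanced d p))
        (≤-reflexive (cong (1680 * dg d +_) (sym (cong₂ (λ n m → 840 * n + m) (orbit-5 nt d p)
          (cong₂ _+_ (orbit-5 taken d p) (orbit-5 received d p)))))))
    where
    p = sym eq
    no-take : orbit take d ≡ 0
    no-take = orbit-zero take d (λ e q → take-5 e (trans q p))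

-- Sums over all darts

module _ {A : Set} where
  sum-map-+ : ∀ (f g : A → ℕ) xs → sum (map (λ x → f x + g x) xs) ≡ sum (map f xs) + sum (map g xs)
  sum-map-+ f g [] = refl
  sum-map-+ f g (x ∷ xs) = trans (cong (f x + g x +_) (sum-map-+ f g xs)) (interchange+ (f x) (g x) _ _)

  sum-map-* : ∀ c (f : A → ℕ) xs → sum (map (λ x → c * f x) xs) ≡ c * sum (map f xs)
  sum-map-* c f [] = sym (*-zeroʳ c)
  sum-map-* c f (x ∷ xs) = trans (cong (c * f x +_) (sum-map-* c f xs)) (sym (*-distribˡ-+ c (f x) (sum (map f xs))))

  sum-map-≤ : ∀ {f g : A → ℕ} xs → (∀ x → f x ≤ g x) → sum (map f xs) ≤ sum (map g xs)
  sum-map-≤ [] h = z≤n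
  sum-map-≤ (x ∷ xs) h = +-mono-≤ (h x) (sum-map-≤ xs h)

  sum-map-≡ : ∀ {f g : A → ℕ} xs → (∀ x → f x ≡ g x) → sum (map f xs) ≡ sum (map g xs)
  sum-map-≡ [] h = refl
  sum-map-≡ (x ∷ xs) h = cong₂ _+_ (h x) (sum-map-≡ xs h)

  sum-map-const : ∀ c (xs : List A) → sum (map (λ _ → c) xs) ≡ length xs * c
  sum-map-const c [] = refl
  sum-map-const c (x ∷ xs) = cong (c +_) (sum-map-const c xs)

  sum-map-concatMap : ∀ {B : Set} (F : A → ℕ) (g : B → List A) xs →
    sum (map F (concatMap g xs)) ≡ sum (map (λ x → sum (map F (g x))) xs)
  sum-map-concatMap F g [] = refl
  sum-map-concatMap F g (x ∷ xs) = trans (cong sum (map-++ F (g x) (concatMap g xs)))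
    (trans (sum-++ (map F (g x)) (map F (concatMap g xs))) (cong (sum (map F (g x)) +_) (sum-map-concatMap F g xs)))

  sum-∈ : ∀ (f : A → ℕ) {xs x} → x ∈ xs → f x ≤ sum (map f xs)
  sum-∈ f (here refl) = m≤m+n _ _
  sum-∈ f {y ∷ xs} (there p) = ≤-trans (sum-∈ f p) (m≤n+m _ (f y))

  -- Applied to the reversal of darts, where it says that all charge given is received, and to the
  -- predecessor on a face, where it moves weights along faces.
  sum-permuted : ∀ (F : A → ℕ) {π ψ : A → A} {xs : List A} → (∀ x → π (ψ x) ≡ x) → (∀ x → ψ (π x) ≡ x) →
    Unique xs → (∀ x → x ∈ xs) → sum (map (λ x → F (π x)) xs) ≡ sum (map F xs)
  sum-permuted F {π} {ψ} {xs} πψ ψπ u full = trans (cong sum (map-∘ xs)) (sum-↭ (Perm.map⁺ F perm))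
    where
    perm : map π xs ↭ xs
    perm = ∼bag⇒↭ (unique∧set⇒bag (Unique.map⁺ (λ {x} {y} q → trans (sym (ψπ x)) (trans (cong ψ q) (ψπ y))) u) u
      (λ {x} → mk⇔ (λ _ → full x) (λ _ → subst (_∈ map π xs) (πψ x) (∈-map⁺ π (full (ψ x))))))

sum-tabulate : ∀ {d} (h : Fin d → ℕ) g → (∀ i → h i ≡ g (toℕ i)) → sum (map h (allFin d)) ≡ ∑ d g
sum-tabulate h g q = trans (cong sum (map-tabulate (λ i → i) h)) (go h g q)
  where
  go : ∀ {d} (h : Fin d → ℕ) g → (∀ i → h i ≡ g (toℕ i)) → sum (tabulate h) ≡ ∑ d g
  go {zero} h g q = refl
  go {suc d} h g q = cong₂ _+_ (q Fin.zero) (go (λ i → h (Fin.suc i)) (λ j → g (suc j)) (λ i → q (Fin.suc i)))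

module DartSums (G : RotationGraph) (md : MinDegree≥ G 5) where
  open RotationGraph G
  open Instance G md
  open Degrees system

  darts : List (Dart G)
  darts = allDarts G

  dartSum : (Dart G → ℕ) → ℕ
  dartSum F = sum (map F darts)

  ∈-darts : ∀ d → d ∈ darts
  ∈-darts (v , i) = ∈-concatMap⁺ (λ v → map (v ,_) (allFin (deg v)))
    (Any.map (λ { refl → ∈-map⁺ (v ,_) (∈-allFin i) }) (∈-allFin v))

  unique-darts : Unique darts
  unique-darts = Unique.concat⁺
    (All.map⁺ (AllM.tabulate λ {v} _ → Unique.map⁺ (λ { refl → refl }) (Unique.allFin⁺ (deg v))))
    (AllPairs.map⁺ (AllPairs.tabulate⁺ λ {i} {j} i≢j {d} (p , q) →
      i≢j (trans (sym (source p)) (source q))))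
    where
    source : ∀ {v d} → d ∈ map (v ,_) (allFin (deg v)) → proj₁ d ≡ v
    source {v} p with _ , _ , refl ← ∈-map⁻ (v ,_) p = refl

  dartSum-flip : ∀ F → dartSum (λ d → F (flipᵈ d)) ≡ dartSum F
  dartSum-flip F = sum-permuted F flip-flip flip-flip unique-darts ∈-darts

  first : ∀ {d} → 5 ≤ d → Σ[ i ∈ Fin d ] toℕ i ≡ 0
  first (s≤s _) = Fin.zero , refl

  root : Fin n → Dart G
  root v = v , proj₁ (first (md v))

  iterate-first : ∀ {d} (i z : Fin d) → toℕ z ≡ 0 → iterate (next G) (toℕ i) z ≡ i
  iterate-first {suc m} i z q = toℕ-injective (trans (toℕ-iterate (toℕ i) z)
    (trans (cong (λ x → (x + toℕ i) % suc m) q) (toℕ-% i)))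

  dartSum-orbits : ∀ F → dartSum F ≡ sum (map (λ v → orbit F (root v)) (allFin n))
  dartSum-orbits F = trans (sum-map-concatMap F _ (allFin n)) (sum-map-≡ (allFin n) λ v →
    trans (cong sum (sym (map-∘ (allFin (deg v))))) (sum-tabulate _ _ λ i →
      cong F (sym (trans (iterate-nextᵈ (toℕ i) v _) (cong (v ,_) (iterate-first i _ (proj₂ (first (md v)))))))))

-- Euler's formula

≡ᵇ-sound : ∀ m n → (m ≡ᵇ n) ≡ true → m ≡ n
≡ᵇ-sound m n p = ≡ᵇ⇒≡ m n (subst T (sym p) _)

<ᵇ-sound : ∀ m n → (m <ᵇ n) ≡ true → m < n
<ᵇ-sound m n p = <ᵇ⇒< m n (subst T (sym p) _)

∧-both : ∀ a {b} → a ∧ b ≡ true → a ≡ true × b ≡ true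
∧-both true p = refl , p

module Faces (G : RotationGraph) (md : MinDegree≥ G 5) (nonempty : 1 ≤ RotationGraph.n G) where
  open RotationGraph G
  open Instance G md
  open DartSums G md

  σ τ : Dart G → Dart G
  σ = faceStep G
  τ d = flipᵈ (prevᵈ d)

  στ : ∀ d → σ (τ d) ≡ d
  στ d = trans (cong nextᵈ (flip-flip (prevᵈ d))) (DartSystem.NP system d)

  τσ : ∀ d → τ (σ d) ≡ d
  τσ d = trans (cong flipᵈ (DartSystem.PN system (flipᵈ d))) (flip-flip d)

  σ-injective : ∀ {d e} → σ d ≡ σ e → d ≡ e
  σ-injective {d} {e} p = trans (sym (τσ d)) (trans (cong τ p) (τσ e))

  dartLeq-antisym : ∀ d e → dartLeq G d e ≡ true → dartLeq G e d ≡ true → d ≡ e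
  dartLeq-antisym (v , i) (w , j) p q
    with ∨-elim (toℕ v <ᵇ toℕ w) p | ∨-elim (toℕ w <ᵇ toℕ v) q
  ... | inj₁ a | inj₁ b = ⊥-elim (<-asym (<ᵇ-sound (toℕ v) (toℕ w) a) (<ᵇ-sound (toℕ w) (toℕ v) b))
  ... | inj₁ a | inj₂ b = ⊥-elim (<⇒≢ (<ᵇ-sound (toℕ v) (toℕ w) a)
    (sym (≡ᵇ-sound (toℕ w) (toℕ v) (proj₁ (∧-both (toℕ w ≡ᵇ toℕ v) b)))))
  ... | inj₂ a | inj₁ b = ⊥-elim (<⇒≢ (<ᵇ-sound (toℕ w) (toℕ v) b)
    (sym (≡ᵇ-sound (toℕ v) (toℕ w) (proj₁ (∧-both (toℕ v ≡ᵇ toℕ w) a)))))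
  ... | inj₂ a | inj₂ b with toℕ-injective {i = v} {w} (≡ᵇ-sound (toℕ v) (toℕ w) (proj₁ (∧-both (toℕ v ≡ᵇ toℕ w) a)))
  ... | refl = cong (v ,_) (toℕ-injective (≤-antisym
    (≤ᵇ-sound (proj₂ (∧-both (toℕ v ≡ᵇ toℕ v) a))) (≤ᵇ-sound (proj₂ (∧-both (toℕ v ≡ᵇ toℕ v) b)))))

  rep-minimal : ∀ d → isFaceRep G d ≡ true → ∀ k → k < numDarts G → dartLeq G d (faceIter G k d) ≡ true
  rep-minimal d p k q = all-sound (λ k → dartLeq G d (faceIter G k d)) (upTo (numDarts G)) p (∈-upTo⁺ q)

  faceIter-+ : ∀ m k d → faceIter G (m + k) d ≡ faceIter G k (faceIter G m d)
  faceIter-+ zero k d = refl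
  faceIter-+ (suc m) k d = faceIter-+ m k (σ d)

  faceIter-injective : ∀ k {d e} → faceIter G k d ≡ faceIter G k e → d ≡ e
  faceIter-injective zero p = p
  faceIter-injective (suc k) p = σ-injective (faceIter-injective k p)

  -- Pigeonhole among `numDarts + 1` iterates, then cancellation by injectivity. The bound on the
  -- period is essential because `isFaceRep` inspects only iterates below `numDarts`.
  return : ∀ d → ∃[ p ] 1 ≤ p × p ≤ numDarts G × faceIter G p d ≡ d
  return d with Finₚ.pigeonhole (n<1+n (numDarts G)) (λ k → index (∈-darts (faceIter G (toℕ k) d)))
  ... | i , j , i<j , q = toℕ j ∸ toℕ i , m<n⇒0<n∸m i<j , ≤-trans (m∸n≤m (toℕ j) (toℕ i)) (≤-pred (toℕ<n j)) ,
    sym (faceIter-injective (toℕ i) (trans same (trans (cong (λ k → faceIter G k d)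
      (sym (trans (+-comm (toℕ j ∸ toℕ i) (toℕ i)) (m+[n∸m]≡n (<⇒≤ i<j))))) (faceIter-+ (toℕ j ∸ toℕ i) (toℕ i) d))))
    where
    same : faceIter G (toℕ i) d ≡ faceIter G (toℕ j) d
    same = trans (lookup-index (∈-darts (faceIter G (toℕ i) d))) (trans (cong (List.lookup darts) q)
      (sym (lookup-index (∈-darts (faceIter G (toℕ j) d)))))

  no-1-face : ∀ d → σ d ≢ d
  no-1-face (v , i) p = loopless v i (cong proj₁ p)

  -- Such a face would leave the second vertex along the edge by which it came. As there are no
  -- parallel edges, `next` would then fix a position, although the degree exceeds 1.
  no-2-face : ∀ d → σ (σ d) ≢ d
  no-2-face (v , i) p = next-≢ (≤-trans (≤ᵇ-sound refl) (md (nb v i))) (rev v i)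
    (nb-inj (nb v i) _ _ (trans (cong proj₁ p) (sym (nb-rev v i))))

  dartSum-one : dartSum (λ _ → 1) ≡ numDarts G
  dartSum-one = trans (sum-map-const 1 darts) (*-identityʳ (length darts))

  orbit-one : ∀ d → Degrees.orbit system (λ _ → 1) d ≡ deg (proj₁ d)
  orbit-one d = trans (∑-const (deg (proj₁ d)) 1) (*-identityʳ _)

  -- Ensures that the range inspected by `isFaceRep` includes the first three face steps.
  3<darts : 3 < numDarts G
  3<darts = begin-strict
    3 <⟨ ≤ᵇ-sound {4} {5} refl ⟩
    5 ≤⟨ md v ⟩
    deg v ≡⟨ orbit-one (root v) ⟨
    Degrees.orbit system (λ _ → 1) (root v) ≤⟨ sum-∈ (λ v → Degrees.orbit system (λ _ → 1) (root v)) (∈-allFin v) ⟩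
    sum (map (λ v → Degrees.orbit system (λ _ → 1) (root v)) (allFin n)) ≡⟨ dartSum-orbits (λ _ → 1) ⟨
    dartSum (λ _ → 1) ≡⟨ dartSum-one ⟩
    numDarts G ∎
    where
    open ≤-Reasoning
    v : Fin n
    v = Fin.fromℕ< nonempty

  return-≥3 : ∀ d p → 1 ≤ p → faceIter G p d ≡ d → 3 ≤ p
  return-≥3 d 1 _ q = ⊥-elim (no-1-face d q)
  return-≥3 d 2 _ q = ⊥-elim (no-2-face d q)
  return-≥3 d (suc (suc (suc p))) _ _ = s≤s (s≤s (s≤s z≤n))

  -- The second representative is reached from the first by `m` steps and the first from the second
  -- by `p ∸ m` steps, where `p` is a period. Both counts are below `numDarts`, so each dart is at
  -- most the other in the order.
  separate : ∀ m → 1 ≤ m → m ≤ 3 → ∀ b → isFaceRep G b ≡ true → isFaceRep G (faceIter G m b) ≡ true →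
    faceIter G m b ≡ b
  separate m 1≤m m≤3 b rb ra with return b
  ... | p , 1≤p , p≤D , q = sym (dartLeq-antisym b a (rep-minimal b rb m (≤-<-trans m≤3 3<darts))
    (subst (λ x → dartLeq G a x ≡ true) back (rep-minimal a ra (p ∸ m) (<-≤-trans (∸-monoʳ-< 1≤m m≤p) p≤D))))
    where
    a = faceIter G m b
    m≤p : m ≤ p
    m≤p = ≤-trans m≤3 (return-≥3 b p 1≤p q)
    back : faceIter G (p ∸ m) a ≡ b
    back = trans (sym (faceIter-+ m (p ∸ m) b)) (trans (cong (λ k → faceIter G k b) (m+[n∸m]≡n m≤p)) q)

  triᵈ-τ : ∀ d → triᵈ (τ d) ≡ triᵈ d
  triᵈ-τ d = same (λ p → triᵈ-complete d (trans (cong (λ x → σ (σ (σ x))) (sym (στ d)))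
      (trans (cong σ (triᵈ-sound (τ d) p)) (στ d))))
    (λ p → triᵈ-complete (τ d) (σ-injective (trans (cong (λ x → σ (σ (σ x))) (στ d)) (trans (triᵈ-sound d p) (sym (στ d))))))
    where
    same : ∀ {a b} → (a ≡ true → b ≡ true) → (b ≡ true → a ≡ true) → a ≡ b
    same {true} h k = sym (h refl)
    same {false} {false} h k = refl
    same {false} {true} h k = k refl

  not-both : ∀ {a b} → (a ≡ true → b ≡ true → ⊥) → a ∧ b ≡ false
  not-both {true} {true} h = ⊥-elim (h refl refl)
  not-both {true} {false} h = refl
  not-both {false} h = refl

  coincide : ∀ m → 1 ≤ m → m ≤ 3 → ∀ {d b} → faceIter G m b ≡ d → isFaceRep G d ≡ true → isFaceRep G b ≡ true → d ≡ b
  coincide m p q {b = b} refl ra rb = separate m p q b rb ra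

  σ²τ² : ∀ d → σ (σ (τ (τ d))) ≡ d
  σ²τ² d = trans (cong σ (στ (τ d))) (στ d)

  σ³τ³ : ∀ d → σ (σ (σ (τ (τ (τ d))))) ≡ d
  σ³τ³ d = trans (cong (λ x → σ (σ x)) (στ (τ (τ d)))) (σ²τ² d)

  not-both-1 : ∀ d → isFaceRep G d ∧ isFaceRep G (τ d) ≡ false
  not-both-1 d = not-both λ a b →
    no-1-face (τ d) (trans (στ d) (coincide 1 (≤ᵇ-sound refl) (≤ᵇ-sound refl) (στ d) a b))

  not-both-2 : ∀ d → isFaceRep G d ∧ isFaceRep G (τ (τ d)) ≡ false
  not-both-2 d = not-both λ a b →
    no-2-face (τ (τ d)) (trans (σ²τ² d) (coincide 2 (≤ᵇ-sound refl) (≤ᵇ-sound refl) (σ²τ² d) a b))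

  not-both-3 : ∀ d → triᵈ d ≡ false → isFaceRep G d ∧ isFaceRep G (τ (τ (τ d))) ≡ false
  not-both-3 d nt = not-both λ a b → absurd (coincide 3 (≤ᵇ-sound refl) (≤ᵇ-sound refl) (σ³τ³ d) a b)
    where
    absurd : d ≡ τ (τ (τ d)) → ⊥
    absurd q with () ← trans (sym nt) (triᵈ-complete d (trans (cong (λ x → σ (σ (σ x))) q) (σ³τ³ d)))

  one-of-3 : ∀ a b c → a ∧ b ≡ false → b ∧ c ≡ false → a ∧ c ≡ false → bit a + bit b + bit c ≤ 1
  one-of-3 true false false _ _ _ = ≤-refl
  one-of-3 false true false _ _ _ = ≤-refl
  one-of-3 false false c _ _ _ with c
  ... | true = ≤-refl
  ... | false = z≤n

  one-of-4 : ∀ a b c d → a ∧ b ≡ false → b ∧ c ≡ false → c ∧ d ≡ false → a ∧ c ≡ false → b ∧ d ≡ false → a ∧ d ≡ false →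
    bit a + bit b + bit c + bit d ≤ 1
  one-of-4 a b c false p q r s u v = subst (_≤ 1) (sym (+-identityʳ _)) (one-of-3 a b c p q s)
  one-of-4 false false false true p q r s u v = ≤-refl

  nt : Dart G → ℕ
  nt d = bit (not (triᵈ d))

  inTri inLarge : Dart G → ℕ
  inTri d = bit (triᵈ d) * bit (isFaceRep G d)
  inLarge d = nt d * bit (isFaceRep G d)

  -- Each face representative hands its weight 12 to four darts of its face, or to the
  -- three darts of a triangle, and no dart receives from two representatives.
  pointwise : ∀ d → 4 * (inTri d + inTri (τ d) + inTri (τ (τ d))) +
    3 * (inLarge d + inLarge (τ d) + inLarge (τ (τ d)) + inLarge (τ (τ (τ d)))) + nt d ≤ 4
  pointwise d rewrite triᵈ-τ (τ (τ d)) | triᵈ-τ (τ d) | triᵈ-τ d with triᵈ d in q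
  ... | true = tri-case (bit (isFaceRep G d)) (bit (isFaceRep G (τ d))) (bit (isFaceRep G (τ (τ d))))
    (one-of-3 (isFaceRep G d) (isFaceRep G (τ d)) (isFaceRep G (τ (τ d))) (not-both-1 d) (not-both-1 (τ d)) (not-both-2 d))
    where
    tri-case : ∀ a b c → a + b + c ≤ 1 → 4 * (1 * a + 1 * b + 1 * c) + 0 + 0 ≤ 4
    tri-case a b c h = subst (_≤ 4) (eq a b c) (*-monoʳ-≤ 4 h)
      where
      eq : ∀ a b c → 4 * (a + b + c) ≡ 4 * (1 * a + 1 * b + 1 * c) + 0 + 0
      eq = solve-∀
  ... | false = large-case (bit (isFaceRep G d)) (bit (isFaceRep G (τ d))) (bit (isFaceRep G (τ (τ d)))) (bit (isFaceRep G (τ (τ (τ d)))))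
    (one-of-4 (isFaceRep G d) (isFaceRep G (τ d)) (isFaceRep G (τ (τ d))) (isFaceRep G (τ (τ (τ d)))) (not-both-1 d) (not-both-1 (τ d))
      (not-both-1 (τ (τ d))) (not-both-2 d) (not-both-2 (τ d)) (not-both-3 d q))
    where
    large-case : ∀ a b c e → a + b + c + e ≤ 1 → 0 + 3 * (1 * a + 1 * b + 1 * c + 1 * e) + 1 ≤ 4
    large-case a b c e h = subst (_≤ 4) (eq a b c e) (+-monoˡ-≤ 1 (*-monoʳ-≤ 3 h))
      where
      eq : ∀ a b c e → 3 * (a + b + c + e) + 1 ≡ 0 + 3 * (1 * a + 1 * b + 1 * c + 1 * e) + 1
      eq = solve-∀

  dartSum-τ : ∀ F → dartSum (λ d → F (τ d)) ≡ dartSum F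
  dartSum-τ F = sum-permuted F τσ στ unique-darts ∈-darts

  dartSum-+ : ∀ F H → dartSum (λ d → F d + H d) ≡ dartSum F + dartSum H
  dartSum-+ F H = sum-map-+ F H darts

  dartSum-* : ∀ c F → dartSum (λ d → c * F d) ≡ c * dartSum F
  dartSum-* c F = sum-map-* c F darts

  faces-bound : 12 * numFaces G + dartSum nt ≤ 4 * numDarts G
  faces-bound = begin
    12 * numFaces G + dartSum nt ≡⟨ cong (λ f → 12 * f + dartSum nt) faces ⟩
    12 * (a + b) + dartSum nt ≡⟨ spread a b (dartSum nt) ⟩
    4 * (a + a + a) + 3 * (b + b + b + b) + dartSum nt
      ≡⟨ cong₂ (λ x y → 4 * x + 3 * y + dartSum nt) (sym a³) (sym b⁴) ⟩
    4 * dartSum A + 3 * dartSum B + dartSum nt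
      ≡⟨ cong (_+ dartSum nt) (cong₂ _+_ (sym (dartSum-* 4 A)) (sym (dartSum-* 3 B))) ⟩
    dartSum (λ d → 4 * A d) + dartSum (λ d → 3 * B d) + dartSum nt
      ≡⟨ trans (cong (_+ dartSum nt) (sym (dartSum-+ (λ d → 4 * A d) (λ d → 3 * B d)))) (sym (dartSum-+ (λ d → 4 * A d + 3 * B d) nt)) ⟩
    dartSum (λ d → 4 * A d + 3 * B d + nt d) ≤⟨ sum-map-≤ darts pointwise ⟩
    dartSum (λ _ → 4) ≡⟨ trans (sum-map-const 4 darts) (*-comm (length darts) 4) ⟩
    4 * numDarts G ∎
    where
    open ≤-Reasoning
    a = dartSum inTri
    b = dartSum inLarge
    A B : Dart G → ℕ
    A d = inTri d + inTri (τ d) + inTri (τ (τ d))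
    B d = inLarge d + inLarge (τ d) + inLarge (τ (τ d)) + inLarge (τ (τ (τ d)))
    spread : ∀ a b m → 12 * (a + b) + m ≡ 4 * (a + a + a) + 3 * (b + b + b + b) + m
    spread = solve-∀
    twice : ∀ F → dartSum (λ d → F (τ (τ d))) ≡ dartSum F
    twice F = trans (dartSum-τ (λ d → F (τ d))) (dartSum-τ F)
    three : ∀ F → dartSum (λ d → F d + F (τ d) + F (τ (τ d))) ≡ dartSum F + dartSum F + dartSum F
    three F = trans (dartSum-+ (λ d → F d + F (τ d)) (λ d → F (τ (τ d)))) (cong₂ _+_
      (trans (dartSum-+ F (λ d → F (τ d))) (cong (dartSum F +_) (dartSum-τ F))) (twice F))
    a³ : dartSum A ≡ a + a + a
    a³ = three inTri
    b⁴ : dartSum B ≡ b + b + b + b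
    b⁴ = trans (dartSum-+ (λ d → inLarge d + inLarge (τ d) + inLarge (τ (τ d))) (λ d → inLarge (τ (τ (τ d)))))
      (cong₂ _+_ (three inLarge) (trans (dartSum-τ (λ d → inLarge (τ (τ d)))) (twice inLarge)))
    isolated : ∀ v → (if deg v ≡ᵇ 0 then 1 else 0) ≡ 0
    isolated v with deg v | md v
    ... | suc _ | _ = refl
    reps : ∀ d → (if isFaceRep G d then 1 else 0) ≡ inTri d + inLarge d
    reps d with triᵈ d | isFaceRep G d
    ... | true | true = refl
    ... | true | false = refl
    ... | false | true = refl
    ... | false | false = refl
    faces : numFaces G ≡ a + b
    faces = trans (cong₂ _+_ (trans (sum-map-≡ darts reps) (dartSum-+ inTri inLarge))
      (trans (sum-map-≡ (allFin n) isolated) (trans (sum-map-const 0 (allFin n)) (*-zeroʳ (length (allFin n))))))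
      (+-identityʳ (a + b))

  -- The vertex with index 0 is the least of its component. One component already makes the surplus
  -- in Euler's formula positive.
  some-component : 1 ≤ numComponents G
  some-component = subst (_≤ numComponents G) (cong (λ b → if b then 1 else 0) minimal)
    (sum-∈ (λ v → if isCompRep G v then 1 else 0) (∈-allFin v))
    where
    v : Fin n
    v = Fin.fromℕ< nonempty
    all-true : ∀ {A : Set} (f : A → Bool) xs → (∀ x → f x ≡ true) → all f xs ≡ true
    all-true f [] h = refl
    all-true f (x ∷ xs) h rewrite h x = all-true f xs h
    minimal : isCompRep G v ≡ true
    minimal = all-true _ (allFin n) λ u →
      trans (cong (λ k → not (reachable G v u) ∨ (k ≤ᵇ toℕ u)) (toℕ-fromℕ< nonempty)) (∨-zeroʳ _)

-- Decidability of stars and the final contradiction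

module _ (G : RotationGraph) where
  open RotationGraph G

  fits? : ∀ d κ → Dec (Fits G d κ)
  fits? d nothing = yes _
  fits? d (just k) = d ≤? k

  bool? : ∀ {P : Bool → Set} → (∀ o → Dec (P o)) → Dec (Σ Bool P)
  bool? p with p true | p false
  ... | yes x | _ = yes (true , x)
  ... | no _ | yes y = yes (false , y)
  ... | no ¬x | no ¬y = no λ { (true , x) → ¬x x ; (false , y) → ¬y y }

  -- Discharging only refutes the absence of all stars; decidability turns this refutation into an
  -- actual star.
  hasStar? : ∀ κ → Dec (HasStar G κ)
  hasStar? κ = Finₚ.any? λ v → at v (deg v ≟ 5)
    where
    At : ∀ v → deg v ≡ 5 → Set
    At v e = Σ[ s ∈ Fin 5 ] Σ[ o ∈ Bool ] (∀ i → Fits G (deg (nb v (cast (sym e) (pos G s o i)))) (lookup κ i))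
    at : ∀ v → Dec (deg v ≡ 5) → Dec (Σ (deg v ≡ 5) (At v))
    at v (no ¬e) = no λ { (e , _) → ¬e e }
    at v (yes e) = map′ (e ,_) (λ { (e′ , x) → subst (At v) (≡-irrelevant e′ e) x })
      (Finₚ.any? λ s → bool? λ o → Finₚ.all? λ i → fits? _ (lookup κ i))

-- The bound on charges is added to 840 times the bound on faces and compared with 5040 times
-- Euler's formula. All terms cancel except 20160 * c.
euler-contradiction : ∀ n F D c M → 2 * n + 2 * F ≡ D + 4 * c → 1 ≤ c → 12 * F + M ≤ 4 * D →
  10080 * n ≤ 1680 * D + 840 * M → ⊥
euler-contradiction n F D c M euler 1≤c faces charges = <-irrefl refl (begin-strict
  10080 * n + (10080 * F + 840 * M) ≤⟨ +-mono-≤ charges (subst (_≤ 3360 * D) (e₁ F M) (subst (840 * (12 * F + M) ≤_) (e₂ D) (*-monoʳ-≤ 840 faces))) ⟩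
  (1680 * D + 840 * M) + 3360 * D ≡⟨ e₃ D M ⟩
  5040 * D + 840 * M <⟨ m<m+n (5040 * D + 840 * M) (≤-trans (s≤s z≤n) (*-monoʳ-≤ 20160 1≤c)) ⟩
  (5040 * D + 840 * M) + 20160 * c ≡⟨ e₄ D M c ⟩
  5040 * (D + 4 * c) + 840 * M ≡⟨ cong (λ x → 5040 * x + 840 * M) euler ⟨
  5040 * (2 * n + 2 * F) + 840 * M ≡⟨ e₅ n F M ⟩
  10080 * n + (10080 * F + 840 * M) ∎)
  where
  open ≤-Reasoning
  e₁ : ∀ F M → 840 * (12 * F + M) ≡ 10080 * F + 840 * M
  e₁ = solve-∀
  e₂ : ∀ D → 840 * (4 * D) ≡ 3360 * D
  e₂ = solve-∀
  e₃ : ∀ D M → (1680 * D + 840 * M) + 3360 * D ≡ 5040 * D + 840 * M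
  e₃ = solve-∀
  e₄ : ∀ D M c → (5040 * D + 840 * M) + 20160 * c ≡ 5040 * (D + 4 * c) + 840 * M
  e₄ = solve-∀
  e₅ : ∀ n F M → 5040 * (2 * n + 2 * F) + 840 * M ≡ 10080 * n + (10080 * F + 840 * M)
  e₅ = solve-∀

module Discharged (G : RotationGraph) (nonempty : 1 ≤ RotationGraph.n G) (md : MinDegree≥ G 5)
  (none : ¬ Any (HasStar G) starList) where
  open RotationGraph G
  open Instance G md
  open DartSums G md
  open Faces G md nonempty using (nt; dartSum-one; orbit-one)
  open DartSystem system using (take; R)
  open FiveVertex system (uncovered none) using (out)
  open Degrees system using (orbit)
  open Vertices system (uncovered none) using (settled)

  vertexSum : (Fin n → ℕ) → ℕ
  vertexSum f = sum (map f (allFin n))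

  vertexSum-+ : ∀ f g → vertexSum (λ v → f v + g v) ≡ vertexSum f + vertexSum g
  vertexSum-+ f g = sum-map-+ f g (allFin n)

  orbits : ∀ F → vertexSum (λ v → orbit F (root v)) ≡ dartSum F
  orbits F = sym (dartSum-orbits F)

  degrees : vertexSum deg ≡ numDarts G
  degrees = trans (sum-map-≡ (allFin n) (λ v → sym (orbit-one (root v)))) (trans (orbits (λ _ → 1)) dartSum-one)

  -- Summing `settled` over the vertices puts the transfers on both sides, once indexed by the
  -- giving dart and once by its reverse, so they cancel.
  total-charge : 10080 * n ≤ 1680 * numDarts G + 840 * dartSum nt
  total-charge = +-cancelʳ-≤ (a + b) _ _ (begin
    10080 * n + (a + b) ≡⟨ +-comm (10080 * n) (a + b) ⟩
    a + b + 10080 * n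
      ≡⟨ cong₂ _+_ (sym (trans (vertexSum-+ _ _) (cong₂ _+_ (orbits take) (orbits out))))
         (trans (*-comm 10080 n) (sym constant)) ⟩
    vertexSum (λ v → orbit take (root v) + orbit out (root v)) + vertexSum (λ _ → 10080) ≡⟨ vertexSum-+ _ _ ⟨
    vertexSum (λ v → orbit take (root v) + orbit out (root v) + 10080) ≤⟨ sum-map-≤ (allFin n) (λ v → settled (root v)) ⟩
    vertexSum (λ v → 1680 * deg v + (840 * orbit nt (root v) + (orbit (λ e → take (R e)) (root v) + orbit (λ e → out (R e)) (root v))))
      ≡⟨ trans (vertexSum-+ _ _) (cong₂ _+_ (trans (sum-map-* 1680 deg (allFin n)) (cong (1680 *_) degrees))
         (trans (vertexSum-+ _ _) (cong₂ _+_ (trans (sum-map-* 840 _ (allFin n)) (cong (840 *_) (orbits nt)))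
           (trans (vertexSum-+ _ _) (cong₂ _+_ (trans (orbits (λ e → take (R e))) (dartSum-flip take))
             (trans (orbits (λ e → out (R e))) (dartSum-flip out))))))) ⟩
    1680 * numDarts G + (840 * dartSum nt + (a + b)) ≡⟨ +-assoc (1680 * numDarts G) _ _ ⟨
    1680 * numDarts G + 840 * dartSum nt + (a + b) ∎)
    where
    open ≤-Reasoning
    a = dartSum take
    b = dartSum out
    vertices : length (allFin n) ≡ n
    vertices = length-tabulate (λ i → i)
    constant : vertexSum (λ _ → 10080) ≡ n * 10080
    constant = trans (sum-map-const 10080 (allFin n)) (cong (_* 10080) vertices)

theorem1 : (G : RotationGraph) → 1 ≤ RotationGraph.n G → IsPlane G →
    MinDegree≥ G 5 → Any (HasStar G) starList
theorem1 G nonempty plane md with Any.any? (hasStar? G) starList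
... | yes star = star
... | no none = ⊥-elim (euler-contradiction (RotationGraph.n G) (numFaces G) (numDarts G) (numComponents G)
  (DartSums.dartSum G md (Faces.nt G md nonempty)) plane (Faces.some-component G md nonempty)
  (Faces.faces-bound G md nonempty) (Discharged.total-charge G nonempty md none))
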